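{- Let $g(k)$ denote the smallest integer $N$ such that for every $n\ge N$ and every sequence of non-negative integers $(e_1,\dots,e_k)$ with $\sum_{i=1}^k e_i=\binom{n}{2}$, there exists a Gallai colouring of $K_n$ with colour distribution sequence $(e_1,\dots,e_k)$. Then \[g(k)=\Theta\!\left(\frac{k^{1.5}}{(\log k)^{0.5}}\right).\]
   Context: An edge colouring of $K_n$ with $k$ colours is a map $c:E(K_n)\to[k]$. It has colour distribution sequence $(e_1,\dots,e_k)$ if exactly $e_i$ edges receive colour $i$ for each $i\in[k]$. A Gallai colouring is an edge colouring of $K_n$ containing no rainbow triangle, i.e. no triangle whose three edges have three distinct colours. It is known (and used in the definition) that such an $N$ exists for every $k\ge 2$. -}

module Defs where

open import Data.Nat using (ℕ; _≤_; _*_; _^_)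
open import Data.Nat.Combinatorics using (_C_)
open import Data.Fin using (Fin; _<_; _≟_)
open import Data.Fin.Properties using (_<?_)
open import Data.List using (List; []; _∷_; length; filter; allFin; concatMap; tabulate)
open import Data.Nat.ListAction using (sum)
open import Data.Product using (_×_; _,_; proj₁; proj₂; Σ)
open import Relation.Binary.PropositionalEquality using (_≡_; _≢_)
open import Relation.Nullary using (¬_; yes; no)

-- An edge colouring of K_n with k colours: a colour for each unordered pair
-- {x,y}, x ≠ y, represented as a symmetric function on ordered pairs
-- (values on the diagonal are irrelevant and never used).
record EdgeColouring (n k : ℕ) : Set where
  field
    col : Fin n → Fin n → Fin k
    sym : ∀ x y → col x y ≡ col y x
open EdgeColouring public

edges : (n : ℕ) → List (Fin n × Fin n)
edges n = concatMap (λ x → concatMap (λ y → pairIf x y) (allFin n)) (allFin n)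
  where
  pairIf : Fin n → Fin n → List (Fin n × Fin n)
  pairIf x y with x <? y
  ... | yes _ = (x , y) ∷ []
  ... | no  _ = []

colourCount : ∀ {n k} → EdgeColouring n k → Fin k → ℕ
colourCount {n} c i = length (filter (λ e → col c (proj₁ e) (proj₂ e) ≟ i) (edges n))

HasDistribution : ∀ {n k} → EdgeColouring n k → (Fin k → ℕ) → Set
HasDistribution c e = ∀ i → colourCount c i ≡ e i

Rainbow : ∀ {n k} → EdgeColouring n k → Fin n → Fin n → Fin n → Set
Rainbow c x y z =
  (col c x y ≢ col c y z) × (col c y z ≢ col c x z) × (col c x z ≢ col c x y)

IsGallai : ∀ {n k} → EdgeColouring n k → Set
IsGallai {n} c = (x y z : Fin n) → x ≢ y → y ≢ z → x ≢ z → ¬ Rainbow c x y z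

GallaiProperty : (k N : ℕ) → Set
GallaiProperty k N =
  (n : ℕ) → N ≤ n → (e : Fin k → ℕ) → sum (tabulate e) ≡ n C 2 →
  Σ (EdgeColouring n k) (λ c → IsGallai c × HasDistribution c e)

IsG : (k N : ℕ) → Set
IsG k N = GallaiProperty k N × (∀ M → GallaiProperty k M → N ≤ M)

{-# OPTIONS --safe #-}
-- Lower bound.  Give half of the colours about k/16 edges each ("small") and spread the other edges evenly
-- over the remaining colours, E edges each.  Every Gallai coloured vertex set has a bipartition whose crossing
-- edges use at most two colours, both of them spanning; on more than 2s vertices, where s bounds the small
-- colours, these two are not small, so the sides satisfy |A||B| ≤ 2E.  Splitting recursively, the small
-- colours get only O(s² + E log n) edges, which is too few when n² log k ≪ k³.
--
-- Upper bound.  Build the colouring from the outside by peeling off vertices and blocks, each joined to the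
-- rest in one colour.  At geometrically decreasing scales β, blocks of size about α ~ E/β are peeled off by
-- frequent colours, and the rare colours (at most O(k) edges) are used up exactly inside these blocks: each
-- of the Θ(log k) scales offers room for about E rare edges.  Colours whose remaining number of edges is
-- comparable to β are used up exactly by peeling single vertices in a window [β, 5β) of levels.  In the end only
-- O(log k) colours are left, and these are removed one by one.
module Submission where

open import Defs
open import Data.Nat using (ℕ; _≤_; _*_; _^_)
open import Data.Nat.Logarithm using (⌊log₂_⌋)
open import Data.Nat.Logarithm using (⌊log₂⌋-mono-≤; ⌊log₂⌊n/2⌋⌋≡⌊log₂n⌋∸1; ⌊log₂[2^n]⌋≡n)
open import Data.Nat.Induction using (<-rec)
open import Data.Product using (_×_; Σ; ∃-syntax)

open import Data.Bool using (Bool; true; false; not; _∧_; _∨_; if_then_else_)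
import Data.Bool.Properties as Bool
open import Data.Empty using (⊥; ⊥-elim)
open import Data.Fin using (Fin; toℕ; fromℕ<; splitAt; _↑ˡ_; _↑ʳ_)
import Data.Fin as Fin
import Data.Fin.Properties as Fin
open import Data.List using (List; []; _∷_; length; filter; concatMap; allFin; tabulate; lookup)
open import Data.List.Properties using (filter-++; length-++; length-tabulate; filter-notAll)
open import Data.List.Membership.Propositional using (_∈_; _∉_; find; lose)
open import Data.List.Relation.Unary.Any using (here; there)
import Data.List.Relation.Unary.Any as Any
open import Data.List.Relation.Unary.Any.Properties using (lookup-index)
open import Data.List.Relation.Unary.All using ([]; _∷_)
import Data.List.Relation.Unary.All as All
open import Data.List.Relation.Unary.AllPairs using ([]; _∷_)
open import Data.List.Relation.Unary.Unique.Propositional using (Unique)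
import Data.List.Relation.Unary.Unique.Propositional.Properties as Unique
open import Data.List.Membership.Propositional.Properties using (∈-filter⁺; ∈-filter⁻; ∈-allFin)
open import Data.Maybe using (Maybe; just; nothing)
open import Data.Nat
open import Data.Nat.Combinatorics using (_C_; nCk+nC[k+1]≡[n+1]C[k+1]; nC1≡n)
open import Data.Nat.DivMod using (m≡m%n+[m/n]*n; m%n<n)
open import Data.Nat.ListAction using (sum)
open import Data.Nat.Properties
open import Data.Nat.Tactic.RingSolver using (solve-∀)
open import Data.Product using (_,_; proj₁; proj₂; ∃)
open import Data.Sum using (_⊎_; inj₁; inj₂; [_,_]′)
open import Function using (_∘_; id; case_of_)
open import Relation.Binary.PropositionalEquality using (_≡_; _≢_; refl; trans; cong; cong₂; subst; subst₂) renaming (sym to symm)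
open import Relation.Nullary using (Dec; yes; no; does; ¬_)
open import Relation.Nullary.Decidable using (_×-dec_; _⊎-dec_; _→-dec_; ¬?; map′; decidable-stable; dec-true; dec-false)
open import Relation.Binary using (tri<; tri≈; tri>)
open import Relation.Unary using (Decidable)

-- The order of g(k) comes from one balance. Rare colours have fewer than 4u edges, with u of order
-- k. Split into J classes, J of order log k, each with h² / 8 colours, they force h² to be of order
-- k / log k; the stages then start near level u h, which is of order k^1.5 / (log k)^0.5. The
-- obstacle in the upper bound is exactness. A rare colour has to be exhausted to the last edge, so
-- its demand is kept at zero or at least 4α: from there distinct free levels can be subtracted
-- until a final pair x, r - x ends it. A frequent colour must not get stuck at an awkward number of
-- edges, hence the gap between 2T and `G` = 2QT: what is stuck below 2T is either one colour, or
-- few edges from the start, or at most a fraction 1/Q of what there was. Which colours act as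
-- fillers depends on the course of the construction, so each phase receives the rest of the
-- construction as a continuation, valid for every outcome that keeps the invariants. In the lower
-- bound, the two colours of a cut have to be spanning because only this bounds their classes from
-- below. The cut is therefore built by adding vertices one at a time, with spanning as part of the
-- invariant.

-- Arithmetic

≡⇒≥ : ∀ {m n} → m ≡ n → n ≤ m
≡⇒≥ = ≤-reflexive ∘ symm

-- The number of edges of K_n as 0 + 1 + ... + (n - 1): the recursion removes a vertex with `n`
-- edges to the other `n` vertices, which is how colourings are built below.
tri : ℕ → ℕ
tri zero    = 0
tri (suc n) = n + tri n

tri-C : ∀ n → n C 2 ≡ tri n
tri-C zero    = refl
tri-C (suc n) = trans (symm (nCk+nC[k+1]≡[n+1]C[k+1] n 1)) (cong₂ _+_ (nC1≡n n) (tri-C n))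

tri-double : ∀ n → 2 * tri n + n ≡ n * n
tri-double zero    = refl
tri-double (suc n) = trans (step n (tri n)) (trans (cong (_+ (n + n + 1)) (tri-double n)) (square n))
  where
  step : ∀ n t → 2 * (n + t) + suc n ≡ 2 * t + n + (n + n + 1)
  step = solve-∀
  square : ∀ n → n * n + (n + n + 1) ≡ suc n * suc n
  square = solve-∀

tri-mono : ∀ {m n} → m ≤ n → tri m ≤ tri n
tri-mono z≤n       = z≤n
tri-mono (s≤s m≤n) = +-mono-≤ m≤n (tri-mono m≤n)

2tri≤² : ∀ n → 2 * tri n ≤ n * n
2tri≤² n = ≤-trans (m≤m+n _ n) (≤-reflexive (tri-double n))

²≤2tri-suc : ∀ n → n * n ≤ 2 * tri (suc n)
²≤2tri-suc n = ≤-trans (≤-trans (≡⇒≥ (tri-double n)) (m≤m+n _ n)) (≤-reflexive (rearrange n (tri n)))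
  where
  rearrange : ∀ n t → 2 * t + n + n ≡ 2 * (n + t)
  rearrange = solve-∀

-- A linear combination of hypotheses, given with the slack that makes it an identity.
≤-from : ∀ {l r a b} s → l ≤ r → b + l ≡ a + r + s → a ≤ b
≤-from {l} {r} {a} {b} s l≤r eq = +-cancelʳ-≤ r a b
  (≤-trans (m≤m+n (a + r) s) (≤-trans (≡⇒≥ eq) (+-monoʳ-≤ b l≤r)))

n<2^1+⌊log₂n⌋ : ∀ n → n < 2 ^ suc ⌊log₂ n ⌋
n<2^1+⌊log₂n⌋ n = ≰⇒> λ le → <-irrefl refl
  (≤-trans (≡⇒≥ (⌊log₂[2^n]⌋≡n (suc ⌊log₂ n ⌋))) (⌊log₂⌋-mono-≤ le))

≤⌊log₂⌋ : ∀ a n → 2 ^ a ≤ n → a ≤ ⌊log₂ n ⌋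
≤⌊log₂⌋ a n le = ≤-trans (≡⇒≥ (⌊log₂[2^n]⌋≡n a)) (⌊log₂⌋-mono-≤ le)

2^⌊log₂n⌋≤n : ∀ n → 1 ≤ n → 2 ^ ⌊log₂ n ⌋ ≤ n
2^⌊log₂n⌋≤n n = <-rec (λ n → 1 ≤ n → 2 ^ ⌊log₂ n ⌋ ≤ n) step n
  where
  open ≤-Reasoning
  step : ∀ n → (∀ {m} → m < n → 1 ≤ m → 2 ^ ⌊log₂ m ⌋ ≤ m) → 1 ≤ n → 2 ^ ⌊log₂ n ⌋ ≤ n
  step (suc zero) rec _ = ≤-refl
  step n@(suc (suc m)) rec _ = begin
    2 ^ ⌊log₂ n ⌋ ≡⟨ cong (2 ^_) (m+[n∸m]≡n (⌊log₂⌋-mono-≤ {2} {n} (s≤s (s≤s z≤n)))) ⟨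
    2 * 2 ^ (⌊log₂ n ⌋ ∸ 1) ≡⟨ cong (λ t → 2 * 2 ^ t) (⌊log₂⌊n/2⌋⌋≡⌊log₂n⌋∸1 n) ⟨
    2 * 2 ^ ⌊log₂ ⌊ n /2⌋ ⌋ ≤⟨ *-monoʳ-≤ 2 (rec (⌊n/2⌋<n (suc m)) (s≤s z≤n)) ⟩
    2 * ⌊ n /2⌋ ≡⟨ cong (⌊ n /2⌋ +_) (+-identityʳ _) ⟩
    ⌊ n /2⌋ + ⌊ n /2⌋ ≤⟨ +-monoʳ-≤ ⌊ n /2⌋ (⌊n/2⌋≤⌈n/2⌉ n) ⟩
    ⌊ n /2⌋ + ⌈ n /2⌉ ≡⟨ ⌊n/2⌋+⌈n/2⌉≡n n ⟩
    n ∎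

exp-dominates : ∀ c n₀ → c * n₀ ≤ 2 ^ n₀ → 1 ≤ n₀ → ∀ n → n₀ ≤ n → c * n ≤ 2 ^ n
exp-dominates c n₀ base 1≤n₀ n n₀≤n with m≤n⇒∃[o]m+o≡n n₀≤n
... | d , refl = go d
  where
  open ≤-Reasoning
  double : ∀ a → 1 ≤ a → suc a ≤ 2 * a
  double a 1≤a = ≤-trans (+-monoˡ-≤ a 1≤a) (≤-reflexive (cong (a +_) (symm (+-identityʳ a))))
  go : ∀ d → c * (n₀ + d) ≤ 2 ^ (n₀ + d)
  go zero = subst (λ t → c * t ≤ 2 ^ t) (symm (+-identityʳ n₀)) base
  go (suc d) = subst (λ t → c * t ≤ 2 ^ t) (symm (+-suc n₀ d)) (begin
    c * suc (n₀ + d) ≤⟨ *-monoʳ-≤ c (double (n₀ + d) (≤-trans 1≤n₀ (m≤m+n n₀ d))) ⟩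
    c * (2 * (n₀ + d)) ≡⟨ rearrange c (n₀ + d) ⟩
    2 * (c * (n₀ + d)) ≤⟨ *-monoʳ-≤ 2 (go d) ⟩
    2 * 2 ^ (n₀ + d) ∎)
    where
    rearrange : ∀ c a → c * (2 * a) ≡ 2 * (c * a)
    rearrange = solve-∀

-- Serves to choose a parameter as large as a condition allows, given one success and one failure.
last-true : ∀ {P : ℕ → Set} → Decidable P → P 0 → ∀ N → ¬ P N → ∃ λ n → P n × ¬ P (suc n)
last-true P? p0 zero ¬pN = ⊥-elim (¬pN p0)
last-true P? p0 (suc N) ¬pN with P? N
... | yes pN  = N , pN , ¬pN
... | no ¬pN′ = last-true P? p0 N ¬pN′

n<2^n : ∀ n → n < 2 ^ n
n<2^n zero    = s≤s z≤n
n<2^n (suc n) = ≤-trans (+-mono-≤ (m^n>0 2 n) (n<2^n n)) (≤-reflexive (cong (2 ^ n +_) (symm (+-identityʳ _))))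

cube : ∀ k → k * k * k ≡ k * (k * (k * 1))
cube = solve-∀

+-swapʳ : ∀ a b c → a + b + c ≡ a + c + b
+-swapʳ = solve-∀

interchange : ∀ a b c d → a + b + (c + d) ≡ a + c + (b + d)
interchange = solve-∀

-- Sums

∑ : ∀ {n} → (Fin n → ℕ) → ℕ
∑ {zero}  f = 0
∑ {suc n} f = f Fin.zero + ∑ (f ∘ Fin.suc)

∑-tabulate : ∀ {n} (f : Fin n → ℕ) → sum (tabulate f) ≡ ∑ f
∑-tabulate {zero}  f = refl
∑-tabulate {suc n} f = cong (f Fin.zero +_) (∑-tabulate (f ∘ Fin.suc))

∑-cong : ∀ {n} {f g : Fin n → ℕ} → (∀ i → f i ≡ g i) → ∑ f ≡ ∑ g
∑-cong {zero}  eq = refl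
∑-cong {suc n} eq = cong₂ _+_ (eq Fin.zero) (∑-cong (eq ∘ Fin.suc))

∑-mono : ∀ {n} {f g : Fin n → ℕ} → (∀ i → f i ≤ g i) → ∑ f ≤ ∑ g
∑-mono {zero}  le = z≤n
∑-mono {suc n} le = +-mono-≤ (le Fin.zero) (∑-mono (le ∘ Fin.suc))

∑-const : ∀ n c → ∑ {n} (λ _ → c) ≡ n * c
∑-const zero    c = refl
∑-const (suc n) c = cong (c +_) (∑-const n c)

∑-zero : ∀ {n} {f : Fin n → ℕ} → (∀ i → f i ≡ 0) → ∑ f ≡ 0
∑-zero {n} eq = trans (∑-cong eq) (trans (∑-const n 0) (*-zeroʳ n))

∑-zero⁻¹ : ∀ {n} {f : Fin n → ℕ} → ∑ f ≡ 0 → ∀ i → f i ≡ 0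
∑-zero⁻¹ {suc n} {f} eq Fin.zero    = m+n≡0⇒m≡0 (f Fin.zero) eq
∑-zero⁻¹ {suc n} {f} eq (Fin.suc i) = ∑-zero⁻¹ (m+n≡0⇒n≡0 (f Fin.zero) eq) i

∑-+ : ∀ {n} (f g : Fin n → ℕ) → ∑ (λ i → f i + g i) ≡ ∑ f + ∑ g
∑-+ {zero}  f g = refl
∑-+ {suc n} f g = begin-equality
  f Fin.zero + g Fin.zero + ∑ (λ i → f (Fin.suc i) + g (Fin.suc i))
    ≡⟨ cong (f Fin.zero + g Fin.zero +_) (∑-+ (f ∘ Fin.suc) (g ∘ Fin.suc)) ⟩
  f Fin.zero + g Fin.zero + (∑ (f ∘ Fin.suc) + ∑ (g ∘ Fin.suc))
    ≡⟨ interchange (f Fin.zero) (g Fin.zero) (∑ (f ∘ Fin.suc)) (∑ (g ∘ Fin.suc)) ⟩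
  f Fin.zero + ∑ (f ∘ Fin.suc) + (g Fin.zero + ∑ (g ∘ Fin.suc)) ∎
  where open ≤-Reasoning

∑-*ˡ : ∀ {n} c (f : Fin n → ℕ) → ∑ (λ i → c * f i) ≡ c * ∑ f
∑-*ˡ {zero}  c f = symm (*-zeroʳ c)
∑-*ˡ {suc n} c f =
  trans (cong (c * f Fin.zero +_) (∑-*ˡ c (f ∘ Fin.suc))) (symm (*-distribˡ-+ c (f Fin.zero) _))

∑-swap : ∀ {m n} (f : Fin m → Fin n → ℕ) → ∑ (λ x → ∑ (f x)) ≡ ∑ (λ y → ∑ (λ x → f x y))
∑-swap {zero}  {n} f = symm (∑-zero {n} (λ _ → refl))
∑-swap {suc m} f = trans (cong (∑ (f Fin.zero) +_) (∑-swap (f ∘ Fin.suc)))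
                         (symm (∑-+ (f Fin.zero) (λ y → ∑ (λ x → f (Fin.suc x) y))))

∑-≥ : ∀ {n} (f : Fin n → ℕ) i → f i ≤ ∑ f
∑-≥ f Fin.zero    = m≤m+n _ _
∑-≥ f (Fin.suc i) = ≤-trans (∑-≥ (f ∘ Fin.suc) i) (m≤n+m _ _)

∑-≥₂ : ∀ {n} (f : Fin n → ℕ) i j → i ≢ j → f i + f j ≤ ∑ f
∑-≥₂ f Fin.zero    Fin.zero    i≢j = ⊥-elim (i≢j refl)
∑-≥₂ f Fin.zero    (Fin.suc j) i≢j = +-monoʳ-≤ (f Fin.zero) (∑-≥ (f ∘ Fin.suc) j)
∑-≥₂ f (Fin.suc i) Fin.zero    i≢j =
  ≤-trans (≤-reflexive (+-comm (f (Fin.suc i)) _)) (+-monoʳ-≤ (f Fin.zero) (∑-≥ (f ∘ Fin.suc) i))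
∑-≥₂ f (Fin.suc i) (Fin.suc j) i≢j =
  ≤-trans (∑-≥₂ (f ∘ Fin.suc) i j (i≢j ∘ cong Fin.suc)) (m≤n+m _ _)

∑-splitAt : ∀ a {b} (f : Fin (a + b) → ℕ) → ∑ f ≡ ∑ (λ x → f (x ↑ˡ b)) + ∑ (λ y → f (a ↑ʳ y))
∑-splitAt zero    f = refl
∑-splitAt (suc a) f =
  trans (cong (f Fin.zero +_) (∑-splitAt a (f ∘ Fin.suc))) (symm (+-assoc (f Fin.zero) _ _))

∑-large : ∀ {n} (f : Fin n → ℕ) c → n * c < ∑ f → ∃ λ i → c < f i
∑-large {n} f c big with Fin.any? (λ i → c <? f i)
... | yes found = found
... | no none = ⊥-elim (<⇒≱ big
      (≤-trans (∑-mono (λ i → ≮⇒≥ (λ c<f → none (i , c<f)))) (≤-reflexive (∑-const n c))))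

𝟙 : Bool → ℕ
𝟙 true  = 1
𝟙 false = 0

𝟙≤1 : ∀ b → 𝟙 b ≤ 1
𝟙≤1 true  = ≤-refl
𝟙≤1 false = z≤n

δ : ∀ {k} → Fin k → ℕ → Fin k → ℕ
δ p x i = if does (p Fin.≟ i) then x else 0

δ-≡ : ∀ {k} (p : Fin k) x → δ p x p ≡ x
δ-≡ p x rewrite dec-true (p Fin.≟ p) refl = refl

δ-≢ : ∀ {k} {p i : Fin k} x → p ≢ i → δ p x i ≡ 0
δ-≢ {p = p} {i} x p≢i rewrite dec-false (p Fin.≟ i) p≢i = refl

∑-δ : ∀ {k} (p : Fin k) x → ∑ (δ p x) ≡ x
∑-δ {suc k} Fin.zero x =
  trans (cong (x +_) (∑-zero {k} (λ i → δ-≢ {p = Fin.zero} {Fin.suc i} x λ ()))) (+-identityʳ x)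
∑-δ (Fin.suc p) x = ∑-δ p x

length-filter-concatMap : ∀ {A B : Set} {P : A → Set} (P? : Decidable P) {n} (f : B → List A) (g : Fin n → B) →
  length (filter P? (concatMap f (tabulate g))) ≡ ∑ (λ i → length (filter P? (f (g i))))
length-filter-concatMap P? {zero}  f g = refl
length-filter-concatMap P? {suc n} f g = trans
  (cong length (filter-++ P? (f (g Fin.zero)) _))
  (trans (length-++ (filter P? (f (g Fin.zero))))
         (cong (length (filter P? (f (g Fin.zero))) +_) (length-filter-concatMap P? f (g ∘ Fin.suc))))

-- The function producing a single cell is local to `edges`; unification against `refl` gives it a
-- name.
edgeCell : ∀ n → Σ (Fin n → Fin n → List (Fin n × Fin n)) λ cell →
  edges n ≡ concatMap (λ x → concatMap (λ y → cell x y) (allFin n)) (allFin n)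
edgeCell n = _ , refl

colourCount-∑ : ∀ {n k} (c : EdgeColouring n k) i →
  colourCount c i ≡ ∑ (λ x → ∑ (λ y → 𝟙 (does (x Fin.<? y)) * 𝟙 (does (col c x y Fin.≟ i))))
colourCount-∑ {n} c i = trans
  (length-filter-concatMap P? (λ x → concatMap (λ y → cell x y) (allFin n)) id)
  (∑-cong (λ x → trans (length-filter-concatMap P? (cell x) id) (∑-cong (λ y → cellCount x y))))
  where
  P? = λ (e : Fin n × Fin n) → col c (proj₁ e) (proj₂ e) Fin.≟ i
  cell = proj₁ (edgeCell n)
  cellCount : ∀ x y →
    length (filter P? (cell x y)) ≡ 𝟙 (does (x Fin.<? y)) * 𝟙 (does (col c x y Fin.≟ i))
  cellCount x y with x Fin.<? y
  ... | no x≮y rewrite dec-false (x Fin.<? y) x≮y = refl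
  ... | yes x<y rewrite dec-true (x Fin.<? y) x<y with col c x y Fin.≟ i
  ...   | yes _ = refl
  ...   | no _  = refl

-- Realizable distributions

Realizable : ∀ {k} → ℕ → (Fin k → ℕ) → Set
Realizable {k} n e = Σ (EdgeColouring n k) λ c → IsGallai c × HasDistribution c e

realizable-cong : ∀ {k n} {e e′ : Fin k → ℕ} → (∀ i → e i ≡ e′ i) → Realizable n e → Realizable n e′
realizable-cong eq (c , gallai , dist) = c , gallai , λ i → trans (dist i) (eq i)

realizable-0 : ∀ {k} → Realizable {k} 0 (λ _ → 0)
realizable-0 = record { col = λ () ; sym = λ () } , (λ ()) , λ _ → refl

module Join {a b k} (c₁ : EdgeColouring a k) (c₂ : EdgeColouring b k) (p : Fin k) where

  colour : Fin a ⊎ Fin b → Fin a ⊎ Fin b → Fin k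
  colour (inj₁ x) (inj₁ y) = col c₁ x y
  colour (inj₂ x) (inj₂ y) = col c₂ x y
  colour (inj₁ _) (inj₂ _) = p
  colour (inj₂ _) (inj₁ _) = p

  colour-sym : ∀ x y → colour x y ≡ colour y x
  colour-sym (inj₁ x) (inj₁ y) = EdgeColouring.sym c₁ x y
  colour-sym (inj₂ x) (inj₂ y) = EdgeColouring.sym c₂ x y
  colour-sym (inj₁ _) (inj₂ _) = refl
  colour-sym (inj₂ _) (inj₁ _) = refl

  joined : EdgeColouring (a + b) k
  joined = record { col = λ x y → colour (splitAt a x) (splitAt a y)
                  ; sym = λ x y → colour-sym (splitAt a x) (splitAt a y) }

  -- A triangle that meets both sides has two crossing edges, and both have colour `p`.
  colour-gallai : IsGallai c₁ → IsGallai c₂ → ∀ x y z → x ≢ y → y ≢ z → x ≢ z →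
    ¬ ((colour x y ≢ colour y z) × (colour y z ≢ colour x z) × (colour x z ≢ colour x y))
  colour-gallai g₁ g₂ (inj₁ x) (inj₁ y) (inj₁ z) x≢y y≢z x≢z r =
    g₁ x y z (x≢y ∘ cong inj₁) (y≢z ∘ cong inj₁) (x≢z ∘ cong inj₁) r
  colour-gallai g₁ g₂ (inj₂ x) (inj₂ y) (inj₂ z) x≢y y≢z x≢z r =
    g₂ x y z (x≢y ∘ cong inj₂) (y≢z ∘ cong inj₂) (x≢z ∘ cong inj₂) r
  colour-gallai _ _ (inj₁ _) (inj₁ _) (inj₂ _) _ _ _ (_ , r , _) = r refl
  colour-gallai _ _ (inj₁ _) (inj₂ _) (inj₁ _) _ _ _ (r , _ , _) = r refl
  colour-gallai _ _ (inj₁ _) (inj₂ _) (inj₂ _) _ _ _ (_ , _ , r) = r refl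
  colour-gallai _ _ (inj₂ _) (inj₁ _) (inj₁ _) _ _ _ (_ , _ , r) = r refl
  colour-gallai _ _ (inj₂ _) (inj₁ _) (inj₂ _) _ _ _ (r , _ , _) = r refl
  colour-gallai _ _ (inj₂ _) (inj₂ _) (inj₁ _) _ _ _ (_ , r , _) = r refl

  splitAt-≢ : ∀ {x y} → x ≢ y → splitAt a {b} x ≢ splitAt a y
  splitAt-≢ {x} {y} x≢y eq = x≢y
    (trans (symm (Fin.join-splitAt a b x)) (trans (cong (Fin.join a b) eq) (Fin.join-splitAt a b y)))

  joined-gallai : IsGallai c₁ → IsGallai c₂ → IsGallai joined
  joined-gallai g₁ g₂ x y z x≢y y≢z x≢z =
    colour-gallai g₁ g₂ _ _ _ (splitAt-≢ x≢y) (splitAt-≢ y≢z) (splitAt-≢ x≢z)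

  cell : ∀ {n} → EdgeColouring n k → Fin k → Fin n → Fin n → ℕ
  cell c i x y = 𝟙 (does (x Fin.<? y)) * 𝟙 (does (col c x y Fin.≟ i))

  does-<? : ∀ {m n} {x y : Fin m} {x′ y′ : Fin n} →
    (x Fin.< y → x′ Fin.< y′) → (x′ Fin.< y′ → x Fin.< y) → does (x Fin.<? y) ≡ does (x′ Fin.<? y′)
  does-<? {x = x} {y} {x′} {y′} to from with x Fin.<? y
  ... | yes x<y = trans (dec-true (x Fin.<? y) x<y) (symm (dec-true (x′ Fin.<? y′) (to x<y)))
  ... | no x≮y = trans (dec-false (x Fin.<? y) x≮y) (symm (dec-false (x′ Fin.<? y′) (x≮y ∘ from)))

  cell-ll : ∀ i x y → cell joined i (x ↑ˡ b) (y ↑ˡ b) ≡ cell c₁ i x y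
  cell-ll i x y rewrite Fin.splitAt-↑ˡ a x b | Fin.splitAt-↑ˡ a y b =
    cong (λ t → 𝟙 t * 𝟙 (does (col c₁ x y Fin.≟ i)))
      (does-<? {x = x ↑ˡ b} {y ↑ˡ b} (subst₂ _<_ (Fin.toℕ-↑ˡ x b) (Fin.toℕ-↑ˡ y b))
               (subst₂ _<_ (symm (Fin.toℕ-↑ˡ x b)) (symm (Fin.toℕ-↑ˡ y b))))

  cell-rr : ∀ i x y → cell joined i (a ↑ʳ x) (a ↑ʳ y) ≡ cell c₂ i x y
  cell-rr i x y rewrite Fin.splitAt-↑ʳ a b x | Fin.splitAt-↑ʳ a b y =
    cong (λ t → 𝟙 t * 𝟙 (does (col c₂ x y Fin.≟ i)))
      (does-<? {x = a ↑ʳ x} {a ↑ʳ y}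
        (λ lt → +-cancelˡ-< a _ _ (subst₂ _<_ (Fin.toℕ-↑ʳ a x) (Fin.toℕ-↑ʳ a y) lt))
        (λ lt → subst₂ _<_ (symm (Fin.toℕ-↑ʳ a x)) (symm (Fin.toℕ-↑ʳ a y)) (+-monoʳ-< a lt)))

  l<r : ∀ (x : Fin a) (y : Fin b) → (x ↑ˡ b) Fin.< (a ↑ʳ y)
  l<r x y = subst₂ _<_ (symm (Fin.toℕ-↑ˡ x b)) (symm (Fin.toℕ-↑ʳ a y))
    (≤-trans (Fin.toℕ<n x) (m≤m+n a (toℕ y)))

  cell-lr : ∀ i x y → cell joined i (x ↑ˡ b) (a ↑ʳ y) ≡ δ p 1 i
  cell-lr i x y
    rewrite dec-true ((x ↑ˡ b) Fin.<? (a ↑ʳ y)) (l<r x y) | Fin.splitAt-↑ˡ a x b | Fin.splitAt-↑ʳ a b y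
    with p Fin.≟ i
  ... | yes _ = refl
  ... | no _  = refl

  cell-rl : ∀ i x y → cell joined i (a ↑ʳ y) (x ↑ˡ b) ≡ 0
  cell-rl i x y rewrite dec-false ((a ↑ʳ y) Fin.<? (x ↑ˡ b)) (<-asym (l<r x y)) = refl

  joined-count : ∀ i → colourCount joined i ≡ colourCount c₁ i + colourCount c₂ i + δ p (a * b) i
  joined-count i = begin-equality
    colourCount joined i
      ≡⟨ colourCount-∑ joined i ⟩
    ∑ (λ x → ∑ (cell joined i x))
      ≡⟨ ∑-splitAt a _ ⟩
    ∑ (λ x → ∑ (cell joined i (x ↑ˡ b))) + ∑ (λ y → ∑ (cell joined i (a ↑ʳ y)))
      ≡⟨ cong₂ _+_ (∑-cong left) (∑-cong right) ⟩
    ∑ (λ x → ∑ (cell c₁ i x) + b * δ p 1 i) + ∑ (λ y → ∑ (cell c₂ i y))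
      ≡⟨ cong (_+ ∑ (λ y → ∑ (cell c₂ i y))) (trans (∑-+ (λ x → ∑ (cell c₁ i x)) (λ _ → b * δ p 1 i))
           (cong (∑ (λ x → ∑ (cell c₁ i x)) +_) (∑-const a _))) ⟩
    ∑ (λ x → ∑ (cell c₁ i x)) + a * (b * δ p 1 i) + ∑ (λ y → ∑ (cell c₂ i y))
      ≡⟨ cong₂ (λ s t → s + a * (b * δ p 1 i) + t) (symm (colourCount-∑ c₁ i)) (symm (colourCount-∑ c₂ i)) ⟩
    colourCount c₁ i + a * (b * δ p 1 i) + colourCount c₂ i
      ≡⟨ rearrange (colourCount c₁ i) (colourCount c₂ i) a b (δ p 1 i) ⟩
    colourCount c₁ i + colourCount c₂ i + a * b * δ p 1 i
      ≡⟨ cong (colourCount c₁ i + colourCount c₂ i +_) δ-scale ⟩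
    colourCount c₁ i + colourCount c₂ i + δ p (a * b) i ∎
    where
    open ≤-Reasoning
    rearrange : ∀ s t a b d → s + a * (b * d) + t ≡ s + t + a * b * d
    rearrange = solve-∀
    left : ∀ x → ∑ (cell joined i (x ↑ˡ b)) ≡ ∑ (cell c₁ i x) + b * δ p 1 i
    left x = trans (∑-splitAt a _) (cong₂ _+_ (∑-cong (cell-ll i x))
      (trans (∑-cong (cell-lr i x)) (∑-const b _)))
    right : ∀ y → ∑ (cell joined i (a ↑ʳ y)) ≡ ∑ (cell c₂ i y)
    right y = trans (∑-splitAt a _)
      (cong₂ _+_ (∑-zero (λ x → cell-rl i x y)) (∑-cong (cell-rr i y)))
    δ-scale : a * b * δ p 1 i ≡ δ p (a * b) i
    δ-scale with does (p Fin.≟ i)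
    ... | true  = *-identityʳ _
    ... | false = *-zeroʳ (a * b)

realizable-join : ∀ {k a b} {e₁ e₂ : Fin k → ℕ} (p : Fin k) → Realizable a e₁ → Realizable b e₂ →
  Realizable (a + b) (λ i → e₁ i + e₂ i + δ p (a * b) i)
realizable-join {a = a} {b} p (c₁ , g₁ , d₁) (c₂ , g₂ , d₂) =
  joined , joined-gallai g₁ g₂ ,
  λ i → trans (joined-count i) (cong (_+ δ p (a * b) i) (cong₂ _+_ (d₁ i) (d₂ i)))
  where open Join c₁ c₂ p

realizable-1 : ∀ {k} → Fin k → Realizable {k} 1 (λ _ → 0)
realizable-1 p = record { col = λ _ _ → p ; sym = λ _ _ → refl } ,
  (λ { Fin.zero Fin.zero _ x≢y → ⊥-elim (x≢y refl) }) , λ _ → refl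

realizable-peel : ∀ {k m} {e : Fin k → ℕ} (p : Fin k) → Realizable m e →
  Realizable (suc m) (λ i → e i + δ p m i)
realizable-peel {m = m} {e} p r = realizable-cong
  (λ i → cong (λ t → e i + δ p t i) (*-identityˡ m))
  (realizable-join p (realizable-1 p) r)

-- Existence of g(k)

-- Search is stated up to a relation because functions are enumerated only up to pointwise equality,
-- which the predicate then has to respect.
Exhaustible : {A : Set} → (A → A → Set) → Set₁
Exhaustible {A} _≈_ =
  (P : A → Set) → Decidable P → (∀ {a b} → a ≈ b → P a → P b) → Dec (∃ P)

exhaustible-Fin : ∀ {n} → Exhaustible {Fin n} _≡_
exhaustible-Fin P P? _ = Fin.any? P?

exhaustible-→ : ∀ {A : Set} {_≈_ : A → A → Set} → (∀ a → a ≈ a) → Exhaustible _≈_ →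
  ∀ n → Exhaustible {Fin n → A} (λ f g → ∀ i → f i ≈ g i)
exhaustible-→ {A} ≈-refl exh zero P P? resp =
  map′ (empty ,_) (λ (f , p) → resp (λ ()) p) (P? empty)
  where
  empty : Fin 0 → A
  empty ()
exhaustible-→ {A} {_≈_} ≈-refl exh (suc n) P P? resp =
  map′ (λ (a , f , p) → cons a f , p)
       (λ (f , p) → f Fin.zero , f ∘ Fin.suc ,
         resp (λ { Fin.zero → ≈-refl _ ; (Fin.suc i) → ≈-refl _ }) p)
       (exh (λ a → ∃ λ f → P (cons a f))
         (λ a → exhaustible-→ ≈-refl exh n (λ f → P (cons a f)) (λ f → P? (cons a f))
           (λ eq → resp (λ { Fin.zero → ≈-refl _ ; (Fin.suc i) → eq i })))
         (λ eq (f , p) → f , resp (λ { Fin.zero → eq ; (Fin.suc i) → ≈-refl _ }) p))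
  where
  cons : ∀ {n} → A → (Fin n → A) → Fin (suc n) → A
  cons a f Fin.zero    = a
  cons a f (Fin.suc i) = f i

realizable? : ∀ {k} n (e : Fin k → ℕ) → Dec (Realizable n e)
realizable? {k} n e = map′
  (λ (f , s , g , d) → record { col = f ; sym = s } , g , d)
  (λ (c , g , d) → col c , EdgeColouring.sym c , g , d)
  (exhaustible-→ (λ _ _ → refl) (exhaustible-→ (λ _ → refl) exhaustible-Fin n) n Good good? resp)
  where
  Good : (Fin n → Fin n → Fin k) → Set
  Good f = Σ (∀ x y → f x y ≡ f y x) λ s →
    IsGallai (record { col = f ; sym = s }) × HasDistribution (record { col = f ; sym = s }) e
  gallai? : ∀ c → Dec (IsGallai {n} {k} c)
  gallai? c = Fin.all? λ x → Fin.all? λ y → Fin.all? λ z →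
    ¬? (x Fin.≟ y) →-dec (¬? (y Fin.≟ z) →-dec (¬? (x Fin.≟ z) →-dec ¬?
      (¬? (col c x y Fin.≟ col c y z) ×-dec ¬? (col c y z Fin.≟ col c x z) ×-dec ¬? (col c x z Fin.≟ col c x y))))
  good? : Decidable Good
  good? f with Fin.all? (λ x → Fin.all? (λ y → f x y Fin.≟ f y x))
  ... | no ¬s = no (¬s ∘ proj₁)
  ... | yes s = map′ (s ,_) (λ (s′ , gd) → gd)
        (gallai? (record { col = f ; sym = s }) ×-dec Fin.all? (λ i → _ ≟ e i))
  resp : ∀ {f g} → (∀ x y → f x y ≡ g x y) → Good f → Good g
  resp {f} {g} eq (s , gal , dist) = s′ , gal′ , dist′
    where
    s′ : ∀ x y → g x y ≡ g y x
    s′ x y = trans (symm (eq x y)) (trans (s x y) (eq y x))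
    shift : ∀ {x y z w} → g x y ≢ g z w → f x y ≢ f z w
    shift {x} {y} {z} {w} ne ff = ne (trans (symm (eq x y)) (trans ff (eq z w)))
    gal′ : IsGallai (record { col = g ; sym = s′ })
    gal′ x y z x≢y y≢z x≢z (r₁ , r₂ , r₃) = gal x y z x≢y y≢z x≢z (shift r₁ , shift r₂ , shift r₃)
    dist′ : HasDistribution (record { col = g ; sym = s′ }) e
    dist′ i = trans (colourCount-∑ (record { col = g ; sym = s′ }) i) (trans
      (∑-cong λ x → ∑-cong λ y → cong (λ t → 𝟙 (does (x Fin.<? y)) * 𝟙 (does (t Fin.≟ i))) (symm (eq x y)))
      (trans (symm (colourCount-∑ (record { col = f ; sym = s }) i)) (dist i)))

AllRealizable : ℕ → ℕ → Set
AllRealizable k n = (e : Fin k → ℕ) → sum (tabulate e) ≡ n C 2 → Realizable n e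

-- A sequence with sum n C 2 has all its entries at most n C 2, so finitely many sequences have to be tested.
allRealizable? : ∀ k n → Dec (AllRealizable k n)
allRealizable? k n = map′ to from (¬? (exhaustible-→ (λ _ → refl) exhaustible-Fin k Bad bad? resp))
  where
  Bad : (Fin k → Fin (suc (n C 2))) → Set
  Bad ε = ∑ (toℕ ∘ ε) ≡ n C 2 × ¬ Realizable n (toℕ ∘ ε)
  bad? : Decidable Bad
  bad? ε = (_ ≟ _) ×-dec ¬? (realizable? n (toℕ ∘ ε))
  resp : ∀ {ε ε′} → (∀ i → ε i ≡ ε′ i) → Bad ε → Bad ε′
  resp eq (s , nr) = trans (∑-cong (λ i → cong toℕ (symm (eq i)))) s ,
    λ r → nr (realizable-cong (λ i → cong toℕ (symm (eq i))) r)
  to : ¬ ∃ Bad → AllRealizable k n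
  to ¬bad e sum≡ = realizable-cong eq (decidable-stable (realizable? n (toℕ ∘ ε))
    λ nr → ¬bad (ε , trans (∑-cong eq) ∑≡ , nr))
    where
    ∑≡ : ∑ e ≡ n C 2
    ∑≡ = trans (symm (∑-tabulate e)) sum≡
    bound : ∀ i → e i < suc (n C 2)
    bound i = s≤s (≤-trans (∑-≥ e i) (≤-reflexive ∑≡))
    ε : Fin k → Fin (suc (n C 2))
    ε i = fromℕ< (bound i)
    eq : ∀ i → toℕ (ε i) ≡ e i
    eq i = Fin.toℕ-fromℕ< (bound i)
  from : AllRealizable k n → ¬ ∃ Bad
  from all (ε , s , nr) = nr (all (toℕ ∘ ε) (trans (∑-tabulate (toℕ ∘ ε)) s))

-- Below a valid bound the property can fail only at the one order that is added. Each step of the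
-- descent thus decides `AllRealizable` for a single order, and the first failure certifies
-- minimality.
isG-exists : ∀ k N → GallaiProperty k N → ∃ λ g → IsG k g × g ≤ N
isG-exists k zero    prop = 0 , (prop , λ _ _ → z≤n) , z≤n
isG-exists k (suc N) prop with allRealizable? k N
... | yes all = case isG-exists k N prop′ of λ (g , isG , g≤N) → g , isG , ≤-trans g≤N (n≤1+n N)
  where
  prop′ : GallaiProperty k N
  prop′ n N≤n with N ≟ n
  ... | yes refl = all
  ... | no N≢n = prop n (≤∧≢⇒< N≤n N≢n)
... | no ¬all = suc N , (prop , λ M propM → ≰⇒> (λ M≤N → ¬all (propM N M≤N))) , ≤-refl

-- Lower bound

module GallaiCut {n k} (c : EdgeColouring n k) (gallai : IsGallai c) where

  open import Data.List.Membership.DecPropositional (Fin._≟_ {n}) using (_∈?_)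

  C : Fin n → Fin n → Fin k
  C = col c

  C-sym : ∀ x y → C x y ≡ C y x
  C-sym = EdgeColouring.sym c

  isosceles : ∀ {x y z} → x ≢ y → y ≢ z → x ≢ z → C x y ≢ C y z → C y z ≢ C x z → C x y ≡ C x z
  isosceles {x} {y} {z} x≢y y≢z x≢z ne₁ ne₂ = decidable-stable (C x y Fin.≟ C x z)
    λ ne₃ → gallai x y z x≢y y≢z x≢z (ne₁ , ne₂ , ne₃ ∘ symm)

  -- The connected component of `v` in colour `r` inside `W`. Connectedness is expressed by the
  -- induction principle `ind` in place of paths; its steps have `y ≢ z` because diagonal values
  -- carry no meaning.
  record Component (r : Fin k) (W : List (Fin n)) (v : Fin n) : Set₁ where
    field
      R      : List (Fin n)
      v∈R    : v ∈ R
      R⊆W    : ∀ {z} → z ∈ R → z ∈ W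
      closed : ∀ {y z} → y ∈ R → z ∈ W → C y z ≡ r → z ∈ R
      ind    : (P : Fin n → Set) → P v →
               (∀ {y z} → P y → y ∈ W → z ∈ W → y ≢ z → C y z ≡ r → P z) →
               ∀ {z} → z ∈ R → P z

  -- A search: as long as a vertex of `Out` has an `r`-edge to `In`, it is moved; otherwise `In` is
  -- closed. `fuel` bounds the shrinking list `Out`.
  grow : ∀ {r W v} fuel (In Out : List (Fin n)) → length Out ≤ fuel → v ∈ In →
    (∀ {z} → z ∈ In → z ∈ W) → (∀ {z} → z ∈ Out → z ∈ W) → (∀ {z} → z ∈ Out → z ∉ In) →
    (∀ {z} → z ∈ W → z ∈ In ⊎ z ∈ Out) →
    ((P : Fin n → Set) → P v → (∀ {y z} → P y → y ∈ W → z ∈ W → y ≢ z → C y z ≡ r → P z) →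
      ∀ {z} → z ∈ In → P z) →
    Component r W v
  grow {r} {W} {v} fuel In Out len v∈In In⊆W Out⊆W disj cover ind
    with Any.any? (λ z → Any.any? (λ y → C y z Fin.≟ r) In) Out
  ... | no none = record
        { R = In ; v∈R = v∈In ; R⊆W = In⊆W ; ind = ind
        ; closed = λ y∈ z∈W eq → case cover z∈W of λ
            { (inj₁ z∈In) → z∈In
            ; (inj₂ z∈Out) → ⊥-elim (none (lose z∈Out (lose y∈ eq))) } }
  ... | yes found with find found
  ...   | z , z∈Out , found′ with find found′
  grow zero In [] len v∈In In⊆W Out⊆W disj cover ind | yes found | z , () , found′ | y , y∈In , eq
  grow {r} {W} {v} (suc fuel) In Out len v∈In In⊆W Out⊆W disj cover ind
    | yes found | z , z∈Out , found′ | y , y∈In , eq =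
    grow fuel (z ∷ In) Out′
      (≤-pred (≤-trans (filter-notAll ≢z? Out (Any.map (λ z≡x x≢z → x≢z (symm z≡x)) z∈Out)) len))
      (there v∈In)
      (λ { (here refl) → Out⊆W z∈Out ; (there w∈) → In⊆W w∈ })
      (λ w∈ → Out⊆W (proj₁ (∈-filter⁻ ≢z? w∈)))
      (λ { w∈ (here refl) → proj₂ (∈-filter⁻ ≢z? {xs = Out} w∈) refl
         ; w∈ (there w∈In) → disj (proj₁ (∈-filter⁻ ≢z? w∈)) w∈In })
      cover′
      (λ { P Pv step (here refl) →
             step (ind P Pv step y∈In) (In⊆W y∈In) (Out⊆W z∈Out) (λ { refl → disj z∈Out y∈In }) eq
         ; P Pv step (there w∈) → ind P Pv step w∈ })
    where
    ≢z? : ∀ x → Dec (x ≢ z)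
    ≢z? x = ¬? (x Fin.≟ z)
    Out′ = filter ≢z? Out
    cover′ : ∀ {w} → w ∈ W → w ∈ z ∷ In ⊎ w ∈ Out′
    cover′ {w} w∈W with w Fin.≟ z
    ... | yes refl = inj₁ (here refl)
    ... | no w≢z with cover w∈W
    ...   | inj₁ w∈In  = inj₁ (there w∈In)
    ...   | inj₂ w∈Out = inj₂ (∈-filter⁺ ≢z? w∈Out w≢z)

  component : ∀ r {W v} → v ∈ W → Component r W v
  component r {W} {v} v∈W = grow (length Out) (v ∷ []) Out ≤-refl (here refl)
    (λ { (here refl) → v∈W })
    (λ z∈ → proj₁ (∈-filter⁻ ≢v? z∈))
    (λ { z∈ (here refl) → proj₂ (∈-filter⁻ ≢v? {xs = W} z∈) refl })
    cover
    (λ { P Pv step (here refl) → Pv })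
    where
    ≢v? : ∀ x → Dec (x ≢ v)
    ≢v? x = ¬? (x Fin.≟ v)
    Out = filter ≢v? W
    cover : ∀ {w} → w ∈ W → w ∈ v ∷ [] ⊎ w ∈ Out
    cover {w} w∈W with w Fin.≟ v
    ... | yes refl = inj₁ (here refl)
    ... | no w≢v = inj₂ (∈-filter⁺ ≢v? w∈W w≢v)

  -- For an `r`-edge az of the component, neither ya nor yz has colour `r`, so the triangle forces
  -- these two to agree; connectedness carries the agreement through the component.
  component-module : ∀ {r W v} (K : Component r W v) → let open Component K in
    ∀ {y} → y ∈ W → y ∉ R → ∀ {z} → z ∈ R → C y z ≡ C y v
  component-module {r} {W} {v} K {y} y∈W y∉R z∈R =
    proj₁ (ind (λ z → C y z ≡ C y v × z ∈ R) (refl , v∈R) step z∈R)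
    where
    open Component K
    step : ∀ {a z} → C y a ≡ C y v × a ∈ R → a ∈ W → z ∈ W → a ≢ z → C a z ≡ r → C y z ≡ C y v × z ∈ R
    step {a} {z} (eq , a∈R) a∈W z∈W a≢z az = trans (symm ya≡yz) eq , z∈R′
      where
      z∈R′ : z ∈ R
      z∈R′ = closed a∈R z∈W az
      ya≡yz : C y a ≡ C y z
      ya≡yz = isosceles (λ { refl → y∉R a∈R }) a≢z (λ { refl → y∉R z∈R′ })
        (λ eq′ → y∉R (closed a∈R y∈W (trans (C-sym a y) (trans eq′ az))))
        (λ eq′ → y∉R (closed z∈R′ y∈W (trans (C-sym z y) (trans (symm eq′) az))))

  -- Colour `p` connects all of `W`: a nonempty part of `W` closed under `p`-edges is everything.
  Span : Fin k → List (Fin n) → Set₁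
  Span p W = (P : Fin n → Set) → ∀ {x} → x ∈ W → P x →
    (∀ {y z} → P y → y ∈ W → z ∈ W → y ≢ z → C y z ≡ p → P z) → ∀ {z} → z ∈ W → P z

  -- A bipartite form of Gallai's partition theorem, strengthened by the spanning of both colours.
  -- The colours `p` and `q` may coincide.
  record Cut (W : List (Fin n)) : Set₁ where
    field
      side   : Fin n → Bool
      p q    : Fin k
      a₀ b₀  : Fin n
      a₀∈W   : a₀ ∈ W
      b₀∈W   : b₀ ∈ W
      a₀-side : side a₀ ≡ true
      b₀-side : side b₀ ≡ false
      cross  : ∀ {x y} → x ∈ W → y ∈ W → side x ≡ true → side y ≡ false → C x y ≡ p ⊎ C x y ≡ q
      span-p : Span p W
      span-q : Span q W

  flip : ∀ {W} → Cut W → Cut W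
  flip K = record
    { side = not ∘ side ; p = p ; q = q ; a₀ = b₀ ; b₀ = a₀ ; a₀∈W = b₀∈W ; b₀∈W = a₀∈W
    ; a₀-side = cong not b₀-side ; b₀-side = cong not a₀-side
    ; cross = λ {x} {y} x∈ y∈ sx sy → subst (λ t → t ≡ p ⊎ t ≡ q) (C-sym y x)
        (cross y∈ x∈ (Bool.not-injective sy) (Bool.not-injective sx))
    ; span-p = span-p ; span-q = span-q }
    where open Cut K

  isVertex : Fin n → Fin n → Bool
  isVertex v x = does (x Fin.≟ v)

  isVertex-true : ∀ {v x} → isVertex v x ≡ true → x ≡ v
  isVertex-true {v} {x} eq with x Fin.≟ v
  ... | yes x≡v = x≡v
  isVertex-true () | no _

  isVertex-false : ∀ {v x} → isVertex v x ≡ false → x ≢ v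
  isVertex-false {v} eq refl = case trans (symm (dec-true (v Fin.≟ v) refl)) eq of λ ()

  tail-∈ : ∀ {v x} {W : List (Fin n)} → x ∈ v ∷ W → x ≢ v → x ∈ W
  tail-∈ (here x≡v) x≢v = ⊥-elim (x≢v x≡v)
  tail-∈ (there x∈) _   = x∈

  ∉-≢ : ∀ {v x} {W : List (Fin n)} → v ∉ W → x ∈ W → v ≢ x
  ∉-≢ v∉ x∈ refl = v∉ x∈

  span-extend : ∀ {p v W u} → Span p W → v ∉ W → u ∈ W → C v u ≡ p → Span p (v ∷ W)
  span-extend {p} {v} {W} {u} span v∉ u∈ vu P x∈ Px step = all
    where
    step′ : ∀ {y z} → P y → y ∈ W → z ∈ W → y ≢ z → C y z ≡ p → P z
    step′ Py y∈ z∈ = step Py (there y∈) (there z∈)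
    fromW : ∀ {x} → x ∈ v ∷ W → P x → ∀ {z} → z ∈ W → P z
    fromW (here refl) Pv = span P u∈ (step Pv (here refl) (there u∈) (∉-≢ v∉ u∈) vu) step′
    fromW (there x∈) Px  = span P x∈ Px step′
    all : ∀ {z} → z ∈ v ∷ W → P z
    all (there z∈)  = fromW x∈ Px z∈
    all (here refl) = step (fromW x∈ Px u∈) (there u∈) (here refl)
      (λ { refl → v∉ u∈ }) (trans (C-sym u v) vu)

  vertexCut : ∀ {v W w} (p q : Fin k) → v ∉ W → w ∈ W → (∀ {x} → x ∈ W → C v x ≡ p ⊎ C v x ≡ q) →
    Span p (v ∷ W) → Span q (v ∷ W) → Cut (v ∷ W)
  vertexCut {v} {W} {w} p q v∉ w∈ colours span-p span-q = record
    { side = isVertex v ; p = p ; q = q ; a₀ = v ; b₀ = w ; a₀∈W = here refl ; b₀∈W = there w∈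
    ; a₀-side = dec-true (v Fin.≟ v) refl
    ; b₀-side = dec-false (w Fin.≟ v) (∉-≢ v∉ w∈ ∘ symm)
    ; cross = λ {x} {y} x∈ y∈ sx sy → subst (λ t → C t y ≡ p ⊎ C t y ≡ q)
        (symm (isVertex-true sx)) (colours (tail-∈ y∈ (isVertex-false sy)))
    ; span-p = span-p ; span-q = span-q }

  -- For a `p`-edge yz of `W`, neither vy nor vz has colour `p`, so they agree. As `p` spans `W`,
  -- the vertex `v` sees all of `W` in one colour, and the star at `v` makes this colour spanning.
  vertexCut-mono : ∀ {v W w p} → v ∉ W → w ∈ W → Span p W → (∀ {x} → x ∈ W → C v x ≢ p) → Cut (v ∷ W)
  vertexCut-mono {v} {W} {w} {p} v∉ w∈ span no-p =
    vertexCut (C v w) (C v w) v∉ w∈ (inj₁ ∘ mono) span′ span′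
    where
    mono : ∀ {x} → x ∈ W → C v x ≡ C v w
    mono = span (λ x → C v x ≡ C v w) w∈ refl
      λ {y} {z} eq y∈ z∈ y≢z yz → trans (symm (isosceles (∉-≢ v∉ y∈) y≢z (∉-≢ v∉ z∈)
        (λ e → no-p y∈ (trans e yz)) (λ e → no-p z∈ (trans (symm e) yz)))) eq
    span′ : Span (C v w) (v ∷ W)
    span′ P x∈ Px step = all
      where
      reach-v : ∀ {x} → x ∈ v ∷ W → P x → P v
      reach-v (here refl) Px = Px
      reach-v (there x∈W) Px = step Px (there x∈W) (here refl) (λ { refl → v∉ x∈W })
                                 (trans (C-sym _ v) (mono x∈W))
      Pv = reach-v x∈ Px
      all : ∀ {z} → z ∈ v ∷ W → P z
      all (here refl) = Pv
      all (there z∈)  = step Pv (here refl) (there z∈) (∉-≢ v∉ z∈) (mono z∈)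

  module Extend {v W} (v∉ : v ∉ W) (K : Cut W) where
    open Cut K

    module _ (span-p′ : Span p (v ∷ W)) (span-q′ : Span q (v ∷ W)) where

      addFalse : (∀ {x} → x ∈ W → side x ≡ true → C v x ≡ p ⊎ C v x ≡ q) → Cut (v ∷ W)
      addFalse ok = record
        { side = side′ ; p = p ; q = q ; a₀ = a₀ ; b₀ = b₀ ; a₀∈W = there a₀∈W ; b₀∈W = there b₀∈W
        ; a₀-side = trans (side′-≢ a₀∈W) a₀-side ; b₀-side = trans (side′-≢ b₀∈W) b₀-side
        ; cross = cross′ ; span-p = span-p′ ; span-q = span-q′ }
        where
        side′ : Fin n → Bool
        side′ x = if isVertex v x then false else side x
        side′-≢ : ∀ {x} → x ∈ W → side′ x ≡ side x
        side′-≢ {x} x∈ rewrite dec-false (x Fin.≟ v) (∉-≢ v∉ x∈ ∘ symm) = refl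
        side′-v : side′ v ≡ false
        side′-v rewrite dec-true (v Fin.≟ v) refl = refl
        cross′ : ∀ {x y} → x ∈ v ∷ W → y ∈ v ∷ W → side′ x ≡ true → side′ y ≡ false → C x y ≡ p ⊎ C x y ≡ q
        cross′ (here refl) _ sx _ = case trans (symm side′-v) sx of λ ()
        cross′ {x} (there x∈) (here refl) sx _ =
          subst (λ t → t ≡ p ⊎ t ≡ q) (C-sym v x) (ok x∈ (trans (symm (side′-≢ x∈)) sx))
        cross′ (there x∈) (there y∈) sx sy =
          cross x∈ y∈ (trans (symm (side′-≢ x∈)) sx) (trans (symm (side′-≢ y∈)) sy)

      -- The whole component of `v` moves to the true side. A vertex left on the false side sees the
      -- component in a single colour, the one it has towards `a`, and that edge crossed the old
      -- cut.
      absorb : ∀ {r} (L : Component r (v ∷ W) v) → let open Component L in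
        ∀ {a y} → a ∈ W → a ∈ R → side a ≡ true → y ∈ W → y ∉ R → side y ≡ false → Cut (v ∷ W)
      absorb L {a} {y} a∈ a∈R sa y∈ y∉ sy = record
        { side = side′ ; p = p ; q = q ; a₀ = v ; b₀ = y ; a₀∈W = here refl ; b₀∈W = there y∈
        ; a₀-side = cong (_∨ side v) (dec-true (v ∈? R) v∈R)
        ; b₀-side = trans (cong (_∨ side y) (dec-false (y ∈? R) y∉)) sy
        ; cross = cross′ ; span-p = span-p′ ; span-q = span-q′ }
        where
        open Component L
        side′ : Fin n → Bool
        side′ x = does (x ∈? R) ∨ side x
        split-false : ∀ {x} → side′ x ≡ false → x ∉ R × side x ≡ false
        split-false {x} eq with x ∈? R
        split-false () | yes _
        ... | no x∉ = x∉ , eq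
        cross′ : ∀ {x z} → x ∈ v ∷ W → z ∈ v ∷ W → side′ x ≡ true → side′ z ≡ false → C x z ≡ p ⊎ C x z ≡ q
        cross′ {x} {z} x∈ z∈ sx sz with split-false sz
        ... | z∉R , sz′ with x ∈? R
        ...   | yes x∈R = subst (λ t → t ≡ p ⊎ t ≡ q)
                  (trans (C-sym a z) (trans (component-module L z∈ z∉R a∈R)
                    (trans (symm (component-module L z∈ z∉R x∈R)) (C-sym z x))))
                  (cross a∈ (tail-∈ z∈ (λ { refl → z∉R v∈R })) sa sz′)
        ...   | no x∉R = cross (tail-∈ x∈ (λ { refl → x∉R v∈R })) (tail-∈ z∈ (λ { refl → z∉R v∈R })) sx sz′

  -- Suppose `r` connects `v` to all of `W`. Then every edge leaving the `r`-component U of `x` in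
  -- `W` has colour `p`, so a spanning `q ≢ p` forces U to be all of `W`. But U lies on one side of
  -- the cut, because crossing edges are not `r`.
  module Contradiction {v W} (v∉ : v ∉ W) (K : Cut W) (p≢q : Cut.p K ≢ Cut.q K)
    {r x} (r≢p : r ≢ Cut.p K) (r≢q : r ≢ Cut.q K) (x∈ : x ∈ W) (vx : C v x ≡ Cut.p K)
    (L : Component r (v ∷ W) v) (W⊆R : ∀ {z} → z ∈ W → z ∈ Component.R L) where

    open Cut K

    private module U = Component (component r {W} x∈)

    U-side : ∀ {z} → z ∈ U.R → side z ≡ side x
    U-side = U.ind (λ z → side z ≡ side x) refl λ {y} {z} eq y∈ z∈ y≢z yz → trans (same y∈ z∈ yz) eq
      where
      not-cross : ∀ {s t} → C s t ≡ r → ¬ (C s t ≡ p ⊎ C s t ≡ q)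
      not-cross st (inj₁ e) = r≢p (trans (symm st) e)
      not-cross st (inj₂ e) = r≢q (trans (symm st) e)
      same : ∀ {y z} → y ∈ W → z ∈ W → C y z ≡ r → side z ≡ side y
      same {y} {z} y∈ z∈ yz with side y in sy | side z in sz
      ... | true  | true  = refl
      ... | false | false = refl
      ... | true  | false = ⊥-elim (not-cross yz (cross y∈ z∈ sy sz))
      ... | false | true  = ⊥-elim (not-cross (trans (C-sym z y) yz) (cross z∈ y∈ sz sy))

    -- The `r`-component Y of `y` in `W` must be attached to `v` by some `r`-edge vu. In the
    -- triangle vxu, vx has colour `p`, vu has colour `r` and xu is not `r`, so xu has colour `p`;
    -- and `x` sees all of Y in one colour.
    leaves-by-p : ∀ {y} → y ∈ W → y ∉ U.R → C x y ≡ p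
    leaves-by-p {y} y∈ y∉U = trans (symm (component-module (component r y∈) x∈ x∉Y u∈Y)) xu
      where
      module Y = Component (component r {W} y∈)
      x∉Y : x ∉ Y.R
      x∉Y x∈Y = Y.ind (_∉ U.R) y∉U
        (λ {a} {z} a∉ a∈ z∈ a≢z az z∈U → a∉ (U.closed z∈U a∈ (trans (C-sym z a) az))) x∈Y U.v∈R
      neighbour : ∃ λ u → u ∈ Y.R × C v u ≡ r
      neighbour with Any.any? (λ u → C v u Fin.≟ r) Y.R
      ... | yes found = find found
      ... | no none = ⊥-elim (Component.ind L (_∉ Y.R) (v∉ ∘ Y.R⊆W) step (W⊆R y∈) Y.v∈R)
        where
        step : ∀ {a z} → a ∉ Y.R → a ∈ v ∷ W → z ∈ v ∷ W → a ≢ z → C a z ≡ r → z ∉ Y.R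
        step a∉ (here refl) z∈ a≢z az z∈Y = none (lose z∈Y az)
        step {a} {z} a∉ (there a∈) z∈ a≢z az z∈Y = a∉ (Y.closed z∈Y a∈ (trans (C-sym z a) az))
      u = proj₁ neighbour
      u∈Y = proj₁ (proj₂ neighbour)
      vu = proj₂ (proj₂ neighbour)
      xu≢r : C x u ≢ r
      xu≢r xu≡r = x∉Y (Y.closed u∈Y x∈ (trans (C-sym u x) xu≡r))
      xu : C x u ≡ p
      xu = decidable-stable (C x u Fin.≟ p) λ xu≢p → r≢p (trans (symm vu) (trans (symm
        (isosceles (∉-≢ v∉ x∈) (λ x≡u → x∉Y (subst (_∈ Y.R) (symm x≡u) u∈Y)) (∉-≢ v∉ (Y.R⊆W u∈Y))
          (λ e → xu≢p (trans (symm e) vx)) (λ e → xu≢r (trans e vu)))) vx))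

    -- The outer end of an edge leaving U sees U in one colour, the colour `p` of its edge to `x`,
    -- so a `q`-edge cannot leave U.
    W⊆U : ∀ {z} → z ∈ W → z ∈ U.R
    W⊆U = span-q (_∈ U.R) x∈ U.v∈R step
      where
      step : ∀ {y z} → y ∈ U.R → y ∈ W → z ∈ W → y ≢ z → C y z ≡ q → z ∈ U.R
      step {y} {z} y∈U y∈ z∈ y≢z yz with z ∈? U.R
      ... | yes z∈U = z∈U
      ... | no z∉U = ⊥-elim (p≢q (trans (symm (leaves-by-p z∈ z∉U)) (trans (C-sym x z)
              (trans (symm (component-module (component r x∈) z∈ z∉U y∈U)) (trans (C-sym z y) yz)))))

    absurd : ⊥
    absurd = case trans (symm a₀-side) (trans (U-side (W⊆U a₀∈W))
      (trans (symm (U-side (W⊆U b₀∈W))) b₀-side)) of λ ()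

  -- The edge ab has colour `p` or `q`, while va and vb have neither, so va and vb share a third
  -- colour r. If the r-component of `v` misses a vertex, it is absorbed into the side opposite to
  -- that vertex. If it misses none, `p ≢ q` is contradictory, and for `p ≡ q` the vertex `v` alone
  -- is cut off, in the colours `p` and r.
  third-colour : ∀ {v W} → v ∉ W → (K : Cut W) → let open Cut K in
    Span p (v ∷ W) → Span q (v ∷ W) → ∀ {a b x} → x ∈ W → C v x ≡ p →
    a ∈ W → side a ≡ true → ¬ (C v a ≡ p ⊎ C v a ≡ q) →
    b ∈ W → side b ≡ false → ¬ (C v b ≡ p ⊎ C v b ≡ q) → Cut (v ∷ W)
  third-colour {v} {W} v∉ K span-p′ span-q′ {a} {b} {x} x∈ vx a∈ sa a-bad b∈ sb b-bad = result
    where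
    open Cut K
    r = C v a
    L = component r {v ∷ W} {v} (here refl)
    open Component L
    ab : C a b ≡ p ⊎ C a b ≡ q
    ab = cross a∈ b∈ sa sb
    ≢-third : ∀ {s t} → s ≡ p ⊎ s ≡ q → ¬ (t ≡ p ⊎ t ≡ q) → t ≢ s
    ≢-third s∈ t∉ refl = t∉ s∈
    a≢b : a ≢ b
    a≢b refl = case trans (symm sa) sb of λ ()
    vb : C v b ≡ r
    vb = symm (isosceles (∉-≢ v∉ a∈) a≢b (∉-≢ v∉ b∈) (≢-third ab a-bad) (≢-third ab b-bad ∘ symm))
    a∈R : a ∈ R
    a∈R = closed v∈R (there a∈) refl
    b∈R : b ∈ R
    b∈R = closed v∈R (there b∈) vb
    -- Every other edge at v lies in a triangle with va or vb whose third edge crosses the cut.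
    v-colours : p ≡ q → ∀ {z} → z ∈ W → C v z ≡ p ⊎ C v z ≡ r
    v-colours refl {z} z∈ with C v z Fin.≟ p
    ... | yes vz = inj₁ vz
    ... | no vz≢p with side z in sz
    ...   | false = inj₂ (symm (isosceles (∉-≢ v∉ a∈) (λ { refl → case trans (symm sa) sz of λ () }) (∉-≢ v∉ z∈)
              (≢-third az a-bad) (λ e → vz≢p (trans (symm e) ([ id , id ]′ az)))))
      where az = cross a∈ z∈ sa sz
    ...   | true = inj₂ (trans (symm (isosceles (∉-≢ v∉ b∈) (λ { refl → case trans (symm sb) sz of λ () }) (∉-≢ v∉ z∈)
              (λ e → b-bad (inj₁ (trans e bz))) (λ e → vz≢p (trans (symm e) bz)))) vb)
      where bz = trans (C-sym b z) ([ id , id ]′ (cross z∈ b∈ sz sb))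
    result : Cut (v ∷ W)
    result with Any.any? (λ y → ¬? (y ∈? R)) W
    ... | yes found with find found
    ...   | y , y∈ , y∉ with side y in sy
    ...     | false = Extend.absorb v∉ K span-p′ span-q′ L a∈ a∈R sa y∈ y∉ sy
    ...     | true = Extend.absorb v∉ (flip K) span-p′ span-q′ L b∈ b∈R (cong not sb) y∈ y∉ (cong not sy)
    result | no none with p Fin.≟ q
    ...   | no p≢q = ⊥-elim (Contradiction.absurd v∉ K p≢q
              (λ e → a-bad (inj₁ e)) (λ e → a-bad (inj₂ e)) x∈ vx L W⊆R)
      where
      W⊆R : ∀ {z} → z ∈ W → z ∈ R
      W⊆R {z} z∈ = decidable-stable (z ∈? R) (λ z∉ → none (lose z∈ z∉))
    ...   | yes p≡q = vertexCut p r v∉ a∈ (v-colours p≡q) span-p′ span-r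
      where
      W⊆R : ∀ {z} → z ∈ v ∷ W → z ∈ R
      W⊆R (here refl) = v∈R
      W⊆R {z} (there z∈) = decidable-stable (z ∈? R) (λ z∉ → none (lose z∈ z∉))
      span-r : Span r (v ∷ W)
      -- `ind` starts only at `v`. The first use of it, with an implication as predicate, carries
      -- `P` back from the given vertex to `v`.
      span-r P x∈ Px step z∈ = ind P
        (ind (λ z → P z → P v) id
          (λ {y} {z} back y∈ z∈ y≢z yz Pz → back (step Pz z∈ y∈ (y≢z ∘ symm) (trans (C-sym z y) yz)))
          (W⊆R x∈) Px)
        step (W⊆R z∈)

  -- If a colour of the cut is missing at `v`, then `v` is cut off alone. Otherwise both colours
  -- remain spanning, and `v` joins a side if its edges to the opposite side use only them; the hard
  -- case is a foreign colour towards both sides.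
  extend : ∀ {v W} → v ∉ W → Cut W → Cut (v ∷ W)
  extend {v} {W} v∉ K with Any.any? (λ x → C v x Fin.≟ Cut.p K) W
  ... | no no-p = vertexCut-mono v∉ (Cut.a₀∈W K) (Cut.span-p K) (λ x∈ e → no-p (lose x∈ e))
  ... | yes p-nbr with Any.any? (λ x → C v x Fin.≟ Cut.q K) W
  ...   | no no-q = vertexCut-mono v∉ (Cut.a₀∈W K) (Cut.span-q K) (λ x∈ e → no-q (lose x∈ e))
  ...   | yes q-nbr with find p-nbr | find q-nbr
  ...     | x , x∈ , vx | y , y∈ , vy = result
    where
    open Cut K
    ok? : ∀ z → Dec (C v z ≡ p ⊎ C v z ≡ q)
    ok? z = (C v z Fin.≟ p) ⊎-dec (C v z Fin.≟ q)
    span-p′ = span-extend span-p v∉ x∈ vx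
    span-q′ = span-extend span-q v∉ y∈ vy
    result : Cut (v ∷ W)
    result with Any.any? (λ z → (side z Bool.≟ true) ×-dec ¬? (ok? z)) W
    ... | no none = Extend.addFalse v∉ K span-p′ span-q′
          (λ {z} z∈ sz → decidable-stable (ok? z) (λ bad → none (lose z∈ (sz , bad))))
    ... | yes foundA with Any.any? (λ z → (side z Bool.≟ false) ×-dec ¬? (ok? z)) W
    ...   | no none = Extend.addFalse v∉ (flip K) span-p′ span-q′
            (λ {z} z∈ sz → decidable-stable (ok? z) (λ bad → none (lose z∈ (Bool.not-injective sz , bad))))
    ...   | yes foundB with find foundA | find foundB
    ...     | a , a∈ , sa , a-bad | b , b∈ , sb , b-bad =
              third-colour v∉ K span-p′ span-q′ x∈ vx a∈ sa a-bad b∈ sb b-bad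

  cut : ∀ W → Unique W → 2 ≤ length W → Cut W
  cut (x ∷ []) _ (s≤s ())
  cut (x ∷ y ∷ []) ((x≢y ∷ []) ∷ _) _ =
    vertexCut (C x y) (C x y) x∉ (here refl) (λ { (here refl) → inj₁ refl }) span span
    where
    span-single : ∀ {p} → Span p (y ∷ [])
    span-single P (here refl) Px step (here refl) = Px
    x∉ : x ∉ y ∷ []
    x∉ (here e) = x≢y e
    span : Span (C x y) (x ∷ y ∷ [])
    span = span-extend span-single x∉ (here refl) refl
  cut (x ∷ y ∷ z ∷ W) (x≢ ∷ u) _ = extend (λ x∈ → All.lookup x≢ x∈ refl) (cut (y ∷ z ∷ W) u (s≤s (s≤s z≤n)))

-- Lower bound: counting pairs in small colours

∑ᴸ : ∀ {A : Set} → List A → (A → ℕ) → ℕ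
∑ᴸ []      f = 0
∑ᴸ (x ∷ W) f = f x + ∑ᴸ W f

∑ᴸ-mono : ∀ {A : Set} (W : List A) {f g : A → ℕ} → (∀ {x} → x ∈ W → f x ≤ g x) → ∑ᴸ W f ≤ ∑ᴸ W g
∑ᴸ-mono []      le = z≤n
∑ᴸ-mono (x ∷ W) le = +-mono-≤ (le (here refl)) (∑ᴸ-mono W (le ∘ there))

∑ᴸ-const : ∀ {A : Set} (W : List A) c → ∑ᴸ W (λ _ → c) ≡ length W * c
∑ᴸ-const []      c = refl
∑ᴸ-const (x ∷ W) c = cong (c +_) (∑ᴸ-const W c)

∑ᴸ-zero : ∀ {A : Set} (W : List A) {f : A → ℕ} → (∀ {x} → x ∈ W → f x ≡ 0) → ∑ᴸ W f ≡ 0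
∑ᴸ-zero W eq = n≤0⇒n≡0 (≤-trans (∑ᴸ-mono W (≤-reflexive ∘ eq))
  (≤-reflexive (trans (∑ᴸ-const W 0) (*-zeroʳ (length W)))))

∑ᴸ-+ : ∀ {A : Set} (W : List A) (f g : A → ℕ) → ∑ᴸ W (λ x → f x + g x) ≡ ∑ᴸ W f + ∑ᴸ W g
∑ᴸ-+ []      f g = refl
∑ᴸ-+ (x ∷ W) f g = trans (cong (f x + g x +_) (∑ᴸ-+ W f g)) (interchange (f x) (g x) _ _)

∑ᴸ-allFin : ∀ {n} (f : Fin n → ℕ) → ∑ᴸ (allFin n) f ≡ ∑ f
∑ᴸ-allFin {n} f = go id
  where
  go : ∀ {m} (g : Fin m → Fin n) → ∑ᴸ (tabulate g) f ≡ ∑ (f ∘ g)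
  go {zero}  g = refl
  go {suc m} g = cong (f (g Fin.zero) +_) (go (g ∘ Fin.suc))

onSide : ∀ {A : Set} → (A → Bool) → Bool → List A → List A
onSide side b = filter (λ x → side x Bool.≟ b)

∑ᴸ-sides : ∀ {A : Set} (side : A → Bool) W f →
  ∑ᴸ W f ≡ ∑ᴸ (onSide side true W) f + ∑ᴸ (onSide side false W) f
∑ᴸ-sides side []      f = refl
∑ᴸ-sides side (x ∷ W) f with side x
... | true  = trans (cong (f x +_) (∑ᴸ-sides side W f)) (symm (+-assoc (f x) _ _))
... | false = trans (cong (f x +_) (∑ᴸ-sides side W f)) (rearrange (f x) (∑ᴸ (onSide side true W) f) (∑ᴸ (onSide side false W) f))
  where
  rearrange : ∀ a b c → a + (b + c) ≡ b + (a + c)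
  rearrange = solve-∀

module SmallColours {n k} (c : EdgeColouring n k) (gallai : IsGallai c) (small : Fin k → Bool) where

  open GallaiCut c gallai

  -- Ordered pairs are counted, so that rows can be summed over any list of vertices regardless of
  -- the order on `Fin n`; the diagonal is excluded since `col` is meaningless there.
  mono : Fin k → Fin n → Fin n → ℕ
  mono i x y = if does (x Fin.≟ y) then 0 else 𝟙 (does (C x y Fin.≟ i))

  ordered : Fin k → ℕ
  ordered i = ∑ λ x → ∑ λ y → mono i x y

  mono-cells : ∀ i x y → mono i x y ≡
    𝟙 (does (x Fin.<? y)) * 𝟙 (does (C x y Fin.≟ i)) + 𝟙 (does (y Fin.<? x)) * 𝟙 (does (C y x Fin.≟ i))
  mono-cells i x y with Fin.<-cmp x y
  ... | tri< x<y x≢y y≮x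
    rewrite dec-false (x Fin.≟ y) x≢y | dec-true (x Fin.<? y) x<y | dec-false (y Fin.<? x) y≮x =
    symm (trans (+-identityʳ _) (+-identityʳ _))
  ... | tri≈ x≮y refl _
    rewrite dec-true (x Fin.≟ x) refl | dec-false (x Fin.<? x) x≮y = refl
  ... | tri> x≮y x≢y y<x
    rewrite dec-false (x Fin.≟ y) x≢y | dec-false (x Fin.<? y) x≮y | dec-true (y Fin.<? x) y<x =
    trans (cong (λ t → 𝟙 (does (t Fin.≟ i))) (C-sym x y)) (symm (+-identityʳ _))

  ordered-count : ∀ i → ordered i ≡ 2 * colourCount c i
  ordered-count i = begin-equality
    ordered i
      ≡⟨ ∑-cong (λ x → trans (∑-cong (mono-cells i x)) (∑-+ (cell x) (λ y → cell y x))) ⟩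
    ∑ (λ x → ∑ (cell x) + ∑ (λ y → cell y x))
      ≡⟨ ∑-+ (λ x → ∑ (cell x)) (λ x → ∑ (λ y → cell y x)) ⟩
    ∑ (λ x → ∑ (cell x)) + ∑ (λ x → ∑ (λ y → cell y x))
      ≡⟨ cong₂ _+_ (symm (colourCount-∑ c i)) (trans (symm (∑-swap cell)) (symm (colourCount-∑ c i))) ⟩
    colourCount c i + colourCount c i
      ≡⟨ cong (colourCount c i +_) (+-identityʳ _) ⟨
    2 * colourCount c i ∎
    where
    open ≤-Reasoning
    cell : Fin n → Fin n → ℕ
    cell x y = 𝟙 (does (x Fin.<? y)) * 𝟙 (does (C x y Fin.≟ i))

  smallPair : Fin n → Fin n → ℕ
  smallPair x y = if does (x Fin.≟ y) then 0 else 𝟙 (small (C x y))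

  smallPair≤1 : ∀ x y → smallPair x y ≤ 1
  smallPair≤1 x y with does (x Fin.≟ y)
  ... | true  = z≤n
  ... | false = 𝟙≤1 _

  smallPair-∑ : ∀ x y → smallPair x y ≡ ∑ (λ i → 𝟙 (small i) * mono i x y)
  smallPair-∑ x y with does (x Fin.≟ y)
  ... | true  = symm (∑-zero {k} (λ i → *-zeroʳ (𝟙 (small i))))
  ... | false = trans (symm (∑-δ (C x y) (𝟙 (small (C x y))))) (∑-cong pointwise)
    where
    pointwise : ∀ i → δ (C x y) (𝟙 (small (C x y))) i ≡ 𝟙 (small i) * 𝟙 (does (C x y Fin.≟ i))
    pointwise i with C x y Fin.≟ i
    ... | yes refl = symm (*-identityʳ _)
    ... | no _     = symm (*-zeroʳ (𝟙 (small i)))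

  smallPair-total : ∑ (λ x → ∑ (smallPair x)) ≡ ∑ (λ i → 𝟙 (small i) * ordered i)
  smallPair-total = begin-equality
    ∑ (λ x → ∑ (smallPair x))
      ≡⟨ ∑-cong (λ x → trans (∑-cong (smallPair-∑ x)) (∑-swap (λ y i → 𝟙 (small i) * mono i x y))) ⟩
    ∑ (λ x → ∑ (λ i → ∑ (λ y → 𝟙 (small i) * mono i x y)))
      ≡⟨ ∑-swap (λ x i → ∑ (λ y → 𝟙 (small i) * mono i x y)) ⟩
    ∑ (λ i → ∑ (λ x → ∑ (λ y → 𝟙 (small i) * mono i x y)))
      ≡⟨ ∑-cong (λ i → trans (∑-cong (λ x → ∑-*ˡ (𝟙 (small i)) (mono i x)))
           (∑-*ˡ (𝟙 (small i)) (λ x → ∑ (mono i x)))) ⟩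
    ∑ (λ i → 𝟙 (small i) * ordered i) ∎
    where open ≤-Reasoning

  -- Says that `W` repeats no vertex, in the form that bounds sums directly and passes to the sides
  -- of a cut.
  Dominated : List (Fin n) → Set
  Dominated W = ∀ f → ∑ᴸ W f ≤ ∑ f

  pairs : List (Fin n) → ℕ
  pairs W = ∑ᴸ W λ x → ∑ᴸ W λ y → smallPair x y

  pairs≤ : ∀ W → pairs W ≤ length W * length W
  pairs≤ W = ≤-trans (∑ᴸ-mono W (λ {x} _ → ≤-trans (∑ᴸ-mono W (λ {y} _ → smallPair≤1 x y))
      (≤-reflexive (trans (∑ᴸ-const W 1) (*-identityʳ _)))))
    (≤-reflexive (∑ᴸ-const W (length W)))

  -- If a vertex of `W` had no `p`-neighbour, its singleton would be closed under `p`-edges, and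
  -- spanning would identify `a` with `b`. So each vertex of `W` starts an ordered pair of colour
  -- `p`.
  span-≥ : ∀ {p W a b} → Dominated W → a ∈ W → b ∈ W → a ≢ b → Span p W → length W ≤ ordered p
  span-≥ {p} {W} {a} {b} dom a∈ b∈ a≢b span = begin
    length W ≡⟨ trans (∑ᴸ-const W 1) (*-identityʳ _) ⟨
    ∑ᴸ W (λ _ → 1) ≤⟨ ∑ᴸ-mono W neighbour ⟩
    ∑ᴸ W (λ x → ∑ (mono p x)) ≤⟨ dom _ ⟩
    ordered p ∎
    where
    open ≤-Reasoning
    neighbour : ∀ {x} → x ∈ W → 1 ≤ ∑ (mono p x)
    neighbour {x} x∈ with Fin.any? (λ y → ¬? (x Fin.≟ y) ×-dec (C x y Fin.≟ p))
    ... | yes (y , x≢y , xy) = ≤-trans (≡⇒≥ one) (∑-≥ (mono p x) y)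
      where
      one : mono p x y ≡ 1
      one rewrite dec-false (x Fin.≟ y) x≢y | dec-true (C x y Fin.≟ p) xy = refl
    ... | no none = ⊥-elim (a≢b (trans (isolated a∈) (symm (isolated b∈))))
      where
      isolated : ∀ {z} → z ∈ W → z ≡ x
      isolated = span (_≡ x) x∈ refl (λ { refl _ _ y≢z yz → ⊥-elim (none (_ , y≢z , yz)) })

  module _ {W} (dom : Dominated W) (K : Cut W) where
    open Cut K

    A B : List (Fin n)
    A = onSide side true W
    B = onSide side false W

    length-sides : length W ≡ length A + length B
    length-sides = trans (count W) (trans (∑ᴸ-sides side W (λ _ → 1)) (symm (cong₂ _+_ (count A) (count B))))
      where
      count : ∀ V → length V ≡ ∑ᴸ V (λ _ → 1)
      count V = symm (trans (∑ᴸ-const V 1) (*-identityʳ _))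

    ∈A : ∀ {x} → x ∈ A → x ∈ W × side x ≡ true
    ∈A = ∈-filter⁻ (λ x → side x Bool.≟ true)

    ∈B : ∀ {x} → x ∈ B → x ∈ W × side x ≡ false
    ∈B = ∈-filter⁻ (λ x → side x Bool.≟ false)

    dom-A : Dominated A
    dom-A f = ≤-trans (≤-trans (m≤m+n _ _) (≡⇒≥ (∑ᴸ-sides side W f))) (dom f)

    dom-B : Dominated B
    dom-B f = ≤-trans (≤-trans (m≤n+m _ _) (≡⇒≥ (∑ᴸ-sides side W f))) (dom f)

    nonempty : ∀ {x} {V : List (Fin n)} → x ∈ V → 1 ≤ length V
    nonempty {V = _ ∷ _} _ = s≤s z≤n

    1≤A : 1 ≤ length A
    1≤A = nonempty (∈-filter⁺ (λ x → side x Bool.≟ true) a₀∈W a₀-side)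

    1≤B : 1 ≤ length B
    1≤B = nonempty (∈-filter⁺ (λ x → side x Bool.≟ false) b₀∈W b₀-side)

    a₀≢b₀ : a₀ ≢ b₀
    a₀≢b₀ eq = case trans (symm a₀-side) (trans (cong side eq) b₀-side) of λ ()

    |W|≤p : length W ≤ ordered p
    |W|≤p = span-≥ dom a₀∈W b₀∈W a₀≢b₀ span-p

    |W|≤q : length W ≤ ordered q
    |W|≤q = span-≥ dom a₀∈W b₀∈W a₀≢b₀ span-q

    crossing-≢ : ∀ {x y} → x ∈ A → y ∈ B → x ≢ y
    crossing-≢ x∈ y∈ refl = case trans (symm (proj₂ (∈A x∈))) (proj₂ (∈B y∈)) of λ ()

    crossing : ∀ {x y} → x ∈ A → y ∈ B → C x y ≡ p ⊎ C x y ≡ q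
    crossing x∈ y∈ = cross (proj₁ (∈A x∈)) (proj₁ (∈B y∈)) (proj₂ (∈A x∈)) (proj₂ (∈B y∈))

    |A||B|≤ : length A * length B ≤ ordered p + ordered q
    |A||B|≤ = begin
      length A * length B
        ≡⟨ ∑ᴸ-const A (length B) ⟨
      ∑ᴸ A (λ _ → length B)
        ≤⟨ ∑ᴸ-mono A row ⟩
      ∑ᴸ A (λ x → ∑ (mono p x) + ∑ (mono q x))
        ≡⟨ ∑ᴸ-+ A (λ x → ∑ (mono p x)) (λ x → ∑ (mono q x)) ⟩
      ∑ᴸ A (λ x → ∑ (mono p x)) + ∑ᴸ A (λ x → ∑ (mono q x))
        ≤⟨ +-mono-≤ (dom-A _) (dom-A _) ⟩
      ordered p + ordered q ∎
      where
      open ≤-Reasoning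
      hit : ∀ {x y} → x ∈ A → y ∈ B → 1 ≤ mono p x y + mono q x y
      hit {x} {y} x∈ y∈ rewrite dec-false (x Fin.≟ y) (crossing-≢ x∈ y∈) with crossing x∈ y∈
      ... | inj₁ e rewrite dec-true (C x y Fin.≟ p) e = m≤m+n 1 _
      ... | inj₂ e rewrite dec-true (C x y Fin.≟ q) e = m≤n+m 1 _
      row : ∀ {x} → x ∈ A → length B ≤ ∑ (mono p x) + ∑ (mono q x)
      row {x} x∈ = begin
        length B ≡⟨ trans (∑ᴸ-const B 1) (*-identityʳ _) ⟨
        ∑ᴸ B (λ _ → 1) ≤⟨ ∑ᴸ-mono B (hit x∈) ⟩
        ∑ᴸ B (λ y → mono p x y + mono q x y) ≤⟨ dom-B _ ⟩
        ∑ (λ y → mono p x y + mono q x y) ≡⟨ ∑-+ (mono p x) (mono q x) ⟩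
        ∑ (mono p x) + ∑ (mono q x) ∎

    pairs-split : small p ≡ false → small q ≡ false → pairs W ≡ pairs A + pairs B
    pairs-split p-big q-big = trans (∑ᴸ-sides side W _) (cong₂ _+_
      (trans (split A) (trans (cong (pairs A +_) (∑ᴸ-zero A (λ x∈ → ∑ᴸ-zero B (no-small x∈)))) (+-identityʳ _)))
      (trans (split B) (cong (_+ pairs B) (∑ᴸ-zero B (λ {y} y∈ → ∑ᴸ-zero A (λ {x} x∈ →
        trans (smallPair-sym y x) (no-small x∈ y∈)))))))
      where
      split : ∀ V → ∑ᴸ V (λ x → ∑ᴸ W (smallPair x)) ≡
        ∑ᴸ V (λ x → ∑ᴸ A (smallPair x)) + ∑ᴸ V (λ x → ∑ᴸ B (smallPair x))
      split V = trans (≤-antisym (∑ᴸ-mono V λ {x} _ → ≤-reflexive (∑ᴸ-sides side W (smallPair x)))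
                                 (∑ᴸ-mono V λ {x} _ → ≡⇒≥ (∑ᴸ-sides side W (smallPair x))))
                      (∑ᴸ-+ V _ _)
      no-small : ∀ {x y} → x ∈ A → y ∈ B → smallPair x y ≡ 0
      no-small {x} {y} x∈ y∈ rewrite dec-false (x Fin.≟ y) (crossing-≢ x∈ y∈) =
        cong 𝟙 (big (crossing x∈ y∈))
        where
        big : ∀ {t} → t ≡ p ⊎ t ≡ q → small t ≡ false
        big (inj₁ refl) = p-big
        big (inj₂ refl) = q-big
      smallPair-sym : ∀ x y → smallPair x y ≡ smallPair y x
      smallPair-sym x y with x Fin.≟ y
      ... | yes refl rewrite dec-true (x Fin.≟ x) refl = refl
      ... | no x≢y rewrite dec-false (y Fin.≟ x) (x≢y ∘ symm) = cong (𝟙 ∘ small) (C-sym x y)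

  module Bound (s E : ℕ) .{{_ : NonZero s}}
    (small-≤ : ∀ i → small i ≡ true → ordered i ≤ s) (all-≤ : ∀ i → ordered i ≤ E) where

    F : ℕ
    F = 8 * E

    -- In `bound`, the term `F * length W` is a potential that pays for the peelings within one
    -- dyadic range. When the range is left it is at most `F * H`, the price of one unit of `j`.
    next-level : ∀ H s² F j → H * (s² + F * j) + F * H ≡ H * (s² + F * suc j)
    next-level = solve-∀

    -- Peeling the smaller side a off a set of size m ≥ H / 2 costs a² ≤ a (2 · 2E / m) small pairs;
    -- summed over a dyadic range of m this is O(E).
    bound : ∀ fuel j W → length W ≤ fuel → Unique W → Dominated W → length W ≤ 2 ^ j * s →
      2 ^ j * s * pairs W ≤ 2 ^ j * s * (s * s + F * j) + F * length W
    bound fuel zero W _ _ _ len = ≤-trans (*-monoʳ-≤ (1 * s) (≤-trans (pairs≤ W) (≤-trans (*-mono-≤ len′ len′) (m≤m+n _ _))))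
                                          (m≤m+n _ _)
      where
      len′ : length W ≤ s
      len′ = ≤-trans len (≤-reflexive (*-identityˡ s))
    bound fuel (suc j) W |W|≤fuel uniq dom len with length W ≤? 2 ^ j * s
    ... | yes short = ≤-trans (*-monoʳ-≤ (2 ^ suc j * s) smaller) (m≤m+n _ _)
      where
      H = 2 ^ j * s
      instance
        H≢0 : NonZero H
        H≢0 = m*n≢0 (2 ^ j) s {{m^n≢0 2 j}}
      smaller : pairs W ≤ s * s + F * suc j
      smaller = *-cancelˡ-≤ H (≤-trans (bound fuel j W |W|≤fuel uniq dom short)
        (≤-trans (+-monoʳ-≤ (H * (s * s + F * j)) (*-monoʳ-≤ F short)) (≤-reflexive (next-level H (s * s) F j))))
    bound zero (suc j) W |W|≤0 uniq dom len | no long =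
      ⊥-elim (long (≤-trans |W|≤0 z≤n))
    bound (suc fuel) (suc j) W |W|≤fuel uniq dom len | no long = result
      where
      H m : ℕ
      H = 2 ^ suc j * s
      m = length W
      1≤2^ : 1 ≤ 2 ^ j
      1≤2^ = m^n>0 2 j
      s<m : s < m
      s<m = ≤-trans (s≤s (≤-trans (≡⇒≥ (*-identityˡ s)) (*-monoˡ-≤ s 1≤2^))) (≰⇒> long)
      H≤2m : H ≤ 2 * m
      H≤2m = ≤-trans (≤-reflexive (*-assoc 2 (2 ^ j) s)) (*-monoʳ-≤ 2 (<⇒≤ (≰⇒> long)))
      K : Cut W
      K = cut W uniq (≤-trans (s≤s (>-nonZero⁻¹ s)) s<m)
      open Cut K using (side; p; q)
      a b : ℕ
      a = length (A dom K)
      b = length (B dom K)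
      m≡a+b : m ≡ a + b
      m≡a+b = length-sides dom K
      big : ∀ i → m ≤ ordered i → small i ≡ false
      big i m≤ with small i in eq
      ... | false = refl
      ... | true = ⊥-elim (<⇒≱ s<m (≤-trans m≤ (small-≤ i eq)))
      split : pairs W ≡ pairs (A dom K) + pairs (B dom K)
      split = pairs-split dom K (big p (|W|≤p dom K)) (big q (|W|≤q dom K))
      ab≤ : a * b ≤ 2 * E
      ab≤ = ≤-trans (|A||B|≤ dom K) (≤-trans (+-mono-≤ (all-≤ p) (all-≤ q))
        (≤-reflexive (cong (E +_) (symm (+-identityʳ E)))))
      cost : ∀ x y → x + y ≡ m → x * y ≤ 2 * E → x ≤ y → H * (x * x) ≤ F * x
      cost x y x+y xy x≤y = begin
        H * (x * x) ≤⟨ *-monoˡ-≤ (x * x) H≤2m ⟩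
        2 * m * (x * x) ≤⟨ *-monoˡ-≤ (x * x) (*-monoʳ-≤ 2 (≤-trans (≡⇒≥ x+y) (+-monoˡ-≤ y x≤y))) ⟩
        2 * (y + y) * (x * x) ≡⟨ rearrange x y ⟩
        4 * x * (x * y) ≤⟨ *-monoʳ-≤ (4 * x) xy ⟩
        4 * x * (2 * E) ≡⟨ rearrange′ x E ⟩
        F * x ∎
        where
        open ≤-Reasoning
        rearrange : ∀ x y → 2 * (y + y) * (x * x) ≡ 4 * x * (x * y)
        rearrange = solve-∀
        rearrange′ : ∀ x E → 4 * x * (2 * E) ≡ 8 * E * x
        rearrange′ = solve-∀
      glue : ∀ x y Sx Sy → x + y ≡ m → x * y ≤ 2 * E → x ≤ y → Sx ≤ x * x →
        H * Sy ≤ H * (s * s + F * suc j) + F * y → H * (Sx + Sy) ≤ H * (s * s + F * suc j) + F * m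
      glue x y Sx Sy x+y xy x≤y Sx≤ ih = begin
        H * (Sx + Sy) ≡⟨ *-distribˡ-+ H Sx Sy ⟩
        H * Sx + H * Sy ≤⟨ +-mono-≤ (≤-trans (*-monoʳ-≤ H Sx≤) (cost x y x+y xy x≤y)) ih ⟩
        F * x + (H * (s * s + F * suc j) + F * y) ≡⟨ rearrange F x y (H * (s * s + F * suc j)) ⟩
        H * (s * s + F * suc j) + F * (x + y) ≡⟨ cong (λ t → H * (s * s + F * suc j) + F * t) x+y ⟩
        H * (s * s + F * suc j) + F * m ∎
        where
        open ≤-Reasoning
        rearrange : ∀ F x y Z → F * x + (Z + F * y) ≡ Z + F * (x + y)
        rearrange = solve-∀
      result : H * pairs W ≤ H * (s * s + F * suc j) + F * m
      result with ≤-total a b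
      ... | inj₁ a≤b = subst (λ t → H * t ≤ _) (symm split)
            (glue a b _ _ (symm m≡a+b) ab≤ a≤b (pairs≤ (A dom K))
              (bound fuel (suc j) (B dom K) (≤-pred (≤-trans b<m |W|≤fuel))
                (Unique.filter⁺ _ uniq) (dom-B dom K) (≤-trans (<⇒≤ b<m) len)))
        where
        b<m : b < m
        b<m = ≤-trans (+-monoˡ-≤ b (1≤A dom K)) (≡⇒≥ m≡a+b)
      ... | inj₂ b≤a = subst (λ t → H * t ≤ _) (trans (+-comm (pairs (B dom K)) _) (symm split))
            (glue b a _ _ (trans (+-comm b a) (symm m≡a+b)) (≤-trans (≤-reflexive (*-comm b a)) ab≤) b≤a (pairs≤ (B dom K))
              (bound fuel (suc j) (A dom K) (≤-pred (≤-trans a<m |W|≤fuel))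
                (Unique.filter⁺ _ uniq) (dom-A dom K) (≤-trans (<⇒≤ a<m) len)))
        where
        a<m : a < m
        a<m = ≤-trans (≤-trans (≤-reflexive (+-comm 1 a)) (+-monoʳ-≤ a (1≤B dom K))) (≡⇒≥ m≡a+b)

    total-bound : ∀ j → n ≤ 2 ^ j * s → ∑ (λ i → 𝟙 (small i) * ordered i) ≤ s * s + F * suc j
    total-bound j n≤ = *-cancelˡ-≤ H (begin
      H * ∑ (λ i → 𝟙 (small i) * ordered i) ≡⟨ cong (H *_) total ⟩
      H * pairs (allFin n) ≤⟨ bound n j (allFin n) (≤-reflexive length-all) (Unique.allFin⁺ n)
                                                    (λ f → ≤-reflexive (∑ᴸ-allFin f)) (≤-trans (≤-reflexive length-all) n≤) ⟩
      H * (s * s + F * j) + F * length (allFin n) ≤⟨ +-monoʳ-≤ _ (*-monoʳ-≤ F (≤-trans (≤-reflexive length-all) n≤)) ⟩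
      H * (s * s + F * j) + F * H ≡⟨ next-level H (s * s) F j ⟩
      H * (s * s + F * suc j) ∎)
      where
      open ≤-Reasoning
      H = 2 ^ j * s
      instance
        H≢0 : NonZero H
        H≢0 = m*n≢0 (2 ^ j) s {{m^n≢0 2 j}}
      length-all : length (allFin n) ≡ n
      length-all = length-tabulate {n = n} id
      total : ∑ (λ i → 𝟙 (small i) * ordered i) ≡ pairs (allFin n)
      total = trans (symm smallPair-total) (trans (∑-cong (λ x → symm (∑ᴸ-allFin (smallPair x))))
        (symm (∑ᴸ-allFin (λ x → ∑ᴸ (allFin n) (smallPair x)))))

-- Lower bound: a sequence that is not realizable

module HardSequence (κ d n j : ℕ) (1≤κ : 1 ≤ κ) (d<16κ : suc d ≤ 16 * κ) (8κ≤1+d : 8 * κ ≤ suc d)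
  (8κ²≤tri : 8 * κ * κ ≤ tri n) (n≤ : n ≤ 2 ^ j * (2 * κ))
  (n-small : (n * n + 512 * (κ * κ)) * suc j < 12 * (κ * κ * κ)) where

  rest : ℕ
  rest = tri n ∸ 8 * κ * κ

  big : Fin (suc d) → ℕ
  big Fin.zero    = rest / suc d + rest % suc d
  big (Fin.suc _) = rest / suc d

  e : Fin (8 * κ + suc d) → ℕ
  e i = [ (λ _ → κ) , big ]′ (splitAt (8 * κ) i)

  small : Fin (8 * κ + suc d) → Bool
  small i = [ (λ _ → true) , (λ _ → false) ]′ (splitAt (8 * κ) i)

  ∑-e : ∑ e ≡ n C 2
  ∑-e = begin-equality
    ∑ e
      ≡⟨ ∑-splitAt (8 * κ) e ⟩
    ∑ (λ x → e (x ↑ˡ suc d)) + ∑ (λ y → e (8 * κ ↑ʳ y))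
      ≡⟨ cong₂ _+_ (trans (∑-cong (λ x → cong [ (λ _ → κ) , big ]′ (Fin.splitAt-↑ˡ (8 * κ) x (suc d)))) (∑-const (8 * κ) κ))
                   (∑-cong (λ y → cong [ (λ _ → κ) , big ]′ (Fin.splitAt-↑ʳ (8 * κ) (suc d) y))) ⟩
    8 * κ * κ + ∑ big
      ≡⟨ cong (8 * κ * κ +_) ∑-big ⟩
    8 * κ * κ + rest
      ≡⟨ m+[n∸m]≡n 8κ²≤tri ⟩
    tri n
      ≡⟨ tri-C n ⟨
    n C 2 ∎
    where
    open ≤-Reasoning
    rearrange : ∀ q r d → q + r + d * q ≡ r + (q + d * q)
    rearrange = solve-∀
    ∑-big : ∑ big ≡ rest
    ∑-big = begin-equality
      rest / suc d + rest % suc d + ∑ {d} (λ _ → rest / suc d)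
        ≡⟨ cong (rest / suc d + rest % suc d +_) (∑-const d _) ⟩
      rest / suc d + rest % suc d + d * (rest / suc d)
        ≡⟨ rearrange (rest / suc d) (rest % suc d) d ⟩
      rest % suc d + suc d * (rest / suc d)
        ≡⟨ cong (rest % suc d +_) (*-comm (suc d) (rest / suc d)) ⟩
      rest % suc d + rest / suc d * suc d
        ≡⟨ m≡m%n+[m/n]*n rest (suc d) ⟨
      rest ∎

  -- Bounds ordered pairs, hence the factor 2; the summand `16 * κ` covers the remainder of the
  -- division, which the first big colour carries.
  E : ℕ
  E = 2 * (rest / suc d + 16 * κ)

  big≤ : ∀ y → 2 * big y ≤ E
  big≤ Fin.zero = *-monoʳ-≤ 2 (+-monoʳ-≤ (rest / suc d) (≤-trans (<⇒≤ (m%n<n rest (suc d))) d<16κ))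
  big≤ (Fin.suc _) = *-monoʳ-≤ 2 (m≤m+n (rest / suc d) (16 * κ))

  8κE≤ : 8 * κ * E ≤ n * n + 512 * (κ * κ)
  8κE≤ = begin
    8 * κ * E ≡⟨ rearrange κ (rest / suc d) ⟩
    2 * (8 * κ * (rest / suc d)) + 256 * (κ * κ) ≤⟨ +-mono-≤ (*-monoʳ-≤ 2 quotient) (*-monoˡ-≤ (κ * κ) (m≤m+n 256 256)) ⟩
    2 * tri n + 512 * (κ * κ) ≤⟨ +-monoˡ-≤ _ (2tri≤² n) ⟩
    n * n + 512 * (κ * κ) ∎
    where
    open ≤-Reasoning
    rearrange : ∀ κ q → 8 * κ * (2 * (q + 16 * κ)) ≡ 2 * (8 * κ * q) + 256 * (κ * κ)
    rearrange = solve-∀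
    quotient : 8 * κ * (rest / suc d) ≤ tri n
    quotient = begin
      8 * κ * (rest / suc d) ≤⟨ *-monoˡ-≤ (rest / suc d) 8κ≤1+d ⟩
      suc d * (rest / suc d) ≡⟨ *-comm (suc d) (rest / suc d) ⟩
      rest / suc d * suc d ≤⟨ m≤n+m _ (rest % suc d) ⟩
      rest % suc d + rest / suc d * suc d ≡⟨ m≡m%n+[m/n]*n rest (suc d) ⟨
      rest ≤⟨ m∸n≤m (tri n) (8 * κ * κ) ⟩
      tri n ∎

  -- The 8κ small colours have 8κ · 2κ = 16κ² ordered pairs, whereas the cut argument with s = 2κ
  -- allows at most 4κ² + 8E (j + 1). After multiplication by κ, `n-small` makes this less than 4κ³
  -- + 12κ³.
  unrealizable : ¬ Realizable n e
  unrealizable (c , gallai , dist) = <⇒≱ few many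
    where
    open SmallColours c gallai small
    instance
      2κ≢0 : NonZero (2 * κ)
      2κ≢0 = >-nonZero (*-mono-≤ {1} {2} (s≤s z≤n) 1≤κ)
    ordered-e : ∀ i → ordered i ≡ 2 * e i
    ordered-e i = trans (ordered-count i) (cong (2 *_) (dist i))
    κ≤ : 2 * κ ≤ E
    κ≤ = *-monoʳ-≤ 2 (≤-trans (m≤m+n κ (15 * κ)) (m≤n+m (16 * κ) (rest / suc d)))
    small-≤ : ∀ i → small i ≡ true → ordered i ≤ 2 * κ
    small-≤ i eq with splitAt (8 * κ) i | ordered-e i
    ... | inj₁ _ | oe = ≤-reflexive oe
    small-≤ i () | inj₂ _ | _
    all-≤ : ∀ i → ordered i ≤ E
    all-≤ i with splitAt (8 * κ) i | ordered-e i
    ... | inj₁ _ | oe = ≤-trans (≤-reflexive oe) κ≤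
    ... | inj₂ y | oe = ≤-trans (≤-reflexive oe) (big≤ y)
    open Bound (2 * κ) E small-≤ all-≤
    open ≤-Reasoning
    total : ∑ (λ i → 𝟙 (small i) * ordered i) ≡ 16 * (κ * κ)
    total = begin-equality
      ∑ (λ i → 𝟙 (small i) * ordered i)
        ≡⟨ ∑-cong (λ i → cong (𝟙 (small i) *_) (ordered-e i)) ⟩
      ∑ (λ i → 𝟙 (small i) * (2 * e i))
        ≡⟨ ∑-splitAt (8 * κ) _ ⟩
      ∑ (λ x → f (x ↑ˡ suc d)) + ∑ (λ y → f (8 * κ ↑ʳ y))
        ≡⟨ cong₂ _+_ (trans (∑-cong left) (∑-const (8 * κ) _)) (∑-zero right) ⟩
      8 * κ * (1 * (2 * κ)) + 0
        ≡⟨ rearrange κ ⟩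
      16 * (κ * κ) ∎
      where
      f : Fin (8 * κ + suc d) → ℕ
      f i = 𝟙 (small i) * (2 * e i)
      left : ∀ x → f (x ↑ˡ suc d) ≡ 1 * (2 * κ)
      left x rewrite Fin.splitAt-↑ˡ (8 * κ) x (suc d) = refl
      right : ∀ y → f (8 * κ ↑ʳ y) ≡ 0
      right y rewrite Fin.splitAt-↑ʳ (8 * κ) (suc d) y = refl
      rearrange : ∀ κ → 8 * κ * (1 * (2 * κ)) + 0 ≡ 16 * (κ * κ)
      rearrange = solve-∀
    many : 16 * (κ * κ) ≤ 2 * κ * (2 * κ) + F * suc j
    many = ≤-trans (≡⇒≥ total) (total-bound j n≤)
    few : 2 * κ * (2 * κ) + F * suc j < 16 * (κ * κ)
    few = *-cancelˡ-< κ _ _ (begin-strict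
      κ * (2 * κ * (2 * κ) + F * suc j) ≡⟨ rearrange κ E (suc j) ⟩
      4 * (κ * κ * κ) + 8 * κ * E * suc j ≤⟨ +-monoʳ-≤ (4 * (κ * κ * κ)) (*-monoˡ-≤ (suc j) 8κE≤) ⟩
      4 * (κ * κ * κ) + (n * n + 512 * (κ * κ)) * suc j <⟨ +-monoʳ-< (4 * (κ * κ * κ)) n-small ⟩
      4 * (κ * κ * κ) + 12 * (κ * κ * κ) ≡⟨ rearrange′ κ ⟩
      κ * (16 * (κ * κ)) ∎)
      where
      rearrange : ∀ κ E J → κ * (2 * κ * (2 * κ) + 8 * E * J) ≡ 4 * (κ * κ * κ) + 8 * κ * E * J
      rearrange = solve-∀
      rearrange′ : ∀ κ → 4 * (κ * κ * κ) + 12 * (κ * κ * κ) ≡ κ * (16 * (κ * κ))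
      rearrange′ = solve-∀

module LowerBound (k κ L g : ℕ) (20≤L : 20 ≤ L) (2^L≤k : 2 ^ L ≤ k) (k<2^1+L : k < 2 ^ suc L)
  (k<16κ+16 : k < 16 + κ * 16) (16κ≤k : κ * 16 ≤ k) (prop : GallaiProperty k g) where

  open ≤-Reasoning

  2+L≤3L : (2 + L) ≤ 3 * L
  2+L≤3L = ≤-from (L + 18) 20≤L (identity L)
    where
    identity : ∀ L → 3 * L + 20 ≡ 2 + L + L + (L + 18)
    identity = solve-∀

  512[2+L]≤κ : 512 * (2 + L) ≤ κ
  512[2+L]≤κ = *-cancelʳ-≤ _ _ 16 (+-cancelˡ-≤ 16 _ _ (begin
    16 + 512 * (2 + L) * 16 ≤⟨ ≤-from 147440 (*-monoʳ-≤ 8192 20≤L) (identity L) ⟩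
    -- The threshold 20 for `L` is good for 16384 * 20 ≤ 2 ^ 20.
    16384 * L ≤⟨ exp-dominates 16384 20 (m≤m+n (16384 * 20) (2 ^ 20 ∸ 16384 * 20)) (s≤s z≤n) L 20≤L ⟩
    2 ^ L ≤⟨ 2^L≤k ⟩
    k ≤⟨ <⇒≤ k<16κ+16 ⟩
    16 + κ * 16 ∎))
    where
    identity : ∀ L → 16384 * L + 8192 * 20 ≡ 16 + 512 * (2 + L) * 16 + 8192 * L + 147440
    identity = solve-∀

  15≤κ : 15 ≤ κ
  15≤κ = ≤-trans (≤-trans (m≤m+n 15 497) (*-monoʳ-≤ 512 {1} {2 + L} (s≤s z≤n))) 512[2+L]≤κ

  1≤κ : 1 ≤ κ
  1≤κ = ≤-trans (s≤s z≤n) 15≤κ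

  k≤32κ : k ≤ 32 * κ
  k≤32κ = ≤-trans (<⇒≤ k<16κ+16) (≤-from 0 (*-monoʳ-≤ 16 1≤κ) (identity κ))
    where
    identity : ∀ κ → 32 * κ + 16 * 1 ≡ 16 + κ * 16 + 16 * κ + 0
    identity = solve-∀

  -- The largest order to which the counting is applied; `2 + L` is `suc j` for `j = suc L`.
  -- Maximality is what turns `n < g` into a bound of order k³ / log k for g².
  choice : ∃ λ n → n * n * (2 + L) ≤ κ * κ * κ × ¬ (suc n * suc n * (2 + L) ≤ κ * κ * κ)
  choice = last-true (λ n → n * n * (2 + L) ≤? κ * κ * κ) z≤n (suc (κ * κ * κ)) λ le →
    <⇒≱ (n<1+n (κ * κ * κ)) (≤-trans (≤-trans (m≤m*n _ (suc (κ * κ * κ))) (m≤m*n _ (2 + L))) le)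

  n : ℕ
  n = proj₁ choice
  n-ok : n * n * (2 + L) ≤ κ * κ * κ
  n-ok = proj₁ (proj₂ choice)
  n-max : ¬ (suc n * suc n * (2 + L) ≤ κ * κ * κ)
  n-max = proj₂ (proj₂ choice)

  16κ≤n : 16 * κ ≤ n
  16κ≤n = ≮⇒≥ λ n<16κ → n-max (begin
    suc n * suc n * (2 + L) ≤⟨ *-monoˡ-≤ (2 + L) (*-mono-≤ n<16κ n<16κ) ⟩
    16 * κ * (16 * κ) * (2 + L) ≡⟨ regroup κ (2 + L) ⟩
    κ * κ * (256 * (2 + L)) ≤⟨ *-monoʳ-≤ (κ * κ) (≤-trans (*-monoˡ-≤ (2 + L) (m≤m+n 256 256)) 512[2+L]≤κ) ⟩
    κ * κ * κ ∎)
    where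
    regroup : ∀ κ Λ → 16 * κ * (16 * κ) * Λ ≡ κ * κ * (256 * Λ)
    regroup = solve-∀

  8κ²≤tri : 8 * κ * κ ≤ tri n
  8κ²≤tri = ≤-trans (*-cancelˡ-≤ 2 (≤-from (224 * (κ * κ)) (*-monoʳ-≤ (16 * κ) 1≤κ) identity)) (tri-mono 16κ≤n)
    where
    regroup : ∀ κ t → 2 * t + 16 * κ * 1 ≡ 2 * t + 16 * κ
    regroup = solve-∀
    expand : ∀ κ → 16 * κ * (16 * κ) ≡ 2 * (8 * κ * κ) + 16 * κ * κ + 224 * (κ * κ)
    expand = solve-∀
    identity : 2 * tri (16 * κ) + 16 * κ * 1 ≡ 2 * (8 * κ * κ) + 16 * κ * κ + 224 * (κ * κ)
    identity = trans (regroup κ (tri (16 * κ))) (trans (tri-double (16 * κ)) (expand κ))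

  n≤κ² : n ≤ κ * κ
  n≤κ² = ≮⇒≥ λ κ²<n → <⇒≱ (begin-strict
    κ * κ * κ ≤⟨ *-monoʳ-≤ (κ * κ) (m≤m*n κ κ {{>-nonZero 1≤κ}}) ⟩
    κ * κ * (κ * κ) <⟨ *-mono-< κ²<n κ²<n ⟩
    n * n ≤⟨ m≤m*n (n * n) (2 + L) ⟩
    n * n * (2 + L) ∎) n-ok

  n≤ : n ≤ 2 ^ suc L * (2 * κ)
  n≤ = ≤-trans n≤κ² (*-mono-≤ κ≤2^ (m≤n*m κ 2))
    where
    κ≤2^ : κ ≤ 2 ^ suc L
    κ≤2^ = ≤-trans (m≤m*n κ 16) (≤-trans 16κ≤k (<⇒≤ (k<2^1+L)))

  n-small : (n * n + 512 * (κ * κ)) * (2 + L) < 12 * (κ * κ * κ)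
  n-small = begin-strict
    (n * n + 512 * (κ * κ)) * (2 + L) ≡⟨ regroup n κ (2 + L) ⟩
    n * n * (2 + L) + κ * κ * (512 * (2 + L)) ≤⟨ +-mono-≤ n-ok (*-monoʳ-≤ (κ * κ) 512[2+L]≤κ) ⟩
    κ * κ * κ + κ * κ * κ <⟨ ≤-from (9 * (κ * κ * κ)) 1≤κ³ (identity (κ * κ * κ)) ⟩
    12 * (κ * κ * κ) ∎
    where
    regroup : ∀ n κ Λ → (n * n + 512 * (κ * κ)) * Λ ≡ n * n * Λ + κ * κ * (512 * Λ)
    regroup = solve-∀
    1≤κ³ : 1 ≤ κ * κ * κ
    1≤κ³ = *-mono-≤ (*-mono-≤ 1≤κ 1≤κ) 1≤κ
    identity : ∀ t → 12 * t + 1 ≡ suc (t + t) + t + 9 * t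
    identity = solve-∀

  contradictory : ∀ d → 8 * κ + suc d ≡ k → ¬ g ≤ n
  contradictory d eq g≤n =
    unrealizable (subst (λ t → GallaiProperty t g) (symm eq) prop n g≤n e (trans (∑-tabulate e) ∑-e))
    where
    regroup : ∀ κ → 16 + κ * 16 ≡ 8 * κ + (8 * κ + 15) + 1
    regroup = solve-∀
    upper : suc d ≤ 16 * κ
    upper = +-cancelˡ-≤ (8 * κ) _ _ (begin
      8 * κ + suc d ≡⟨ eq ⟩
      k ≤⟨ ≤-pred (≤-trans k<16κ+16 (≤-reflexive (trans (regroup κ) (+-comm _ 1)))) ⟩
      8 * κ + (8 * κ + 15) ≤⟨ +-monoʳ-≤ (8 * κ) (+-monoʳ-≤ (8 * κ) 15≤8κ) ⟩
      8 * κ + (8 * κ + 8 * κ) ≡⟨ cong (8 * κ +_) (*-distribʳ-+ κ 8 8) ⟨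
      8 * κ + 16 * κ ∎)
      where
      15≤8κ : 15 ≤ 8 * κ
      15≤8κ = ≤-trans 15≤κ (m≤n*m κ 8)
    lower : 8 * κ ≤ suc d
    lower = +-cancelˡ-≤ (8 * κ) _ _ (begin
      8 * κ + 8 * κ ≡⟨ trans (symm (*-distribʳ-+ κ 8 8)) (*-comm 16 κ) ⟩
      κ * 16 ≤⟨ 16κ≤k ⟩
      k ≡⟨ eq ⟨
      8 * κ + suc d ∎)
    open HardSequence κ d n (suc L) 1≤κ upper lower 8κ²≤tri n≤ n-small

  n<g : suc n ≤ g
  n<g = ≰⇒> (contradictory (proj₁ complement) (trans (+-suc (8 * κ) _) (proj₂ complement)))
    where
    expand : ∀ κ → κ * 16 ≡ 8 * κ + κ + 7 * κ
    expand = solve-∀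
    8κ<k : 8 * κ < k
    8κ<k = begin-strict
      8 * κ <⟨ m<m+n (8 * κ) 1≤κ ⟩
      8 * κ + κ ≤⟨ m≤m+n _ (7 * κ) ⟩
      8 * κ + κ + 7 * κ ≡⟨ expand κ ⟨
      κ * 16 ≤⟨ 16κ≤k ⟩
      k ∎
    complement : ∃ λ d → suc (8 * κ) + d ≡ k
    complement = m≤n⇒∃[o]m+o≡n 8κ<k

  conclusion : k * k * k ≤ 32 * 32 * 32 * 3 * (g * g * L)
  conclusion = begin
    k * k * k ≤⟨ *-mono-≤ (*-mono-≤ k≤32κ k≤32κ) k≤32κ ⟩
    32 * κ * (32 * κ) * (32 * κ) ≡⟨ cube-scale 32 κ ⟩
    32 * 32 * 32 * (κ * κ * κ) ≤⟨ *-monoʳ-≤ (32 * 32 * 32) (<⇒≤ (≰⇒> n-max)) ⟩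
    32 * 32 * 32 * (suc n * suc n * (2 + L)) ≤⟨ *-monoʳ-≤ (32 * 32 * 32) (*-mono-≤ (*-mono-≤ n<g n<g) 2+L≤3L) ⟩
    32 * 32 * 32 * (g * g * (3 * L)) ≡⟨ collect (32 * 32 * 32) 3 (g * g) L ⟩
    32 * 32 * 32 * 3 * (g * g * L) ∎
    where
    cube-scale : ∀ c κ → c * κ * (c * κ) * (c * κ) ≡ c * c * c * (κ * κ * κ)
    cube-scale = solve-∀
    collect : ∀ a b x L → a * (x * (b * L)) ≡ a * b * (x * L)
    collect = solve-∀

lower-bound : ∀ k → 1 ≤ k → 20 ≤ ⌊log₂ k ⌋ → ∀ g → GallaiProperty k g → k ^ 3 ≤ 32 * 32 * 32 * 3 * (g ^ 2 * ⌊log₂ k ⌋)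
lower-bound k 1≤k 20≤L g prop =
  subst₂ (λ s t → s ≤ 32 * 32 * 32 * 3 * (t * ⌊log₂ k ⌋)) (cube k) (cong (g *_) (symm (*-identityʳ g)))
    (LowerBound.conclusion k (k / 16) ⌊log₂ k ⌋ g 20≤L
      (2^⌊log₂n⌋≤n k 1≤k) (n<2^1+⌊log₂n⌋ k)
      (≤-trans (≤-reflexive (cong suc k≡)) (+-monoˡ-≤ (k / 16 * 16) (m%n<n k 16)))
      (≤-trans (m≤n+m _ (k % 16)) (≡⇒≥ k≡)) prop)
  where
  k≡ : k ≡ k % 16 + k / 16 * 16
  k≡ = m≡m%n+[m/n]*n k 16

-- Upper bound: plans and covers

Demand : ℕ → Set
Demand k = Fin k → ℕ

module _ {k : ℕ} where

  open import Data.List.Membership.DecPropositional _≟_ using () renaming (_∈?_ to _∈ℕ?_)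

  sub : Demand k → Fin k → ℕ → Demand k
  sub e p x i = e i ∸ δ p x i

  sub-≡ : ∀ e p x → sub e p x p ≡ e p ∸ x
  sub-≡ e p x = cong (e p ∸_) (δ-≡ p x)

  sub-≢ : ∀ e {p} x {i} → p ≢ i → sub e p x i ≡ e i
  sub-≢ e x {i} p≢i = cong (e i ∸_) (δ-≢ x p≢i)

  sub-+ : ∀ (e : Demand k) p x → x ≤ e p → ∀ i → sub e p x i + δ p x i ≡ e i
  sub-+ e p x x≤ i with p Fin.≟ i
  ... | yes refl = m∸n+n≡m x≤
  ... | no _     = +-identityʳ _

  ∑-sub : ∀ (e : Demand k) p x → x ≤ e p → ∑ (sub e p x) + x ≡ ∑ e
  ∑-sub e p x x≤ = trans (cong (∑ (sub e p x) +_) (symm (∑-δ p x)))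
    (trans (symm (∑-+ (sub e p x) (δ p x))) (∑-cong (sub-+ e p x x≤)))

  peel : ∀ {m} {e : Demand k} p → m ≤ e p → Realizable m (sub e p m) → Realizable (suc m) e
  peel {m} {e} p m≤ r = realizable-cong (sub-+ e p m m≤) (realizable-peel p r)

  -- A plan assigns colours to some of the levels of a caterpillar; level l is the vertex with l edges to its successors.
  Plan : Set
  Plan = ℕ → Maybe (Fin k)

  hit : Maybe (Fin k) → ℕ → Demand k
  hit (just p) x i = δ p x i
  hit nothing  x i = 0

  used : Plan → ℕ → Demand k
  used f zero    i = 0
  used f (suc m) i = hit (f m) m i + used f m i

  set : Plan → ℕ → Fin k → Plan
  set f x p l = if does (l ≟ x) then just p else f l

  set-≡ : ∀ f x p → set f x p x ≡ just p
  set-≡ f x p rewrite dec-true (x ≟ x) refl = refl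

  set-≢ : ∀ f {x} p {l} → l ≢ x → set f x p l ≡ f l
  set-≢ f {x} p {l} l≢x rewrite dec-false (l ≟ x) l≢x = refl

  used-set-≥ : ∀ f x p m i → m ≤ x → used (set f x p) m i ≡ used f m i
  used-set-≥ f x p zero    i m≤x = refl
  used-set-≥ f x p (suc m) i m<x = cong₂ _+_ (cong (λ t → hit t m i) (set-≢ f p (<⇒≢ m<x)))
                                              (used-set-≥ f x p m i (<⇒≤ m<x))

  used-set : ∀ f x p m i → f x ≡ nothing → x < m → used (set f x p) m i ≡ used f m i + δ p x i
  used-set f x p (suc m) i free (s≤s x≤m) with m ≟ x
  ... | yes refl = trans
    (cong₂ _+_ (cong (λ t → hit t m i) (set-≡ f m p)) (used-set-≥ f m p m i ≤-refl))
    (trans (+-comm (δ p m i) (used f m i)) (cong (λ t → hit t m i + used f m i + δ p m i) (symm free)))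
  ... | no m≢x = trans
    (cong₂ _+_ (cong (λ t → hit t m i) (set-≢ f p m≢x)) (used-set f x p m i free (≤∧≢⇒< x≤m (m≢x ∘ symm))))
    (symm (+-assoc (hit (f m) m i) _ _))

  used-nothing : ∀ f m i → (∀ l → l < m → f l ≡ nothing) → used f m i ≡ 0
  used-nothing f zero    i free = refl
  used-nothing f (suc m) i free rewrite free m ≤-refl = used-nothing f m i (λ l l<m → free l (m≤n⇒m≤1+n l<m))

  -- The number of edges at unassigned levels, which a filler colour has to supply.
  gap : Plan → ℕ → ℕ
  gap f zero = 0
  gap f (suc m) with f m
  ... | just _  = gap f m
  ... | nothing = m + gap f m

  gap≤tri : ∀ f m → gap f m ≤ tri m
  gap≤tri f zero = z≤n
  gap≤tri f (suc m) with f m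
  ... | just _  = ≤-trans (gap≤tri f m) (m≤n+m _ m)
  ... | nothing = +-monoʳ-≤ m (gap≤tri f m)

  δ-+ : ∀ (p : Fin k) x y i → δ p (x + y) i ≡ δ p x i + δ p y i
  δ-+ p x y i with does (p Fin.≟ i)
  ... | true  = refl
  ... | false = refl

  δ≤ : ∀ (p : Fin k) x i → δ p x i ≤ x
  δ≤ p x i with does (p Fin.≟ i)
  ... | true  = ≤-refl
  ... | false = z≤n

  realizable-plan : ∀ f p b → Realizable b (λ i → used f b i + δ p (gap f b) i)
  realizable-plan f p zero = realizable-cong (λ i → symm (n≤0⇒n≡0 (δ≤ p 0 i))) realizable-0
  realizable-plan f p (suc b) with f b
  ... | just q = realizable-cong (λ i → rearrange (used f b i) (δ p (gap f b) i) (δ q b i))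
                   (realizable-peel q (realizable-plan f p b))
    where
    rearrange : ∀ x y z → x + y + z ≡ z + x + y
    rearrange = solve-∀
  ... | nothing = realizable-cong
                    (λ i → trans (rearrange (used f b i) (δ p (gap f b) i) (δ p b i))
                      (cong (used f b i +_) (symm (δ-+ p b (gap f b) i))))
                    (realizable-peel p (realizable-plan f p b))
    where
    rearrange : ∀ x y z → x + y + z ≡ x + (z + y)
    rearrange = solve-∀

  -- The block is a caterpillar on `b` vertices that follows `f`, joined to the other `m` vertices
  -- in colour `p`. This colour also fills the gaps, hence its cost `b * m + gap f b`.
  block : ∀ {m} {e : Demand k} e′ f p b → (∀ i → e i ≡ e′ i + used f b i + δ p (b * m + gap f b) i) →
    Realizable m e′ → Realizable (b + m) e
  block {m} e′ f p b eq r = realizable-cong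
    (λ i → symm (trans (eq i) (trans (cong (e′ i + used f b i +_) (δ-+ p (b * m) (gap f b) i))
      (rearrange (e′ i) (used f b i) (δ p (b * m) i) (δ p (gap f b) i)))))
    (realizable-join p (realizable-plan f p b) r)
    where
    rearrange : ∀ e u x y → e + u + (x + y) ≡ u + y + e + x
    rearrange = solve-∀

  -- Each used level excludes at most one `s`: the levels α + s are distinct, so are their
  -- complements in `r`, and a level is never a complement since two levels below 2α add up to less
  -- than 4α ≤ r. With fewer than α used levels the pigeonhole principle leaves an `s`.
  free-slot : ∀ α (U : List ℕ) r → length U < α → 4 * α ≤ r →
    ∃ λ s → s < α × α + s ∉ U × r ∸ (α + s) ∉ U
  free-slot α U r |U|<α 4α≤r
    with Fin.any? (λ (s : Fin α) → ¬? (α + toℕ s ∈ℕ? U) ×-dec ¬? (r ∸ (α + toℕ s) ∈ℕ? U))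
  ... | yes (s , x∉ , y∉) = toℕ s , Fin.toℕ<n s , x∉ , y∉
  ... | no none = ⊥-elim clash
    where
    taken : ∀ (s : Fin α) → ∃ λ x → x ∈ U × (x ≡ α + toℕ s ⊎ x ≡ r ∸ (α + toℕ s))
    taken s with α + toℕ s ∈ℕ? U | r ∸ (α + toℕ s) ∈ℕ? U
    ... | yes x∈ | _      = _ , x∈ , inj₁ refl
    ... | no _   | yes y∈ = _ , y∈ , inj₂ refl
    ... | no x∉  | no y∉  = ⊥-elim (none (s , x∉ , y∉))
    position : Fin α → Fin (length U)
    position s = Any.index (proj₁ (proj₂ (taken s)))
    α+s<2α : ∀ (s : Fin α) → α + toℕ s < α + α
    α+s<2α s = +-monoʳ-< α (Fin.toℕ<n s)
    sum<r : ∀ (s t : Fin α) → α + toℕ s + (α + toℕ t) < r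
    sum<r s t = ≤-trans (+-mono-<-≤ (α+s<2α s) (<⇒≤ (α+s<2α t))) (≤-trans (≤-reflexive (rearrange α)) 4α≤r)
      where
      rearrange : ∀ α → α + α + (α + α) ≡ 4 * α
      rearrange = solve-∀
    ≤r : ∀ (s : Fin α) → α + toℕ s ≤ r
    ≤r s = ≤-trans (m≤m+n _ _) (<⇒≤ (sum<r s s))
    mixed : ∀ (s t : Fin α) → α + toℕ s ≢ r ∸ (α + toℕ t)
    mixed s t eq = <-irrefl (trans (cong (_+ (α + toℕ t)) eq) (m∸n+n≡m (≤r t))) (sum<r s t)
    clash : ⊥
    clash with Fin.pigeonhole |U|<α position
    ... | s , t , s<t , eq with taken s | taken t
    ...   | x , x∈ , x≡ | y , y∈ , y≡ = conflict x≡ y≡ (trans (lookup-index x∈) (trans (cong (lookup U) eq) (symm (lookup-index y∈))))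
      where
      conflict : ∀ {x y} → x ≡ α + toℕ s ⊎ x ≡ r ∸ (α + toℕ s) → y ≡ α + toℕ t ⊎ y ≡ r ∸ (α + toℕ t) → x ≡ y → ⊥
      conflict (inj₁ refl) (inj₁ refl) e = <⇒≢ s<t (+-cancelˡ-≡ α _ _ e)
      conflict (inj₁ refl) (inj₂ refl) e = mixed s t e
      conflict (inj₂ refl) (inj₁ refl) e = mixed t s (symm e)
      conflict (inj₂ refl) (inj₂ refl) e = <⇒≢ s<t (+-cancelˡ-≡ α _ _ (∸-cancelˡ-≡ (≤r s) (≤r t) e))

  -- A demand of at least 4α can still be split among levels from [α, 5α) as long as few of them are
  -- used; smaller positive remainders must never arise.
  Good : ℕ → Demand k → Set
  Good α z = ∀ i → z i ≡ 0 ⊎ 4 * α ≤ z i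

  -- The state after `t` rounds, each using at most two levels and removing at least α edges unless
  -- nothing is left. `f-low` is there for windows, which stop at level α.
  record Cover (α t : ℕ) (z : Demand k) : Set where
    field
      f       : Plan
      z′      : Demand k
      U       : List ℕ
      U-short : length U ≤ 2 * t
      U-used  : ∀ l → l ∉ U → f l ≡ nothing
      f-low   : ∀ l → l < α → f l ≡ nothing
      covers  : ∀ i → z i ≡ z′ i + used f (5 * α) i
      good    : Good α z′
      gain    : ∑ z′ + t * α ≤ ∑ z ⊎ (∀ i → z′ i ≡ 0)

  -- A demand of at least 6α is lowered by one unused level from [α, 2α); a demand in [4α, 6α) is met
  -- exactly by a level from [α, 2α) and the complementary level, which lies in (2α, 5α).
  cover : ∀ α t z → 2 * t ≤ α → Good α z → Cover α t z
  cover α zero z _ good = record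
    { f = λ _ → nothing ; z′ = z ; U = [] ; U-short = z≤n ; U-used = λ _ _ → refl ; f-low = λ _ _ → refl
    ; covers = λ i → symm (trans (cong (z i +_) (used-nothing (λ _ → nothing) (5 * α) i (λ _ _ → refl))) (+-identityʳ _))
    ; good = good ; gain = inj₁ (≤-reflexive (+-identityʳ _)) }
  cover α (suc t) z 2t≤α good with cover α t z (≤-trans (*-monoʳ-≤ 2 (n≤1+n t)) 2t≤α) good
  ... | K with Fin.any? (λ i → ¬? (Cover.z′ K i ≟ 0))
  ...   | no none = record
          { f = f ; z′ = z′ ; U = U ; U-short = ≤-trans U-short (*-monoʳ-≤ 2 (n≤1+n t))
          ; U-used = U-used ; f-low = f-low ; covers = covers ; good = Cover.good K
          ; gain = inj₂ (λ i → decidable-stable (z′ i ≟ 0) (λ ne → none (i , ne))) }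
    where open Cover K hiding (good)
  ...   | yes (i₀ , r≢0) = result
    where
    open Cover K hiding (good)
    double-suc : ∀ t → 2 * suc t ≡ suc (suc (2 * t))
    double-suc = solve-∀
    r = z′ i₀
    4α≤r : 4 * α ≤ r
    4α≤r with Cover.good K i₀
    ... | inj₁ r≡0 = ⊥-elim (r≢0 r≡0)
    ... | inj₂ le  = le
    slot = free-slot α U r
      (≤-trans (s≤s U-short) (≤-trans (≤-trans (n≤1+n _) (≡⇒≥ (double-suc t))) 2t≤α)) 4α≤r
    s x y : ℕ
    s = proj₁ slot
    x = α + s
    y = r ∸ x
    s<α : s < α
    s<α = proj₁ (proj₂ slot)
    x<2α : x < 2 * α
    x<2α = ≤-trans (+-monoʳ-< α s<α) (≤-reflexive (cong (α +_) (symm (+-identityʳ α))))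
    x≤r : x ≤ r
    x≤r = ≤-trans (<⇒≤ x<2α) (≤-trans (*-monoˡ-≤ α {2} {4} (s≤s (s≤s z≤n))) 4α≤r)
    x-free : f x ≡ nothing
    x-free = U-used x (proj₁ (proj₂ (proj₂ slot)))
    y-free : f y ≡ nothing
    y-free = U-used y (proj₂ (proj₂ (proj₂ slot)))
    x<5α : x < 5 * α
    x<5α = ≤-trans x<2α (*-monoˡ-≤ α {2} {5} (s≤s (s≤s z≤n)))
    U-short′ : ∀ {V : List ℕ} → length V ≤ 2 + length U → length V ≤ 2 * suc t
    U-short′ le = ≤-trans le (≤-trans (s≤s (s≤s U-short)) (≡⇒≥ (double-suc t)))
    gain′ : ∀ (z″ : Demand k) w → α ≤ w → ∑ z″ + w ≡ ∑ z′ → ∑ z″ + suc t * α ≤ ∑ z ⊎ (∀ i → z″ i ≡ 0)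
    gain′ z″ w α≤w eq with gain
    ... | inj₂ all0 = ⊥-elim (r≢0 (all0 i₀))
    ... | inj₁ le = inj₁ (≤-trans (≡⇒≥ (+-assoc (∑ z″) α (t * α)))
            (≤-trans (+-monoˡ-≤ (t * α) (≤-trans (+-monoʳ-≤ (∑ z″) α≤w) (≤-reflexive eq))) le))
    α≤x : α ≤ x
    α≤x = m≤m+n α s
    result : Cover α (suc t) z
    result with 6 * α ≤? r
    ... | yes 6α≤r = record
      { f = set f x i₀ ; z′ = sub z′ i₀ x ; U = x ∷ U
      ; U-short = U-short′ {x ∷ U} (n≤1+n _)
      ; U-used = λ l l∉ → trans (set-≢ f i₀ (λ { refl → l∉ (here refl) })) (U-used l (l∉ ∘ there))
      ; f-low = λ l l<α → trans (set-≢ f i₀ (<⇒≢ (≤-trans l<α α≤x))) (f-low l l<α)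
      ; covers = λ i → trans (covers i) (trans (cong (_+ used f (5 * α) i) (symm (sub-+ z′ i₀ x x≤r i)))
          (trans (rearrange (sub z′ i₀ x i) (δ i₀ x i) _)
            (cong (sub z′ i₀ x i +_) (symm (used-set f x i₀ (5 * α) i x-free x<5α)))))
      ; good = good′
      ; gain = gain′ (sub z′ i₀ x) x α≤x (∑-sub z′ i₀ x x≤r) }
      where
      rearrange : ∀ a b c → a + b + c ≡ a + (c + b)
      rearrange = solve-∀
      good′ : Good α (sub z′ i₀ x)
      good′ i with i₀ Fin.≟ i
      ... | no _ = Cover.good K i
      ... | yes refl = inj₂ (m+n≤o⇒m≤o∸n (4 * α) (≤-trans (+-monoʳ-≤ (4 * α) (<⇒≤ x<2α))
              (≤-trans (≡⇒≥ (*-distribʳ-+ α 4 2)) 6α≤r)))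
    ... | no 6α≰r = record
      { f = set (set f x i₀) y i₀ ; z′ = sub z′ i₀ r ; U = y ∷ x ∷ U
      ; U-short = U-short′ {y ∷ x ∷ U} ≤-refl
      ; U-used = λ l l∉ → trans (set-≢ (set f x i₀) i₀ (λ { refl → l∉ (here refl) }))
          (trans (set-≢ f i₀ (λ { refl → l∉ (there (here refl)) })) (U-used l (l∉ ∘ there ∘ there)))
      ; f-low = λ l l<α → trans (set-≢ (set f x i₀) i₀ (<⇒≢ (≤-trans l<α (≤-trans α≤x (<⇒≤ x<y)))))
          (trans (set-≢ f i₀ (<⇒≢ (≤-trans l<α α≤x))) (f-low l l<α))
      ; covers = covers′
      ; good = good′
      ; gain = gain′ (sub z′ i₀ r) r (≤-trans α≤x x≤r) (∑-sub z′ i₀ r ≤-refl) }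
      where
      x<y : x < y
      x<y = m+n≤o⇒m≤o∸n (suc x) (≤-trans (+-mono-<-≤ x<2α (<⇒≤ x<2α))
        (≤-trans (≡⇒≥ (*-distribʳ-+ α 2 2)) 4α≤r))
      y<5α : y < 5 * α
      y<5α = +-cancelʳ-< x y (5 * α) (≤-trans (s≤s (≤-reflexive (m∸n+n≡m x≤r)))
        (≤-trans (≰⇒> 6α≰r) (≤-trans (≤-reflexive (trans (cong (_* α) (+-comm 1 5)) (trans (*-distribʳ-+ α 5 1) (cong (5 * α +_) (+-identityʳ α))))) (+-monoʳ-≤ (5 * α) α≤x))))
      good′ : Good α (sub z′ i₀ r)
      good′ i with i₀ Fin.≟ i
      ... | no _ = Cover.good K i
      ... | yes refl = inj₁ (n∸n≡0 r)
      rearrange : ∀ a b c d → a + (b + c) + d ≡ a + (d + b + c)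
      rearrange = solve-∀
      covers′ : ∀ i → z i ≡ sub z′ i₀ r i + used (set (set f x i₀) y i₀) (5 * α) i
      covers′ i = begin-equality
        z i
          ≡⟨ covers i ⟩
        z′ i + u
          ≡⟨ cong (_+ u) (sub-+ z′ i₀ r ≤-refl i) ⟨
        sub z′ i₀ r i + δ i₀ r i + u
          ≡⟨ cong (λ t → sub z′ i₀ r i + δ i₀ t i + u) (m+[n∸m]≡n x≤r) ⟨
        sub z′ i₀ r i + δ i₀ (x + y) i + u
          ≡⟨ cong (λ t → sub z′ i₀ r i + t + u) (δ-+ i₀ x y i) ⟩
        sub z′ i₀ r i + (δ i₀ x i + δ i₀ y i) + u
          ≡⟨ rearrange (sub z′ i₀ r i) (δ i₀ x i) (δ i₀ y i) u ⟩
        sub z′ i₀ r i + (u + δ i₀ x i + δ i₀ y i)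
          ≡⟨ cong (λ t → sub z′ i₀ r i + (t + δ i₀ y i)) (used-set f x i₀ (5 * α) i x-free x<5α) ⟨
        sub z′ i₀ r i + (used (set f x i₀) (5 * α) i + δ i₀ y i)
          ≡⟨ cong (sub z′ i₀ r i +_) (used-set (set f x i₀) y i₀ (5 * α) i
               (trans (set-≢ f i₀ (<⇒≢ x<y ∘ symm)) y-free) y<5α) ⟨
        sub z′ i₀ r i + used (set (set f x i₀) y i₀) (5 * α) i ∎
        where
        open ≤-Reasoning
        u = used f (5 * α) i

  -- Greedy choice from the top: level `b` is used whenever it fits, and if it does not, then x < b,
  -- which still gives x ≤ tri b.
  subset-sum : ∀ b x (q : Fin k) → x ≤ tri b → ∃ λ f → ∀ i → used f b i ≡ δ q x i
  subset-sum zero x q x≤ = (λ _ → nothing) , λ i → symm (n≤0⇒n≡0 (≤-trans (δ≤ q x i) x≤))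
  subset-sum (suc b) x q x≤ with b ≤? x
  ... | yes b≤x with subset-sum b (x ∸ b) q (≤-trans (∸-monoˡ-≤ b x≤) (≤-reflexive (m+n∸m≡n b (tri b))))
  ...   | f , eq = set f b q , λ i → trans (cong₂ _+_ (cong (λ t → hit t b i) (set-≡ f b q)) (used-set-≥ f b q b i ≤-refl))
          (trans (cong (δ q b i +_) (eq i)) (trans (symm (δ-+ q b (x ∸ b) i)) (cong (λ t → δ q t i) (m+[n∸m]≡n b≤x))))
  subset-sum (suc b) x q x≤ | no b≰x with subset-sum b x q (small b (≰⇒> b≰x))
    where
    small : ∀ b → x < b → x ≤ tri b
    small (suc b) (s≤s x≤b) = ≤-trans x≤b (m≤m+n b (tri b))
  ...   | f , eq = f′ , λ i → trans (cong₂ _+_ (cong (λ t → hit t b i) f′-≡) (used-f′ b i ≤-refl)) (eq i)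
    where
    -- The recursive plan is controlled only below `b`, so its value at `b` has to be cleared.
    f′ : Plan
    f′ l = if does (l ≟ b) then nothing else f l
    f′-≡ : f′ b ≡ nothing
    f′-≡ rewrite dec-true (b ≟ b) refl = refl
    used-f′ : ∀ m i → m ≤ b → used f′ m i ≡ used f m i
    used-f′ zero i m≤ = refl
    used-f′ (suc m) i m<b rewrite dec-false (m ≟ b) (<⇒≢ m<b) = cong (hit (f m) m i +_) (used-f′ m i (<⇒≤ m<b))

-- Upper bound: descending with frequent colours as fillers

tri-+ : ∀ b m → tri (b + m) ≡ tri b + b * m + tri m
tri-+ zero    m = refl
tri-+ (suc b) m = trans (cong (b + m +_) (tri-+ b m)) (rearrange b m (tri b) (tri m))
  where
  rearrange : ∀ b m s t → b + m + (s + b * m + t) ≡ b + s + (m + b * m) + t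
  rearrange = solve-∀

∑-used-gap : ∀ {k} (f : Plan {k}) b → ∑ (used f b) + gap f b ≡ tri b
∑-used-gap {k} f zero = trans (+-identityʳ _) (∑-zero {k} (λ _ → refl))
∑-used-gap {k} f (suc b) with f b
... | just p = trans (cong (_+ gap f b) (trans (∑-+ (δ p b) (used f b)) (cong (_+ ∑ (used f b)) (∑-δ p b))))
                 (trans (+-assoc b _ _) (cong (b +_) (∑-used-gap f b)))
... | nothing = trans (rearrange (∑ (used f b)) b (gap f b)) (cong (b +_) (∑-used-gap f b))
  where
  rearrange : ∀ x b y → x + (b + y) ≡ b + (x + y)
  rearrange = solve-∀

-- Colours with at least 2T edges serve as fillers and lose at most T edges at a time, so a colour never
-- drops below T by filling.  At any time at most one colour, a, is partially used: it may have between 2T and G edges.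
module Filler {k : ℕ} (T Q : ℕ) where

  G : ℕ
  G = Q * (2 * T)

  Near : Fin k → Demand k → Set
  Near a w = ∀ i → i ≢ a → w i < 2 * T ⊎ G ≤ w i

  -- A colour found below `T` afterwards still has its initial number of edges; this is how later
  -- stages know that rare colours are untouched.
  Desc : Demand k → Demand k → Set
  Desc x y = ∀ i → y i ≡ x i ⊎ (T ≤ y i × y i ≤ x i)

  desc-refl : ∀ {x} → Desc x x
  desc-refl i = inj₁ refl

  desc-≤ : ∀ {x y} → Desc x y → ∀ i → y i ≤ x i
  desc-≤ d i with d i
  ... | inj₁ eq       = ≤-reflexive eq
  ... | inj₂ (_ , le) = le

  desc-trans : ∀ {x y z} → Desc x y → Desc y z → Desc x z
  desc-trans {x} {y} {z} d d′ i with d′ i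
  ... | inj₁ eq = subst (λ t → t ≡ x i ⊎ (T ≤ t × t ≤ x i)) (symm eq) (d i)
  ... | inj₂ (lo , hi) = inj₂ (lo , ≤-trans hi (desc-≤ d i))

  desc-sub : ∀ w p x → 2 * T ≤ w p → x ≤ T → Desc w (sub w p x)
  desc-sub w p x big x≤T i with p Fin.≟ i
  ... | no _ = inj₁ refl
  ... | yes refl = inj₂ (m+n≤o⇒m≤o∸n T (≤-trans (+-monoʳ-≤ T (≤-trans x≤T (≡⇒≥ (+-identityʳ T)))) big)
                        , m∸n≤m (w p) x)

  -- The partially used colour `a` is preferred while it has 2T edges. Once below, it satisfies the
  -- first alternative of `Near`, and the new filler can take over the exceptional role.
  pick : ∀ {a w} → Near a w → (∃ λ i → 2 * T ≤ w i) →
    ∃ λ p → 2 * T ≤ w p × (∀ x → Near p (sub w p x))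
  pick {a} {w} near (j , big) with 2 * T ≤? w a
  ... | yes a-big = a , a-big , λ x i i≢a →
        subst (λ t → t < 2 * T ⊎ G ≤ t) (symm (sub-≢ w x (i≢a ∘ symm))) (near i i≢a)
  ... | no a-small = j , big , λ x i i≢j →
        subst (λ t → t < 2 * T ⊎ G ≤ t) (symm (sub-≢ w x (i≢j ∘ symm))) (other i)
    where
    other : ∀ i → w i < 2 * T ⊎ G ≤ w i
    other i with i Fin.≟ a
    ... | yes refl = inj₁ (≰⇒> a-small)
    ... | no i≢a = near i i≢a

  low : Demand k → Demand k
  low w i = if does (w i <? 2 * T) then w i else 0

  low-< : ∀ w i → w i < 2 * T → low w i ≡ w i
  low-< w i lt rewrite dec-true (w i <? 2 * T) lt = refl

  low≤ : ∀ w i → low w i ≤ w i × low w i ≤ 2 * T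
  low≤ w i with w i <? 2 * T
  ... | yes lt rewrite dec-true (w i <? 2 * T) lt = ≤-refl , <⇒≤ lt
  ... | no ≮ rewrite dec-false (w i <? 2 * T) ≮ = z≤n , z≤n

  module _ (a : Fin k) (c : ℕ) (ws : Demand k) (separated : ∀ i → i ≢ a → ws i < c ⊎ G ≤ ws i) where

    -- Colours other than `a` began either below `c`, or with at least `G`; in the latter case what
    -- is left below 2T is at most a fraction 1/Q of their initial number. The colour `a` adds at
    -- most 2T. Multiplication by `Q` replaces the division.
    low-bound : ∀ {w} → (∀ i → w i ≤ ws i) → Q * ∑ (low w) ≤ k * (Q * c) + ∑ ws + Q * (2 * T)
    low-bound {w} w≤ = begin
      Q * ∑ (low w)
        ≡⟨ ∑-*ˡ Q (low w) ⟨
      ∑ (λ i → Q * low w i)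
        ≤⟨ ∑-mono pointwise ⟩
      ∑ (λ i → Q * c + ws i + δ a (Q * (2 * T)) i)
        ≡⟨ ∑-+ (λ i → Q * c + ws i) (δ a (Q * (2 * T))) ⟩
      ∑ (λ i → Q * c + ws i) + ∑ (δ a (Q * (2 * T)))
        ≡⟨ cong₂ _+_ (trans (∑-+ (λ _ → Q * c) ws) (cong (_+ ∑ ws) (∑-const k (Q * c)))) (∑-δ a _) ⟩
      k * (Q * c) + ∑ ws + Q * (2 * T) ∎
      where
      open ≤-Reasoning
      pointwise : ∀ i → Q * low w i ≤ Q * c + ws i + δ a (Q * (2 * T)) i
      pointwise i with a Fin.≟ i
      ... | yes refl = ≤-trans (*-monoʳ-≤ Q (proj₂ (low≤ w i))) (m≤n+m _ _)
      ... | no a≢i = ≤-trans (other (separated i (a≢i ∘ symm))) (m≤m+n _ 0)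
        where
        other : ws i < c ⊎ G ≤ ws i → Q * low w i ≤ Q * c + ws i
        other (inj₁ lt) = ≤-trans (*-monoʳ-≤ Q (≤-trans (≤-trans (proj₁ (low≤ w i)) (w≤ i)) (<⇒≤ lt))) (m≤m+n _ _)
        other (inj₂ le) = ≤-trans (≤-trans (*-monoʳ-≤ Q (proj₂ (low≤ w i))) le) (m≤n+m _ _)

    module Descent (X m₀ : ℕ)
      (room : k * (Q * c) + ∑ ws + Q * (2 * T) + Q * X < Q * tri (suc m₀)) where

      -- If all colours were below 2T, then `low w` would be all of `w`, and by `low-bound` it could
      -- not make up the `tri (suc m)` edges together with the reserved demand `y`.
      filler : ∀ {w} y m → Desc ws w → m₀ ≤ m → y ≤ X → ∑ w + y ≡ tri (suc m) → ∃ λ i → 2 * T ≤ w i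
      filler {w} y m desc m₀≤m y≤X eq with Fin.any? (λ i → 2 * T ≤? w i)
      ... | yes found = found
      ... | no none = ⊥-elim (<⇒≱ room (begin
        Q * tri (suc m₀) ≤⟨ *-monoʳ-≤ Q (tri-mono (s≤s m₀≤m)) ⟩
        Q * tri (suc m) ≡⟨ cong (Q *_) eq ⟨
        Q * (∑ w + y) ≡⟨ *-distribˡ-+ Q (∑ w) y ⟩
        Q * ∑ w + Q * y ≡⟨ cong (λ t → Q * t + Q * y) (∑-cong (λ i → low-< w i (≰⇒> (λ le → none (i , le))))) ⟨
        Q * ∑ (low w) + Q * y ≤⟨ +-mono-≤ (low-bound (desc-≤ desc)) (*-monoʳ-≤ Q y≤X) ⟩
        k * (Q * c) + ∑ ws + Q * (2 * T) + Q * X ∎))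
        where open ≤-Reasoning

      -- `z` is a demand carried to the end without being touched; the plan `f` supplies the part
      -- that is met on the way. `K` must accept every `a′` and `w′` to which the choice of fillers
      -- may lead.
      descend : ∀ (f : Plan) (z : Demand k) d a (w : Demand k) → Near a w → Desc ws w → d + m₀ ≤ T →
        ∑ w + ∑ (λ i → z i + used f (d + m₀) i) ≡ tri (d + m₀) → ∑ (λ i → z i + used f (d + m₀) i) ≤ X →
        (∀ a′ (w′ : Demand k) → Near a′ w′ → Desc ws w′ → ∑ w′ + ∑ (λ i → z i + used f m₀ i) ≡ tri m₀ →
          Realizable m₀ (λ i → w′ i + (z i + used f m₀ i))) →
        Realizable (d + m₀) (λ i → w i + (z i + used f (d + m₀) i))
      descend f z zero a w near desc _ eq _ K = K a w near desc eq
      descend f z (suc d) a w near desc ≤T eq ≤X K with f (d + m₀)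
      ... | just q = realizable-cong (λ i → rearrange (w i) (z i) (used f (d + m₀) i) (δ q (d + m₀) i))
              (realizable-peel q (descend f z d a w near desc (≤-trans (n≤1+n _) ≤T) eq′ ≤X′ K))
        where
        rearrange : ∀ w z u x → w + (z + u) + x ≡ w + (z + (x + u))
        rearrange = solve-∀
        rearrange′ : ∀ z u x → z + (x + u) ≡ z + u + x
        rearrange′ = solve-∀
        split : ∑ (λ i → z i + (δ q (d + m₀) i + used f (d + m₀) i)) ≡ ∑ (λ i → z i + used f (d + m₀) i) + (d + m₀)
        split = trans (∑-cong (λ i → rearrange′ (z i) (used f (d + m₀) i) (δ q (d + m₀) i)))
          (trans (∑-+ (λ i → z i + used f (d + m₀) i) (δ q (d + m₀)))
            (cong (∑ (λ i → z i + used f (d + m₀) i) +_) (∑-δ q (d + m₀))))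
        eq′ : ∑ w + ∑ (λ i → z i + used f (d + m₀) i) ≡ tri (d + m₀)
        eq′ = +-cancelʳ-≡ (d + m₀) _ _ (trans (+-assoc (∑ w) _ _)
          (trans (cong (∑ w +_) (symm split)) (trans eq (+-comm (d + m₀) _))))
        ≤X′ : ∑ (λ i → z i + used f (d + m₀) i) ≤ X
        ≤X′ = ≤-trans (m≤m+n _ (d + m₀)) (≤-trans (≡⇒≥ split) ≤X)
      ... | nothing = realizable-cong
              (λ i → trans (+-swapʳ (sub w p m i) (z i + used f m i) (δ p m i)) (cong (_+ (z i + used f m i)) (sub-+ w p m m≤wp i)))
              (realizable-peel p (descend f z d p (sub w p m) (proj₂ (proj₂ chosen) m)
                (desc-trans desc (desc-sub w p m p-big m≤T)) m≤T eq′ ≤X K))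
        where
        m = d + m₀
        m≤T : m ≤ T
        m≤T = ≤-trans (n≤1+n _) ≤T
        chosen = pick near (filler _ m desc (m≤n+m m₀ d) ≤X eq)
        p = proj₁ chosen
        p-big = proj₁ (proj₂ chosen)
        m≤wp : m ≤ w p
        m≤wp = ≤-trans m≤T (≤-trans (m≤m+n T _) p-big)
        Y = ∑ (λ i → z i + used f m i)
        eq′ : ∑ (sub w p m) + Y ≡ tri m
        eq′ = +-cancelʳ-≡ m _ _ (trans (+-swapʳ (∑ (sub w p m)) Y m)
          (trans (cong (_+ Y) (∑-sub w p m m≤wp)) (trans eq (+-comm m _))))

      module Blocks (α α′ : ℕ) (1≤α : 1 ≤ α) (2α′≤α : 2 * α′ ≤ α) where

        -- Each block removes at least α′ α edges of `z` or exhausts it, so `t` blocks suffice. The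
        -- filler of a block pays its gaps and all edges to the vertices further in, which is at
        -- most `T`.
        blocks : ∀ t a (w z : Demand k) → Near a w → Desc ws w → Good α z → ∑ z ≤ t * (α′ * α) → ∑ z ≤ X →
          5 * α * (t * (5 * α) + m₀) + tri (5 * α) ≤ T → ∑ w + ∑ z ≡ tri (t * (5 * α) + m₀) →
          (∀ a′ (w′ : Demand k) → Near a′ w′ → Desc ws w′ → ∑ w′ ≡ tri m₀ → Realizable m₀ w′) →
          Realizable (t * (5 * α) + m₀) (λ i → w i + z i)
        blocks zero a w z near desc good z≤ _ _ eq K = realizable-cong
          (λ i → symm (trans (cong (w i +_) (∑-zero⁻¹ ∑z≡0 i)) (+-identityʳ _)))
          (K a w near desc (trans (symm (trans (cong (∑ w +_) ∑z≡0) (+-identityʳ _))) eq))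
          where
          ∑z≡0 : ∑ z ≡ 0
          ∑z≡0 = n≤0⇒n≡0 z≤
        blocks (suc t) a w z near desc good z≤ z≤X ≤T eq K =
          subst (λ n → Realizable n (λ i → w i + z i)) (symm (+-assoc b (t * b) m₀))
            (block (λ i → sub w p x i + z′ i) f p b split
              (blocks t p (sub w p x) z′ (proj₂ (proj₂ chosen) x) (desc-trans desc (desc-sub w p x p-big x≤T))
                (Cover.good K′) z′≤ (≤-trans (≤-trans (m≤m+n _ _) (≡⇒≥ ∑z≡)) z≤X)
                (≤-trans (+-monoˡ-≤ (tri b) (*-monoʳ-≤ b (≤-trans (m≤n+m m b) (≡⇒≥ (+-assoc b (t * b) m₀))))) ≤T) eq′ K))
          where
          b m : ℕ
          b = 5 * α
          m = t * b + m₀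
          K′ : Cover α α′ z
          K′ = cover α α′ z 2α′≤α good
          open Cover K′ using (f; z′; covers; gain)
          x : ℕ
          x = b * m + gap f b
          x≤T : x ≤ T
          x≤T = ≤-trans (+-mono-≤ (*-monoʳ-≤ b (≤-trans (m≤n+m m b) (≡⇒≥ (+-assoc b (t * b) m₀)))) (gap≤tri f b)) ≤T
          tri-split : ∑ w + ∑ z ≡ tri b + b * m + tri m
          tri-split = trans eq (trans (cong tri (+-assoc b (t * b) m₀)) (tri-+ b m))
          1≤b : 1 ≤ b
          1≤b = ≤-trans 1≤α (m≤n*m α 5)
          -- `filler` is phrased for `tri (suc m)`, so the predecessor of the current number of
          -- vertices is needed.
          top : ∃ λ n → suc n ≡ suc t * b + m₀ × m₀ ≤ n
          top with b | 1≤b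
          ... | suc b′ | _ = b′ + t * suc b′ + m₀ , refl , m≤n+m m₀ _
          chosen = pick near (filler (∑ z) (proj₁ top) desc (proj₂ (proj₂ top)) z≤X
            (trans eq (cong tri (symm (proj₁ (proj₂ top))))))
          p = proj₁ chosen
          p-big = proj₁ (proj₂ chosen)
          x≤wp : x ≤ w p
          x≤wp = ≤-trans x≤T (≤-trans (m≤m+n T _) p-big)
          split : ∀ i → w i + z i ≡ sub w p x i + z′ i + used f b i + δ p x i
          split i = trans (cong₂ _+_ (symm (sub-+ w p x x≤wp i)) (covers i))
            (rearrange (sub w p x i) (δ p x i) (z′ i) (used f b i))
            where
            rearrange : ∀ s d z u → s + d + (z + u) ≡ s + z + u + d
            rearrange = solve-∀
          ∑z≡ : ∑ z ≡ ∑ z′ + ∑ (used f b)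
          ∑z≡ = trans (∑-cong covers) (∑-+ z′ (used f b))
          z′≤ : ∑ z′ ≤ t * (α′ * α)
          z′≤ with gain
          ... | inj₂ all0 = ≤-trans (≤-reflexive (∑-zero all0)) z≤n
          ... | inj₁ le = +-cancelʳ-≤ (α′ * α) _ _ (≤-trans le (≤-trans z≤ (≤-reflexive (+-comm (α′ * α) _))))
          eq′ : ∑ (sub w p x) + ∑ z′ ≡ tri m
          eq′ = +-cancelʳ-≡ (tri b + b * m) _ _ (begin-equality
            ∑ (sub w p x) + ∑ z′ + (tri b + b * m)
              ≡⟨ cong (λ t → ∑ (sub w p x) + ∑ z′ + (t + b * m)) (∑-used-gap f b) ⟨
            ∑ (sub w p x) + ∑ z′ + (∑ (used f b) + gap f b + b * m)
              ≡⟨ rearrange (∑ (sub w p x)) (∑ z′) (∑ (used f b)) (gap f b) (b * m) ⟩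
            ∑ (sub w p x) + x + (∑ z′ + ∑ (used f b))
              ≡⟨ cong₂ _+_ (∑-sub w p x x≤wp) (symm ∑z≡) ⟩
            ∑ w + ∑ z
              ≡⟨ tri-split ⟩
            tri b + b * m + tri m
              ≡⟨ +-comm _ (tri m) ⟩
            tri m + (tri b + b * m) ∎)
            where
            open ≤-Reasoning
            rearrange : ∀ s z u g y → s + z + (u + g + y) ≡ s + (y + g) + (z + u)
            rearrange = solve-∀

-- Upper bound: finishing with few colours

argmax : ∀ {k} (e : Demand k) → Fin k → ∃ λ p → ∀ j → e j ≤ e p
argmax {suc zero}    e _ = Fin.zero , λ { Fin.zero → ≤-refl }
argmax {suc (suc k)} e _ with argmax (e ∘ Fin.suc) Fin.zero
... | p , max with ≤-total (e Fin.zero) (e (Fin.suc p))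
...   | inj₁ le = Fin.suc p , λ { Fin.zero → le ; (Fin.suc j) → max j }
...   | inj₂ ge = Fin.zero , λ { Fin.zero → ≤-refl ; (Fin.suc j) → ≤-trans (max j) ge }

∑-support : ∀ {k} (e : Demand k) S M → (∀ i → i ∉ S → e i ≡ 0) → (∀ i → e i ≤ M) → ∑ e ≤ length S * M
∑-support {k} e S M supp bound = ≤-trans (∑-mono pointwise) (≤-reflexive (total S))
  where
  spread : List (Fin k) → Demand k
  spread []      i = 0
  spread (s ∷ S) i = δ s M i + spread S i
  total : ∀ S → ∑ (spread S) ≡ length S * M
  total []      = ∑-zero {k} (λ _ → refl)
  total (s ∷ S) = trans (∑-+ (δ s M) (spread S)) (cong₂ _+_ (∑-δ s M) (total S))
  member : ∀ {S i} → i ∈ S → M ≤ spread S i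
  member {s ∷ S} (here refl) = ≤-trans (≡⇒≥ (δ-≡ s M)) (m≤m+n _ _)
  member {s ∷ S} (there i∈)  = ≤-trans (member i∈) (m≤n+m _ _)
  open import Data.List.Membership.DecPropositional (Fin._≟_ {k}) using (_∈?_)
  pointwise : ∀ i → e i ≤ spread S i
  pointwise i with i ∈? S
  ... | yes i∈ = ≤-trans (bound i) (member i∈)
  ... | no i∉  = ≤-trans (≤-reflexive (supp i i∉)) z≤n

-- The bound 2 ≤ m excludes the coincidence tri 0 = tri 1.
tri-cancel-≤ : ∀ {m n} → 2 ≤ m → tri m ≤ tri n → m ≤ n
tri-cancel-≤ {m} {n} 2≤m le = ≮⇒≥ λ n<m → <⇒≱ (strict n n<m) le
  where
  strict : ∀ n → n < m → tri n < tri m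
  strict zero    n<m = tri-mono 2≤m
  strict (suc n) n<m = ≤-trans (s≤s (m≤n+m _ n)) (tri-mono n<m)

module _ {k : ℕ} where

  -- All edges of `i` go into the interior of a block of `b` vertices as a subset sum of its levels;
  -- colour `p` fills the gaps and joins the block to the rest.
  eliminate : ∀ {m} (e : Demand k) i p b → p ≢ i → e i ≤ tri b → b * m + tri b ≤ e p →
    ∃ λ e′ → (∀ j → j ≢ i → j ≢ p → e′ j ≡ e j) × e′ i ≡ 0 × (e p ≤ e′ p + (b * m + tri b)) × e′ p ≤ e p ×
      (∑ e ≡ tri (b + m) → ∑ e′ ≡ tri m) × (Realizable m e′ → Realizable (b + m) e)
  eliminate {m} e i p b p≢i ei≤ cost = e′ , other , zero-i , loss , p≤ , total , realize
    where
    plan = subset-sum b (e i) i ei≤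
    f = proj₁ plan
    x : ℕ
    x = b * m + gap f b
    x≤ : x ≤ b * m + tri b
    x≤ = +-monoʳ-≤ (b * m) (gap≤tri f b)
    e₁ e′ : Demand k
    e₁ = sub e i (e i)
    e′ = sub e₁ p x
    e₁p : e₁ p ≡ e p
    e₁p = sub-≢ e (e i) (p≢i ∘ symm)
    x≤e₁p : x ≤ e₁ p
    x≤e₁p = ≤-trans (≤-trans x≤ cost) (≡⇒≥ e₁p)
    other : ∀ j → j ≢ i → j ≢ p → e′ j ≡ e j
    other j j≢i j≢p = trans (sub-≢ e₁ x (j≢p ∘ symm)) (sub-≢ e (e i) (j≢i ∘ symm))
    zero-i : e′ i ≡ 0
    zero-i = trans (sub-≢ e₁ x p≢i) (trans (sub-≡ e i (e i)) (n∸n≡0 (e i)))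
    e′p : e′ p ≡ e p ∸ x
    e′p = trans (sub-≡ e₁ p x) (cong (_∸ x) e₁p)
    loss : e p ≤ e′ p + (b * m + tri b)
    loss = ≤-trans (≡⇒≥ (m∸n+n≡m (≤-trans x≤ cost))) (+-mono-≤ (≡⇒≥ e′p) x≤)
    p≤ : e′ p ≤ e p
    p≤ = ≤-trans (≤-reflexive e′p) (m∸n≤m (e p) x)
    tri-b : e i + gap f b ≡ tri b
    tri-b = trans (cong (_+ gap f b) (symm (trans (∑-cong (proj₂ plan)) (∑-δ i (e i))))) (∑-used-gap f b)
    total : ∑ e ≡ tri (b + m) → ∑ e′ ≡ tri m
    total eq = +-cancelʳ-≡ (tri b + b * m) _ _ (begin-equality
      ∑ e′ + (tri b + b * m) ≡⟨ cong (λ t → ∑ e′ + (t + b * m)) tri-b ⟨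
      ∑ e′ + (e i + gap f b + b * m) ≡⟨ rearrange (∑ e′) (e i) (gap f b) (b * m) ⟩
      ∑ e′ + x + e i ≡⟨ cong (_+ e i) (∑-sub e₁ p x x≤e₁p) ⟩
      ∑ e₁ + e i ≡⟨ ∑-sub e i (e i) ≤-refl ⟩
      ∑ e ≡⟨ trans eq (tri-+ b m) ⟩
      tri b + b * m + tri m ≡⟨ +-comm _ (tri m) ⟩
      tri m + (tri b + b * m) ∎)
      where
      open ≤-Reasoning
      rearrange : ∀ s a g y → s + (a + g + y) ≡ s + (y + g) + a
      rearrange = solve-∀
    realize : Realizable m e′ → Realizable (b + m) e
    realize = block e′ f p b λ j → begin-equality
      e j ≡⟨ sub-+ e i (e i) ≤-refl j ⟨
      e₁ j + δ i (e i) j ≡⟨ cong₂ _+_ (symm (sub-+ e₁ p x x≤e₁p j)) (symm (proj₂ plan j)) ⟩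
      e′ j + δ p x j + used f b j ≡⟨ +-swapʳ (e′ j) (δ p x j) (used f b j) ⟩
      e′ j + used f b j + δ p x j ∎
      where open ≤-Reasoning

  -- Peeling in colour `i` lowers `e i` and `tri m` by the same amount. Their difference stays at
  -- least `tri m₀`, so colour `i` runs low while at least m₀ vertices are left.
  peel-colour : ∀ m (e : Demand k) i m₀ → 2 ≤ m₀ → ∑ e ≡ tri m → e i + tri m₀ ≤ tri m →
    (∀ m′ e′ → m₀ ≤ m′ → e′ i ≤ m′ → e′ i ≤ e i → (∀ j → j ≢ i → e′ j ≡ e j) → ∑ e′ ≡ tri m′ → Realizable m′ e′) →
    Realizable m e
  peel-colour zero e i m₀ 2≤m₀ eq le K =
    ⊥-elim (<⇒≱ (≤-trans (tri-mono 2≤m₀) (m≤n+m _ (e i))) le)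
  peel-colour (suc m) e i m₀ 2≤m₀ eq le K with e i ≤? suc m
  ... | yes small = K (suc m) e (tri-cancel-≤ 2≤m₀ (≤-trans (m≤n+m _ (e i)) le)) small ≤-refl (λ _ _ → refl) eq
  ... | no large = peel i m≤ei (peel-colour m (sub e i m) i m₀ 2≤m₀
          (+-cancelʳ-≡ m _ _ (trans (∑-sub e i m m≤ei) (trans eq (+-comm m _)))) le′
          λ m′ e′ m₀≤ small below other eq′ → K m′ e′ m₀≤ small
            (≤-trans below (≤-trans (≤-reflexive (sub-≡ e i m)) (m∸n≤m (e i) m)))
            (λ j j≢i → trans (other j j≢i) (sub-≢ e m (j≢i ∘ symm))) eq′)
    where
    m≤ei : m ≤ e i
    m≤ei = ≤-trans (n≤1+n m) (<⇒≤ (≰⇒> large))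
    le′ : sub e i m i + tri m₀ ≤ tri m
    le′ = +-cancelˡ-≤ m _ _ (≤-trans (≤-reflexive (trans (cong (λ t → m + (t + tri m₀)) (sub-≡ e i m))
      (trans (symm (+-assoc m (e i ∸ m) _)) (cong (_+ tri m₀) (m+[n∸m]≡n m≤ei))))) le)

  realizable-single : ∀ m (e : Demand k) p → (∀ j → j ≢ p → e j ≡ 0) → ∑ e ≡ tri m → Realizable m e
  realizable-single m e p supp eq = realizable-cong pointwise (realizable-plan (λ _ → nothing) p m)
    where
    e-p : e p ≡ tri m
    e-p = trans (trans (symm (∑-δ p (e p))) (∑-cong δ-e)) eq
      where
      δ-e : ∀ i → δ p (e p) i ≡ e i
      δ-e i with p Fin.≟ i
      ... | yes refl = refl
      ... | no p≢i   = symm (supp i (p≢i ∘ symm))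
    gap-nothing : ∀ m → gap {k} (λ _ → nothing) m ≡ tri m
    gap-nothing zero    = refl
    gap-nothing (suc m) = cong (m +_) (gap-nothing m)
    pointwise : ∀ i → used (λ _ → nothing) m i + δ p (gap (λ _ → nothing) m) i ≡ e i
    pointwise i rewrite used-nothing (λ _ → nothing) m i (λ _ _ → refl) with p Fin.≟ i
    ... | yes refl = trans (gap-nothing m) (symm e-p)
    ... | no p≢i   = symm (supp i (p≢i ∘ symm))

  -- The less frequent colours are removed one by one: peel vertices until fewer than m edges of the colour are left,
  -- then put these into a single block.
  few-colours : ∀ q m (e : Demand k) S → length S ≤ q → (∀ i → i ∉ S → e i ≡ 0) → 4 ^ (4 + q) ≤ m →
    ∑ e ≡ tri m → Realizable m e
  few-colours q m e S |S|≤q supp large eq with Fin.any? (λ i → ¬? (e i ≟ 0))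
  ... | no none = ⊥-elim (<⇒≱ (tri-mono 2≤m) (≤-trans (≡⇒≥ eq)
          (≤-reflexive (∑-zero (λ i → decidable-stable (e i ≟ 0) (λ ne → none (i , ne)))))))
    where
    2≤m : 2 ≤ m
    2≤m = ≤-trans (≤-trans (s≤s (s≤s z≤n)) (*-monoʳ-≤ 4 (m^n>0 4 (3 + q)))) large
  ... | yes (j₀ , _) with argmax e j₀
  ...   | p , max with Fin.any? (λ i → ¬? (i Fin.≟ p) ×-dec ¬? (e i ≟ 0))
  ...     | no none = realizable-single m e p
              (λ j j≢p → decidable-stable (e j ≟ 0) (λ ne → none (j , j≢p , ne))) eq
  ...     | yes (i , i≢p , ei≢0) = step q |S|≤q large
    where
    open import Data.List.Membership.DecPropositional (Fin._≟_ {k}) using (_∈?_)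
    i∈S : i ∈ S
    i∈S = decidable-stable (i ∈? S) (λ i∉ → ei≢0 (supp i i∉))
    ≢i? : ∀ x → Dec (x ≢ i)
    ≢i? x = ¬? (x Fin.≟ i)
    S′ = filter ≢i? S
    |S′|<|S| : length S′ < length S
    |S′|<|S| = filter-notAll ≢i? S (Any.map (λ i≡x x≢i → x≢i (symm i≡x)) i∈S)
    step : ∀ q → length S ≤ q → 4 ^ (4 + q) ≤ m → Realizable m e
    step zero |S|≤0 _ = ⊥-elim (<⇒≱ |S′|<|S| (≤-trans |S|≤0 z≤n))
    step (suc q) |S|≤q large = peel-colour m e i m₀ 2≤m₀ eq budget continue
      where
      open ≤-Reasoning
      N m₀ : ℕ
      N = 4 ^ (4 + q)
      m₀ = 2 * N
      1≤N : 1 ≤ N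
      1≤N = m^n>0 4 (4 + q)
      2≤m₀ : 2 ≤ m₀
      2≤m₀ = *-monoʳ-≤ 2 1≤N
      2m₀≤m : m₀ + m₀ ≤ m
      2m₀≤m = ≤-trans (≤-reflexive (double N)) large
        where
        double : ∀ N → 2 * N + 2 * N ≡ 4 * N
        double = solve-∀
      budget : e i + tri m₀ ≤ tri m
      budget = *-cancelˡ-≤ 2 (begin
        2 * (e i + tri m₀) ≡⟨ rearrange (e i) (tri m₀) ⟩
        e i + e i + (tri m₀ + tri m₀) ≤⟨ +-mono-≤ half₁ half₂ ⟩
        tri m + tri m ≡⟨ cong (tri m +_) (+-identityʳ _) ⟨
        2 * tri m ∎)
        where
        rearrange : ∀ a b → 2 * (a + b) ≡ a + a + (b + b)
        rearrange = solve-∀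
        -- `p` is a most frequent colour, so any other colour has at most half of the edges.
        half₁ : e i + e i ≤ tri m
        half₁ = ≤-trans (+-monoʳ-≤ (e i) (max i)) (≤-trans (∑-≥₂ e i p i≢p) (≤-reflexive eq))
        half₂ : tri m₀ + tri m₀ ≤ tri m
        half₂ = ≤-trans (≤-trans (+-monoˡ-≤ (tri m₀) (m≤m+n (tri m₀) (m₀ * m₀)))
          (≡⇒≥ (tri-+ m₀ m₀))) (tri-mono 2m₀≤m)
      continue : ∀ m′ e′ → m₀ ≤ m′ → e′ i ≤ m′ → e′ i ≤ e i → (∀ j → j ≢ i → e′ j ≡ e j) →
        ∑ e′ ≡ tri m′ → Realizable m′ e′
      continue m′ e′ m₀≤m′ e′i≤ e′i≤ei same eq′ =
        let (e″ , other , zero-i , _ , p≤ , total , realize) =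
              eliminate {m″} e′ i p b (i≢p ∘ symm) (≤-trans e′i≤ m′≤tri) cost
        in subst (λ t → Realizable t e′) b+m″
             (realize (finish e″ other zero-i p≤ (total (trans eq′ (cong tri (symm b+m″))))))
        where
        r c b m″ : ℕ
        r = suc q
        -- With b = m′ / (4r), a block costs at most b m′ ≤ m′² / (4r) ≤ tri m′ / r, the share of a
        -- most frequent among r colours; and b ≥ 32r still gives tri b ≥ m′.
        c = 4 * r
        b = m′ / c
        m″ = m′ ∸ b
        cb≤m′ : c * b ≤ m′
        cb≤m′ = ≤-trans (≤-reflexive (*-comm c b)) (≤-trans (m≤n+m _ (m′ % c)) (≡⇒≥ (m≡m%n+[m/n]*n m′ c)))
        m′<c[b+1] : m′ < c * suc b
        m′<c[b+1] = begin-strict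
          m′ ≡⟨ m≡m%n+[m/n]*n m′ c ⟩
          m′ % c + b * c <⟨ +-monoˡ-< (b * c) (m%n<n m′ c) ⟩
          c + b * c ≡⟨ *-comm (suc b) c ⟩
          c * suc b ∎
        r²≤4^q : r * r ≤ 4 ^ q
        r²≤4^q = ≤-trans (*-mono-≤ (n<2^n q) (n<2^n q)) (≤-reflexive (square q))
          where
          regroup : ∀ x → 2 * x * (2 * x) ≡ 4 * (x * x)
          regroup = solve-∀
          square : ∀ q → 2 ^ q * 2 ^ q ≡ 4 ^ q
          square zero = refl
          square (suc q) = trans (regroup (2 ^ q)) (cong (4 *_) (square q))
        b<m′ : b + b ≤ m′
        b<m′ = ≤-trans (≤-trans (≤-reflexive (cong (b +_) (symm (+-identityʳ b)))) (*-monoˡ-≤ b {2} {c} (≤-trans (s≤s (s≤s z≤n)) (*-monoʳ-≤ 4 {1} {r} (s≤s z≤n))))) cb≤m′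
        b+m″ : b + m″ ≡ m′
        b+m″ = m+[n∸m]≡n (≤-trans (m≤m+n b b) b<m′)
        32r≤b : 32 * r ≤ b
        32r≤b = ≤-pred (*-cancelˡ-< c (32 * r) (suc b) (begin-strict
          c * (32 * r) ≡⟨ rearrange r ⟩
          128 * (r * r) ≤⟨ *-monoʳ-≤ 128 r²≤4^q ⟩
          128 * 4 ^ q ≤⟨ *-monoˡ-≤ (4 ^ q) (m≤m+n 128 128) ⟩
          256 * 4 ^ q ≡⟨ expand (4 ^ q) ⟩
          N ≤⟨ m≤n*m N 2 ⟩
          m₀ ≤⟨ m₀≤m′ ⟩
          m′ <⟨ m′<c[b+1] ⟩
          c * suc b ∎))
          where
          rearrange : ∀ r → 4 * r * (32 * r) ≡ 128 * (r * r)
          rearrange = solve-∀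
          expand : ∀ x → 256 * x ≡ 4 * (4 * (4 * (4 * x)))
          expand = solve-∀
        m′≤tri : m′ ≤ tri b
        m′≤tri = *-cancelˡ-≤ 2 (+-cancelʳ-≤ b _ _ (begin
          2 * m′ + b ≤⟨ +-monoˡ-≤ b (*-monoʳ-≤ 2 (<⇒≤ m′<c[b+1])) ⟩
          2 * (c * suc b) + b ≡⟨ rearrange r b ⟩
          8 * r * b + 8 * r + b ≤⟨ +-monoˡ-≤ b (+-monoʳ-≤ (8 * r * b) (m≤m*n (8 * r) b {{>-nonZero 1≤b}})) ⟩
          8 * r * b + 8 * r * b + b ≤⟨ slack ⟩
          b * b ≡⟨ tri-double b ⟨
          2 * tri b + b ∎))
          where
          1≤b : 1 ≤ b
          1≤b = ≤-trans (≤-trans (s≤s z≤n) (*-monoʳ-≤ 32 {1} {r} (s≤s z≤n))) 32r≤b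
          rearrange : ∀ r b → 2 * (4 * r * suc b) + b ≡ 8 * r * b + 8 * r + b
          rearrange = solve-∀
          slack : 8 * r * b + 8 * r * b + b ≤ b * b
          slack = begin
            8 * r * b + 8 * r * b + b ≤⟨ +-monoʳ-≤ (8 * r * b + 8 * r * b) (m≤n*m b (16 * r)) ⟩
            8 * r * b + 8 * r * b + 16 * r * b ≡⟨ collect r b ⟩
            32 * r * b ≤⟨ *-monoˡ-≤ b 32r≤b ⟩
            b * b ∎
            where
            collect : ∀ r b → 8 * r * b + 8 * r * b + 16 * r * b ≡ 32 * r * b
            collect = solve-∀
        max′ : ∀ j → e′ j ≤ e′ p
        max′ j with j Fin.≟ i
        ... | yes refl = ≤-trans e′i≤ei (≤-trans (max j) (≡⇒≥ (same p (i≢p ∘ symm))))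
        ... | no j≢i = ≤-trans (≤-reflexive (same j j≢i)) (≤-trans (max j) (≡⇒≥ (same p (i≢p ∘ symm))))
        supp′ : ∀ j → j ∉ S → e′ j ≡ 0
        supp′ j j∉ = trans (same j (λ { refl → j∉ i∈S })) (supp j j∉)
        tri≤ : tri m′ ≤ r * e′ p
        tri≤ = ≤-trans (≡⇒≥ eq′) (≤-trans (∑-support e′ S (e′ p) supp′ max′) (*-monoˡ-≤ (e′ p) |S|≤q))
        cost : b * m″ + tri b ≤ e′ p
        cost = *-cancelˡ-≤ r (≤-trans (*-cancelˡ-≤ 4 (begin
          4 * (r * (b * m″ + tri b)) ≤⟨ *-monoʳ-≤ 4 (*-monoʳ-≤ r (+-monoʳ-≤ (b * m″) tri≤b²)) ⟩
          4 * (r * (b * m″ + b * b)) ≡⟨ regroup r b m″ ⟩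
          c * b * (b + m″) ≤⟨ *-mono-≤ cb≤m′ (≤-reflexive b+m″) ⟩
          m′ * m′ ≤⟨ m′²≤ ⟩
          4 * tri m′ ∎)) tri≤)
          where
          regroup : ∀ r b m → 4 * (r * (b * m + b * b)) ≡ 4 * r * b * (b + m)
          regroup = solve-∀
          tri≤b² : tri b ≤ b * b
          tri≤b² = ≤-trans (m≤n*m (tri b) 2) (2tri≤² b)
          2≤m′ : 2 ≤ m′
          2≤m′ = ≤-trans 2≤m₀ m₀≤m′
          m′²≤ : m′ * m′ ≤ 4 * tri m′
          m′²≤ = ≤-from 0 (*-monoˡ-≤ m′ 2≤m′) (trans (rearrange m′ (tri m′)) (trans (cong (λ t → t + t) (tri-double m′)) (symm (+-identityʳ _))))
            where
            rearrange : ∀ m t → 4 * t + 2 * m ≡ 2 * t + m + (2 * t + m)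
            rearrange = solve-∀
        N≤m″ : N ≤ m″
        N≤m″ = *-cancelˡ-≤ 2 (begin
          2 * N ≤⟨ m₀≤m′ ⟩
          m′ ≡⟨ b+m″ ⟨
          b + m″ ≤⟨ +-monoˡ-≤ m″ (+-cancelˡ-≤ b _ _ (≤-trans b<m′ (≡⇒≥ b+m″))) ⟩
          m″ + m″ ≡⟨ cong (m″ +_) (+-identityʳ m″) ⟨
          2 * m″ ∎)
        finish : ∀ e″ → (∀ j → j ≢ i → j ≢ p → e″ j ≡ e′ j) → e″ i ≡ 0 → e″ p ≤ e′ p → ∑ e″ ≡ tri m″ →
          Realizable m″ e″
        finish e″ other zero-i p≤ eq″ =
          few-colours q m″ e″ S′ (≤-pred (≤-trans |S′|<|S| |S|≤q)) supp″ N≤m″ eq″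
          where
          supp″ : ∀ j → j ∉ S′ → e″ j ≡ 0
          supp″ j j∉ with j Fin.≟ i
          ... | yes refl = zero-i
          ... | no j≢i with j Fin.≟ p
          ...   | no j≢p = trans (other j j≢i j≢p) (supp′ j (λ j∈ → j∉ (∈-filter⁺ ≢i? j∈ j≢i)))
          ...   | yes refl = n≤0⇒n≡0 (≤-trans p≤ (≤-reflexive (supp′ j (λ j∈ → j∉ (∈-filter⁺ ≢i? j∈ j≢i)))))

-- Upper bound: the stages

module _ {k : ℕ} where

  take keep : (Fin k → Bool) → Demand k → Demand k
  take D e i = if D i then e i else 0
  keep D e i = if D i then 0 else e i

  keep+take : ∀ D e i → keep D e i + take D e i ≡ e i
  keep+take D e i with D i
  ... | true  = refl
  ... | false = +-identityʳ _

  ∑-keep-take : ∀ D e → ∑ (keep D e) + ∑ (take D e) ≡ ∑ e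
  ∑-keep-take D e = trans (symm (∑-+ (keep D e) (take D e))) (∑-cong (keep+take D e))

  keep≤ : ∀ D e i → keep D e i ≤ e i
  keep≤ D e i = ≤-trans (m≤m+n _ _) (≤-reflexive (keep+take D e i))

-- Stage j works at scale β = u 16^(J-j) with blocks of size 5α, where α = h 16^j and h = 16^J, hence αβ = u h².
-- The rare colours of class j are used up in the blocks of stage j.
module Stages {k : ℕ} (Q T u₂ h J : ℕ) (1≤u₂ : 1 ≤ u₂) (1≤h : 1 ≤ h)
  (k-small : 64 * (64 * k) ≤ 2 * u₂) (T-small : 64 * (2 * T) ≤ 2 * u₂ * (2 * u₂)) (Q-large : 64 * (13 * (16 * 16)) ≤ Q)
  (T-large : 128 * (2 * u₂ * (h * h)) ≤ T) (h²≤u : h * h ≤ 2 * u₂)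
  (class : Fin k → ℕ) (class<J : ∀ i → class i < J)
  (class-count : ∀ j → 8 * ∑ (λ i → 𝟙 (does (class i ≟ j))) ≤ h * h)
  (few : ∀ q → q * T ≤ tri (2 * u₂) → 4 ^ (4 + q) ≤ 2 * u₂) where

  open Filler {k} T Q public

  u : ℕ
  u = 2 * u₂

  1≤u : 1 ≤ u
  1≤u = ≤-trans 1≤u₂ (m≤n*m u₂ 2)

  1≤Q : 1 ≤ Q
  1≤Q = ≤-trans (s≤s z≤n) Q-large

  uh²≤T : u * (h * h) ≤ T
  uh²≤T = ≤-trans (m≤n*m _ 128) T-large

  4u≤T : 4 * u ≤ T
  4u≤T = begin
    4 * u ≤⟨ *-monoˡ-≤ u (m≤m+n 4 124) ⟩
    128 * u ≡⟨ cong (128 *_) (*-identityʳ u) ⟨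
    128 * (u * 1) ≤⟨ *-monoʳ-≤ 128 (*-monoʳ-≤ u (*-mono-≤ 1≤h 1≤h)) ⟩
    128 * (u * (h * h)) ≤⟨ T-large ⟩
    T ∎
    where open ≤-Reasoning

  tri[5β]≤ : ∀ β → tri (5 * β) ≤ 13 * (β * β)
  tri[5β]≤ β = *-cancelˡ-≤ 2 (≤-trans (2tri≤² (5 * β)) (≤-from (β * β) (z≤n {0}) (rearrange β)))
    where
    rearrange : ∀ β → 2 * (13 * (β * β)) + 0 ≡ 5 * β * (5 * β) + 0 + β * β
    rearrange = solve-∀

  budget : ∀ c S y → 64 * (k * c) ≤ y → 64 * S ≤ Q * y → 64 * (2 * T) ≤ y →
    64 * (k * (Q * c) + S + Q * (2 * T)) ≤ 3 * (Q * y)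
  budget c S y c≤ S≤ T≤ = begin
    64 * (k * (Q * c) + S + Q * (2 * T)) ≡⟨ regroup k Q c S (2 * T) 64 ⟩
    Q * (64 * (k * c)) + 64 * S + Q * (64 * (2 * T)) ≤⟨ +-mono-≤ (+-mono-≤ (*-monoʳ-≤ Q c≤) S≤) (*-monoʳ-≤ Q T≤) ⟩
    Q * y + Q * y + Q * y ≡⟨ collect (Q * y) ⟩
    3 * (Q * y) ∎
    where
    open ≤-Reasoning
    regroup : ∀ k Q c S T d → d * (k * (Q * c) + S + Q * T) ≡ Q * (d * (k * c)) + d * S + Q * (d * T)
    regroup = solve-∀
    collect : ∀ x → x + x + x ≡ 3 * x
    collect = solve-∀

  -- The three terms of `low-bound` take at most Q y / 64 each and the reserved demand Q y / 16, in
  -- all less than the half of Q y that is available. For c = 64β, S ≤ 13 (16β)² and y = β² this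
  -- gives the constants of `k-small` and `Q-large`.
  room : ∀ c S X m y → 1 ≤ y → 64 * (k * c) ≤ y → 64 * S ≤ Q * y → 64 * (2 * T) ≤ y → 16 * X ≤ y → y ≤ 2 * tri (suc m) →
    k * (Q * c) + S + Q * (2 * T) + Q * X < Q * tri (suc m)
  room c S X m y 1≤y c≤ S≤ T≤ X≤ y≤ = *-cancelˡ-< 64 _ _ (begin-strict
    64 * (k * (Q * c) + S + Q * (2 * T) + Q * X) ≡⟨ *-distribˡ-+ 64 (k * (Q * c) + S + Q * (2 * T)) (Q * X) ⟩
    64 * (k * (Q * c) + S + Q * (2 * T)) + 64 * (Q * X) ≤⟨ +-mono-≤ (budget c S y c≤ S≤ T≤) (≤-trans (≤-reflexive (regroup Q X)) (*-monoʳ-≤ (4 * Q) X≤)) ⟩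
    3 * (Q * y) + 4 * Q * y <⟨ ≤-from (24 * (Q * y)) (*-mono-≤ 1≤Q 1≤y) (collect Q y) ⟩
    32 * (Q * y) ≤⟨ *-monoʳ-≤ 32 (*-monoʳ-≤ Q y≤) ⟩
    32 * (Q * (2 * tri (suc m))) ≡⟨ regroup′ Q (tri (suc m)) ⟩
    64 * (Q * tri (suc m)) ∎)
    where
    open ≤-Reasoning
    regroup : ∀ Q X → 64 * (Q * X) ≡ 4 * Q * (16 * X)
    regroup = solve-∀
    collect : ∀ Q y → 32 * (Q * y) + 1 * 1 ≡ suc (3 * (Q * y) + 4 * Q * y) + Q * y + 24 * (Q * y)
    collect = solve-∀
    regroup′ : ∀ Q t → 32 * (Q * (2 * t)) ≡ 64 * (Q * t)
    regroup′ = solve-∀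

  -- Uses up the colours with between 4β and 2T edges at levels from [β, 5β). Afterwards every
  -- colour except possibly `a` is below 4β or at least `G`, which lowers the threshold `c` of
  -- `low-bound` for the next scale.
  module Window (β₂ : ℕ) (u≤β : u ≤ 2 * β₂) (5β≤T : 5 * (2 * β₂) ≤ T) (a : Fin k) (e : Demand k) (near : Near a e)
    (eq : ∑ e ≡ tri (5 * (2 * β₂))) (low≤β² : 16 * ∑ (low e) ≤ 2 * β₂ * (2 * β₂)) where

    β : ℕ
    β = 2 * β₂

    mid : Fin k → Bool
    mid i = does (4 * β ≤? e i) ∧ does (e i <? 2 * T)

    w₀ z₀ : Demand k
    w₀ = keep mid e
    z₀ = take mid e

    mid-cases : ∀ i → (4 * β ≤ e i × e i < 2 * T × w₀ i ≡ 0 × z₀ i ≡ e i)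
                    ⊎ ((e i < 4 * β ⊎ 2 * T ≤ e i) × w₀ i ≡ e i × z₀ i ≡ 0)
    mid-cases i with 4 * β ≤? e i | e i <? 2 * T
    ... | yes lo | yes hi rewrite dec-true (4 * β ≤? e i) lo | dec-true (e i <? 2 * T) hi = inj₁ (lo , hi , refl , refl)
    ... | no ≰ | _ rewrite dec-false (4 * β ≤? e i) ≰ = inj₂ (inj₁ (≰⇒> ≰) , refl , refl)
    ... | yes lo | no ≮ rewrite dec-true (4 * β ≤? e i) lo | dec-false (e i <? 2 * T) ≮ = inj₂ (inj₂ (≮⇒≥ ≮) , refl , refl)

    separated : ∀ i → i ≢ a → w₀ i < 4 * β ⊎ G ≤ w₀ i
    separated i i≢a with mid-cases i
    ... | inj₁ (_ , _ , w≡0 , _) = inj₁ (≤-trans (s≤s (≤-reflexive w≡0)) (*-mono-≤ {1} {4} (s≤s z≤n) (≤-trans 1≤u u≤β)))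
    ... | inj₂ (inj₁ lt , w≡e , _) = inj₁ (≤-trans (s≤s (≤-reflexive w≡e)) lt)
    ... | inj₂ (inj₂ ge , w≡e , _) with near i i≢a
    ...   | inj₁ lt = ⊥-elim (<⇒≱ lt ge)
    ...   | inj₂ G≤ = inj₂ (≤-trans G≤ (≡⇒≥ w≡e))

    near₀ : Near a w₀
    near₀ i i≢a with mid-cases i
    ... | inj₁ (_ , hi , w≡0 , _) = inj₁ (≤-trans (s≤s (≤-trans (≤-reflexive w≡0) z≤n)) hi)
    ... | inj₂ (_ , w≡e , _) = subst (λ t → t < 2 * T ⊎ G ≤ t) (symm w≡e) (near i i≢a)

    good₀ : Good β z₀
    good₀ i with mid-cases i
    ... | inj₁ (lo , _ , _ , z≡e) = inj₂ (≤-trans lo (≡⇒≥ z≡e))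
    ... | inj₂ (_ , _ , z≡0) = inj₁ z≡0

    z₀≤low : ∀ i → z₀ i ≤ low e i
    z₀≤low i with mid-cases i
    ... | inj₁ (_ , hi , _ , z≡e) = ≤-reflexive (trans z≡e (symm (low-< e i hi)))
    ... | inj₂ (_ , _ , z≡0) = ≤-trans (≤-reflexive z≡0) z≤n

    16∑z₀≤ : 16 * ∑ z₀ ≤ β * β
    16∑z₀≤ = ≤-trans (*-monoʳ-≤ 16 (∑-mono z₀≤low)) low≤β²

    1≤β² : 1 ≤ β * β
    1≤β² = *-mono-≤ (≤-trans 1≤u u≤β) (≤-trans 1≤u u≤β)

    ∑w₀≤ : ∑ w₀ ≤ 13 * (β * β)
    ∑w₀≤ = ≤-trans (∑-mono (keep≤ mid e)) (≤-trans (≤-reflexive eq) (tri[5β]≤ β))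

    window-room : k * (Q * (4 * β)) + ∑ w₀ + Q * (2 * T) + Q * ∑ z₀ < Q * tri (suc β)
    window-room = room (4 * β) (∑ w₀) (∑ z₀) β (β * β) 1≤β² k-term S-term T-term 16∑z₀≤ (²≤2tri-suc β)
      where
      open ≤-Reasoning
      k-term : 64 * (k * (4 * β)) ≤ β * β
      k-term = begin
        64 * (k * (4 * β)) ≡⟨ regroup k β ⟩
        64 * (4 * k) * β ≤⟨ *-monoˡ-≤ β (≤-trans (*-monoʳ-≤ 64 (*-monoˡ-≤ k (m≤m+n 4 60))) (≤-trans k-small u≤β)) ⟩
        β * β ∎
        where
        regroup : ∀ k β → 64 * (k * (4 * β)) ≡ 64 * (4 * k) * β
        regroup = solve-∀
      S-term : 64 * ∑ w₀ ≤ Q * (β * β)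
      S-term = begin
        64 * ∑ w₀ ≤⟨ *-monoʳ-≤ 64 ∑w₀≤ ⟩
        64 * (13 * (β * β)) ≡⟨ *-assoc 64 13 (β * β) ⟨
        64 * 13 * (β * β) ≤⟨ *-monoˡ-≤ (β * β) (≤-trans (*-monoʳ-≤ 64 (m≤m*n 13 (16 * 16))) Q-large) ⟩
        Q * (β * β) ∎
      T-term : 64 * (2 * T) ≤ β * β
      T-term = ≤-trans T-small (*-mono-≤ u≤β u≤β)

    K : Cover β β₂ z₀
    K = cover β β₂ z₀ ≤-refl good₀

    open Cover K using (f; f-low; covers; gain) renaming (z′ to z₁)

    -- Otherwise the β / 2 rounds would have removed at least β² / 2 edges, but there are at most β²
    -- / 16.
    done : ∀ i → z₁ i ≡ 0
    done with gain
    ... | inj₂ all0 = all0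
    ... | inj₁ le = ⊥-elim (<⇒≱ (begin-strict
      16 * ∑ z₀ ≤⟨ 16∑z₀≤ ⟩
      β * β <⟨ ≤-from (6 * (β * β)) 1≤β² (collect β₂) ⟩
      16 * (β₂ * β) ∎) (*-monoʳ-≤ 16 (≤-trans (m≤n+m _ (∑ z₁)) le)))
      where
      open ≤-Reasoning
      collect : ∀ b → 16 * (b * (2 * b)) + 1 ≡ suc (2 * b * (2 * b)) + 2 * b * (2 * b) + 6 * (2 * b * (2 * b))
      collect = solve-∀

    z₀≡used : ∀ i → z₀ i ≡ used f (5 * β) i
    z₀≡used i = trans (covers i) (cong (_+ used f (5 * β) i) (done i))

    run : (∀ a′ (w : Demand k) → Near a′ w → Desc w₀ w → ∑ w ≡ tri β → Realizable β w) → Realizable (5 * β) e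
    run cont = subst (λ n → Realizable n e) (symm size) (realizable-cong split
      (descend f (λ _ → 0) (4 * β) a w₀ near₀ desc-refl
        (≤-trans (≡⇒≥ size) 5β≤T) sum-eq (≤-reflexive ∑used)
        λ a′ w near′ desc eq′ → realizable-cong (λ i → symm (trans (cong (w i +_) (below i)) (+-identityʳ _)))
          (cont a′ w near′ desc (trans (symm (trans (cong (∑ w +_) (∑-zero below)) (+-identityʳ _))) eq′))))
      where
      open Descent a (4 * β) w₀ separated (∑ z₀) β window-room
      size : 5 * β ≡ 4 * β + β
      size = +-comm β (4 * β)
      below : ∀ i → 0 + used f β i ≡ 0
      below i = used-nothing f β i f-low
      used-top : ∀ i → used f (4 * β + β) i ≡ z₀ i
      used-top i = trans (cong (λ n → used f n i) (symm size)) (symm (z₀≡used i))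
      split : ∀ i → w₀ i + (0 + used f (4 * β + β) i) ≡ e i
      split i = trans (cong (w₀ i +_) (used-top i)) (keep+take mid e i)
      ∑used : ∑ (λ i → 0 + used f (4 * β + β) i) ≡ ∑ z₀
      ∑used = ∑-cong used-top
      sum-eq : ∑ w₀ + ∑ (λ i → 0 + used f (4 * β + β) i) ≡ tri (4 * β + β)
      sum-eq = trans (cong (∑ w₀ +_) ∑used) (trans (∑-keep-take mid e) (trans eq (cong tri size)))

  -- Leads from 16β, the lower end of the previous window, to 5β, the upper end of the next one. In
  -- this module β is already the new scale.
  module BlockStage (α₂ β : ℕ) (1≤α : 1 ≤ 2 * α₂) (α≤β : 2 * α₂ ≤ β) (u≤β : u ≤ β)
    (αβ : 2 * α₂ * β ≡ u * (h * h)) (α≤h² : 2 * α₂ ≤ h * h) (j : ℕ) (a : Fin k) (ws : Demand k)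
    (separated : ∀ i → i ≢ a → ws i < 4 * (16 * β) ⊎ G ≤ ws i) (∑ws≤ : ∑ ws ≤ 13 * (16 * β * (16 * β)))
    (small : ∀ i → ws i < 4 * u → ws i ≡ 0 ⊎ (4 * (h * h) ≤ ws i × j ≤ class i)) where

    open ≤-Reasoning

    α : ℕ
    α = 2 * α₂

    -- At least β / α blocks, which together have at most 10β vertices and so fit between 5β and
    -- 16β.
    t : ℕ
    t = suc ((β / α) {{>-nonZero 1≤α}})

    private instance
      α≢0 : NonZero α
      α≢0 = >-nonZero 1≤α

    β≤tα : β ≤ t * α
    β≤tα = begin
      β ≡⟨ m≡m%n+[m/n]*n β α ⟩
      β % α + β / α * α ≤⟨ +-monoˡ-≤ (β / α * α) (<⇒≤ (m%n<n β α)) ⟩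
      α + β / α * α ∎

    tα≤2β : t * α ≤ 2 * β
    tα≤2β = begin
      α + β / α * α ≤⟨ +-mono-≤ α≤β (≤-trans (m≤n+m _ (β % α)) (≡⇒≥ (m≡m%n+[m/n]*n β α))) ⟩
      β + β ≡⟨ cong (β +_) (+-identityʳ β) ⟨
      2 * β ∎

    M : ℕ
    M = t * (5 * α) + 5 * β

    M≤16β : M ≤ 16 * β
    M≤16β = begin
      t * (5 * α) + 5 * β ≡⟨ cong (_+ 5 * β) (regroup t α) ⟩
      5 * (t * α) + 5 * β ≤⟨ +-monoˡ-≤ (5 * β) (*-monoʳ-≤ 5 tα≤2β) ⟩
      5 * (2 * β) + 5 * β ≤⟨ ≤-from β (z≤n {0}) (collect β) ⟩
      16 * β ∎
      where
      regroup : ∀ t α → t * (5 * α) ≡ 5 * (t * α)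
      regroup = solve-∀
      collect : ∀ β → 16 * β + 0 ≡ 5 * (2 * β) + 5 * β + 0 + β
      collect = solve-∀

    16β≤T : 16 * β ≤ T
    16β≤T = begin
      16 * β ≤⟨ *-monoʳ-≤ 16 (m≤n*m β α) ⟩
      16 * (α * β) ≤⟨ *-monoˡ-≤ (α * β) (m≤m+n 16 112) ⟩
      128 * (α * β) ≡⟨ cong (128 *_) αβ ⟩
      128 * (u * (h * h)) ≤⟨ T-large ⟩
      T ∎

    -- The factor 128 in `T-large` has to cover the cost of a block, at most (5 · 16 + 13) α β.
    cost : 5 * α * (t * (5 * α) + 5 * β) + tri (5 * α) ≤ T
    cost = begin
      5 * α * M + tri (5 * α) ≤⟨ +-mono-≤ (*-monoʳ-≤ (5 * α) M≤16β) (tri[5β]≤ α) ⟩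
      5 * α * (16 * β) + 13 * (α * α) ≤⟨ +-monoʳ-≤ (5 * α * (16 * β)) (*-monoʳ-≤ 13 (*-monoʳ-≤ α α≤β)) ⟩
      5 * α * (16 * β) + 13 * (α * β) ≤⟨ ≤-from (35 * (α * β)) (z≤n {0}) (collect α β) ⟩
      128 * (α * β) ≡⟨ cong (128 *_) αβ ⟩
      128 * (u * (h * h)) ≤⟨ T-large ⟩
      T ∎
      where
      collect : ∀ α β → 128 * (α * β) + 0 ≡ 5 * α * (16 * β) + 13 * (α * β) + 0 + 35 * (α * β)
      collect = solve-∀

    -- The rare colours of class `j`. Windows never reach colours below 4u, as they act only from 4β
    -- ≥ 4u on.
    D : Fin k → Bool
    D i = does (ws i <? 4 * u) ∧ does (class i ≟ j)

    D-true : ∀ i → D i ≡ true → ws i < 4 * u × class i ≡ j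
    D-true i eq with ws i <? 4 * u | class i ≟ j
    ... | yes lt | yes c≡j = lt , c≡j
    ... | yes lt | no c≢j rewrite dec-false (class i ≟ j) c≢j with () ← trans (symm (Bool.∧-zeroʳ (does (ws i <? 4 * u)))) eq
    ... | no ≮ | _ rewrite dec-false (ws i <? 4 * u) ≮ with () ← eq

    D-false : ∀ i → D i ≡ false → ¬ (ws i < 4 * u × class i ≡ j)
    D-false i eq (lt , c≡j) rewrite dec-true (ws i <? 4 * u) lt | dec-true (class i ≟ j) c≡j with () ← eq

    ws₁ : Demand k
    ws₁ = keep D ws

    separated₁ : ∀ i → i ≢ a → ws₁ i < 4 * (16 * β) ⊎ G ≤ ws₁ i
    separated₁ i i≢a with D i
    ... | true  = inj₁ (*-mono-≤ {1} {4} (s≤s z≤n) (*-mono-≤ {1} {16} (s≤s z≤n) (≤-trans 1≤u u≤β)))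
    ... | false = separated i i≢a

    1≤β² : 1 ≤ β * β
    1≤β² = *-mono-≤ (≤-trans 1≤u u≤β) (≤-trans 1≤u u≤β)

    k-term : 64 * (k * (4 * (16 * β))) ≤ β * β
    k-term = begin
      64 * (k * (4 * (16 * β))) ≡⟨ regroup k β ⟩
      64 * (64 * k) * β ≤⟨ *-monoˡ-≤ β (≤-trans k-small u≤β) ⟩
      β * β ∎
      where
      regroup : ∀ k β → 64 * (k * (4 * (16 * β))) ≡ 64 * (64 * k) * β
      regroup = solve-∀

    S-term : 64 * ∑ ws₁ ≤ Q * (β * β)
    S-term = begin
      64 * ∑ ws₁ ≤⟨ *-monoʳ-≤ 64 (≤-trans (∑-mono (keep≤ D ws)) ∑ws≤) ⟩
      64 * (13 * (16 * β * (16 * β))) ≡⟨ regroup 64 13 16 β ⟩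
      64 * (13 * (16 * 16)) * (β * β) ≤⟨ *-monoˡ-≤ (β * β) Q-large ⟩
      Q * (β * β) ∎
      where
      regroup : ∀ a b c β → a * (b * (c * β * (c * β))) ≡ a * (b * (c * c)) * (β * β)
      regroup = solve-∀

    T-term : 64 * (2 * T) ≤ β * β
    T-term = ≤-trans T-small (*-mono-≤ u≤β u≤β)

    -- At most h² / 8 colours of fewer than 4u edges make at most u h² / 2 = α β / 2 edges, which is
    -- what β / α blocks can absorb at α² / 2 each.
    take≤ : ∀ {w : Demand k} → (∀ i → w i ≤ ws i) → 2 * ∑ (take D w) ≤ α * β
    take≤ {w} w≤ = begin
      2 * ∑ (take D w) ≤⟨ *-monoʳ-≤ 2 (∑-mono pointwise) ⟩
      2 * ∑ (λ i → 4 * u * 𝟙 (does (class i ≟ j))) ≡⟨ cong (2 *_) (∑-*ˡ {k} (4 * u) (λ i → 𝟙 (does (class i ≟ j)))) ⟩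
      2 * (4 * u * ∑ (λ i → 𝟙 (does (class i ≟ j)))) ≡⟨ regroup u (∑ (λ i → 𝟙 (does (class i ≟ j)))) ⟩
      u * (8 * ∑ (λ i → 𝟙 (does (class i ≟ j)))) ≤⟨ *-monoʳ-≤ u (class-count j) ⟩
      u * (h * h) ≡⟨ αβ ⟨
      α * β ∎
      where
      regroup : ∀ u c → 2 * (4 * u * c) ≡ u * (8 * c)
      regroup = solve-∀
      pointwise : ∀ i → take D w i ≤ 4 * u * 𝟙 (does (class i ≟ j))
      pointwise i with D i in eq
      ... | false = z≤n
      ... | true with D-true i eq
      ...   | lt , c≡j rewrite dec-true (class i ≟ j) c≡j =
              ≤-trans (≤-trans (w≤ i) (<⇒≤ lt)) (≡⇒≥ (*-identityʳ (4 * u)))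

    module Run (a′ : Fin k) (w : Demand k) (near : Near a′ w) (desc : Desc ws w) (eq : ∑ w ≡ tri (16 * β))
      (cont : ∀ a″ (w′ : Demand k) → Near a″ w′ → Desc ws₁ w′ → ∑ w′ ≡ tri (5 * β) → Realizable (5 * β) w′) where

      w₁ z₁ : Demand k
      w₁ = keep D w
      z₁ = take D w

      2∑z₁≤ : 2 * ∑ z₁ ≤ α * β
      2∑z₁≤ = take≤ (desc-≤ desc)

      X-term : 16 * ∑ z₁ ≤ β * β
      X-term = begin
        16 * ∑ z₁ ≡⟨ regroup (∑ z₁) ⟩
        8 * (2 * ∑ z₁) ≤⟨ *-monoʳ-≤ 8 (≤-trans 2∑z₁≤ (≤-trans (≤-reflexive αβ) uh²≤T)) ⟩
        8 * T ≤⟨ *-mono-≤ (m≤m+n 8 56) (m≤n*m T 2) ⟩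
        64 * (2 * T) ≤⟨ T-term ⟩
        β * β ∎
        where
        regroup : ∀ x → 16 * x ≡ 8 * (2 * x)
        regroup = solve-∀

      β²≤ : ∀ {m} → 5 * β ≤ m → β * β ≤ 2 * tri (suc m)
      β²≤ {m} le = begin
        β * β ≤⟨ *-mono-≤ (≤-trans (m≤n*m β 5) le) (≤-trans (m≤n*m β 5) le) ⟩
        m * m ≤⟨ ²≤2tri-suc m ⟩
        2 * tri (suc m) ∎

      room′ : ∀ {m} → 5 * β ≤ m → k * (Q * (4 * (16 * β))) + ∑ ws₁ + Q * (2 * T) + Q * ∑ z₁ < Q * tri (suc m)
      room′ {m} le = room (4 * (16 * β)) (∑ ws₁) (∑ z₁) m (β * β) 1≤β² k-term S-term T-term X-term (β²≤ le)

      near₁ : Near a′ w₁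
      near₁ i i≢a′ with D i
      ... | true  = inj₁ (≤-trans (≤-trans 1≤u (m≤n*m u 4)) (≤-trans 4u≤T (m≤n*m T 2)))
      ... | false = near i i≢a′

      desc₁ : Desc ws₁ w₁
      desc₁ i with D i
      ... | true  = inj₁ refl
      ... | false = desc i

      -- Since α ≤ h² at every stage, the single lower bound 4h² for rare colours provides the 4α
      -- needed here.
      good₁ : Good α z₁
      good₁ i with D i in eqD
      ... | false = inj₁ refl
      ... | true = cases (D-true i eqD) (desc i)
        where
        cases : ws i < 4 * u × class i ≡ j → w i ≡ ws i ⊎ (T ≤ w i × w i ≤ ws i) → w i ≡ 0 ⊎ 4 * α ≤ w i
        cases (lt , _) (inj₂ (T≤ , ≤ws)) = ⊥-elim (<⇒≱ lt (≤-trans 4u≤T (≤-trans T≤ ≤ws)))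
        cases (lt , _) (inj₁ same) with small i lt
        ... | inj₁ z = inj₁ (trans same z)
        ... | inj₂ (ge , _) = inj₂ (≤-trans (*-monoʳ-≤ 4 α≤h²) (≤-trans ge (≡⇒≥ same)))

      d : ℕ
      d = 16 * β ∸ M

      top : d + M ≡ 16 * β
      top = m∸n+n≡m M≤16β

      empty : ∀ m i → z₁ i + used (λ _ → nothing) m i ≡ z₁ i
      empty m i = trans (cong (z₁ i +_) (used-nothing (λ _ → nothing) m i (λ _ _ → refl))) (+-identityʳ _)

      z₁≤blocks : ∑ z₁ ≤ t * (α₂ * α)
      z₁≤blocks = *-cancelˡ-≤ 2 (begin
        2 * ∑ z₁ ≤⟨ 2∑z₁≤ ⟩
        α * β ≤⟨ *-monoʳ-≤ α β≤tα ⟩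
        α * (t * α) ≡⟨ regroup α₂ t ⟩
        2 * (t * (α₂ * α)) ∎)
        where
        regroup : ∀ a t → 2 * a * (t * (2 * a)) ≡ 2 * (t * (a * (2 * a)))
        regroup = solve-∀

      result : Realizable (16 * β) w
      result = subst (λ n → Realizable n w) top (realizable-cong
        (λ i → trans (cong (w₁ i +_) (empty (d + M) i)) (keep+take D w i))
        (F.descend (λ _ → nothing) z₁ d a′ w₁ near₁ desc₁ (≤-trans (≤-reflexive top) 16β≤T)
          (trans (cong (∑ w₁ +_) (∑-cong (empty (d + M)))) (trans (∑-keep-take D w) (trans eq (cong tri (symm top)))))
          (≤-reflexive (∑-cong (empty (d + M))))
          λ a₂ w₂ near₂ desc₂ eq₂ → realizable-cong (λ i → cong (w₂ i +_) (symm (empty M i)))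
            (B.blocks t a₂ w₂ z₁ near₂ desc₂ good₁ z₁≤blocks ≤-refl cost
              (trans (cong (∑ w₂ +_) (symm (∑-cong (empty M)))) eq₂) cont)))
        where
        -- Two floors for one descent: `F` peels single vertices down to where the blocks begin,
        -- `F′` guarantees fillers while the blocks lead on to 5β.
        module F = Descent a (4 * (16 * β)) ws₁ separated₁ (∑ z₁) M (room′ {M} (m≤n+m (5 * β) (t * (5 * α))))
        module F′ = Descent a (4 * (16 * β)) ws₁ separated₁ (∑ z₁) (5 * β) (room′ {5 * β} ≤-refl)
        module B = F′.Blocks α α₂ 1≤α ≤-refl

    -- This is the hypothesis of the next window: the three terms of `budget` give at most 3β² / 64.
    low-after : ∀ {w} → Desc ws₁ w → 16 * ∑ (low w) ≤ β * β
    low-after {w} desc = *-cancelˡ-≤ (4 * Q) {{>-nonZero (*-mono-≤ {1} {4} (s≤s z≤n) 1≤Q)}} (begin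
      4 * Q * (16 * ∑ (low w)) ≡⟨ regroup Q (∑ (low w)) ⟩
      64 * (Q * ∑ (low w)) ≤⟨ *-monoʳ-≤ 64 (low-bound a (4 * (16 * β)) ws₁ separated₁ (desc-≤ desc)) ⟩
      64 * (k * (Q * (4 * (16 * β))) + ∑ ws₁ + Q * (2 * T)) ≤⟨ budget (4 * (16 * β)) (∑ ws₁) (β * β) k-term S-term T-term ⟩
      3 * (Q * (β * β)) ≤⟨ *-monoˡ-≤ (Q * (β * β)) (m≤m+n 3 1) ⟩
      4 * (Q * (β * β)) ≡⟨ *-assoc 4 Q (β * β) ⟨
      4 * Q * (β * β) ∎)
      where
      regroup : ∀ Q x → 4 * Q * (16 * x) ≡ 64 * (Q * x)
      regroup = solve-∀

    small-after : ∀ {w} → Desc ws₁ w → ∀ i → w i < 4 * u → w i ≡ 0 ⊎ (4 * (h * h) ≤ w i × suc j ≤ class i)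
    small-after {w} desc i lt with desc i
    ... | inj₂ (T≤ , _) = ⊥-elim (<⇒≱ lt (≤-trans 4u≤T T≤))
    ... | inj₁ same with D i in eqD
    ...   | true  = inj₁ same
    ...   | false with small i (≤-trans (s≤s (≡⇒≥ same)) lt)
    ...     | inj₁ z = inj₁ (trans same z)
    ...     | inj₂ (ge , j≤) = inj₂ (≤-trans ge (≡⇒≥ same) ,
                ≤∧≢⇒< j≤ (λ j≡ → D-false i eqD (≤-trans (s≤s (≡⇒≥ same)) lt , symm j≡)))

  -- The invariant before stage `j`: rare colours of classes below `j` are exhausted, and those
  -- still present have at least 4h² edges.
  Small : ℕ → Demand k → Set
  Small j e = ∀ i → e i < 4 * u → e i ≡ 0 ⊎ (4 * (h * h) ≤ e i × j ≤ class i)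

  -- At the end all remaining colours are frequent, hence there are few of them.
  final : ∀ (w : Demand k) → (∀ i → w i ≡ 0 ⊎ T ≤ w i) → ∑ w ≡ tri u → Realizable u w
  final w big eq = few-colours (length S) u w S ≤-refl supp (few (length S) count) eq
    where
    side : Fin k → Bool
    side i = does (T ≤? w i)
    S : List (Fin k)
    S = onSide side true (allFin k)
    T≤ : ∀ {i} → i ∈ S → T ≤ w i
    T≤ {i} i∈ with T ≤? w i | proj₂ (∈-filter⁻ (λ x → side x Bool.≟ true) {xs = allFin k} i∈)
    ... | yes le | _ = le
    ... | no ≰ | eq′ with () ← trans (symm (dec-false (T ≤? w i) ≰)) eq′
    supp : ∀ i → i ∉ S → w i ≡ 0
    supp i i∉ with big i
    ... | inj₁ z = z
    ... | inj₂ le = ⊥-elim (i∉ (∈-filter⁺ (λ x → side x Bool.≟ true) (∈-allFin i) (dec-true (T ≤? w i) le)))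
    count : length S * T ≤ tri u
    count = begin
      length S * T ≡⟨ ∑ᴸ-const S T ⟨
      ∑ᴸ S (λ _ → T) ≤⟨ ∑ᴸ-mono S T≤ ⟩
      ∑ᴸ S w ≤⟨ m≤m+n _ _ ⟩
      ∑ᴸ S w + ∑ᴸ (onSide side false (allFin k)) w ≡⟨ ∑ᴸ-sides side (allFin k) w ⟨
      ∑ᴸ (allFin k) w ≡⟨ ∑ᴸ-allFin w ⟩
      ∑ w ≡⟨ eq ⟩
      tri u ∎
      where open ≤-Reasoning

  small₀ : ∀ {j β₂ u≤β 5β≤T a e near eq low≤} → Small j e → Small j (Window.w₀ β₂ u≤β 5β≤T a e near eq low≤)
  small₀ {j} {β₂} {u≤β} {5β≤T} {a} {e} {near} {eq} {low≤} small i lt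
    with Window.mid-cases β₂ u≤β 5β≤T a e near eq low≤ i
  ... | inj₁ (_ , _ , w≡0 , _) = inj₁ w≡0
  ... | inj₂ (_ , w≡e , _) =
        subst (λ t → t ≡ 0 ⊎ (4 * (h * h) ≤ t × j ≤ class i)) (symm w≡e) (small i (≤-trans (s≤s (≡⇒≥ w≡e)) lt))

  16^≢0 : ∀ r → 1 ≤ 16 ^ r
  16^≢0 r = m^n>0 16 r

  u≤ : ∀ r → u ≤ 2 * (u₂ * 16 ^ r)
  u≤ r = *-monoʳ-≤ 2 (m≤m*n u₂ (16 ^ r) {{>-nonZero (16^≢0 r)}})

  scale : ∀ r α → α * 16 ^ r ≡ h * h → α * (2 * (u₂ * 16 ^ r)) ≡ u * (h * h)
  scale r α αr = trans (regroup α u₂ (16 ^ r)) (cong (u *_) αr)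
    where
    regroup : ∀ α u x → α * (2 * (u * x)) ≡ 2 * u * (α * x)
    regroup = solve-∀

  1≤α : ∀ r α → α * 16 ^ r ≡ h * h → 1 ≤ α
  1≤α r zero αr = ⊥-elim (<⇒≱ (*-mono-≤ 1≤h 1≤h) (≡⇒≥ αr))
  1≤α r (suc α) αr = s≤s z≤n

  5β≤T : ∀ r α → α * 16 ^ r ≡ h * h → 5 * (2 * (u₂ * 16 ^ r)) ≤ T
  5β≤T r α αr = begin
    5 * (2 * (u₂ * 16 ^ r)) ≤⟨ *-mono-≤ (m≤m+n 5 123) (m≤n*m _ α {{>-nonZero (1≤α r α αr)}}) ⟩
    128 * (α * (2 * (u₂ * 16 ^ r))) ≡⟨ cong (128 *_) (scale r α αr) ⟩
    128 * (u * (h * h)) ≤⟨ T-large ⟩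
    T ∎
    where open ≤-Reasoning

  -- `r` counts the stages left and sets the scale β = u 16^r; the equation α 16^r = h² ties the
  -- block size to it. For `r = 0` every class is exhausted, and the window at β = u leaves only
  -- colours that are zero or at least `T`.
  stage : ∀ r j α a (e : Demand k) → j + r ≡ J → α * 16 ^ r ≡ h * h → Near a e →
    ∑ e ≡ tri (5 * (2 * (u₂ * 16 ^ r))) →
    16 * ∑ (low e) ≤ 2 * (u₂ * 16 ^ r) * (2 * (u₂ * 16 ^ r)) → Small j e →
    Realizable (5 * (2 * (u₂ * 16 ^ r))) e
  stage zero j α a e jr αr near eq low≤ small = W.run λ a′ w near′ desc eq′ →
      subst (λ n → Realizable (2 * n) w) (symm (*-identityʳ u₂))
        (final w (big w desc) (trans eq′ (cong (λ n → tri (2 * n)) (*-identityʳ u₂))))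
    where
    module W = Window (u₂ * 1) (u≤ 0) (5β≤T 0 α αr) a e near eq low≤
    big : ∀ w → Desc W.w₀ w → ∀ i → w i ≡ 0 ⊎ T ≤ w i
    big w desc i with desc i
    ... | inj₂ (T≤ , _) = inj₂ T≤
    ... | inj₁ same with W.mid-cases i
    ...   | inj₁ (_ , _ , w≡0 , _) = inj₁ (trans same w≡0)
    ...   | inj₂ (inj₂ ge , w≡e , _) = inj₂ (≤-trans (m≤n*m T 2) (≤-trans ge (≡⇒≥ (trans same w≡e))))
    ...   | inj₂ (inj₁ lt , w≡e , _) with small i (subst (λ n → e i < 4 * (2 * n)) (*-identityʳ u₂) lt)
    ...     | inj₁ z = inj₁ (trans same (trans w≡e z))
    ...     | inj₂ (_ , J≤) = ⊥-elim (<⇒≱ (class<J i) (subst (_≤ class i) (trans (symm (+-identityʳ j)) jr) J≤))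
  stage (suc r) j α a e jr αr near eq low≤ small = W.run λ a′ w near′ desc eq′ →
      subst (λ n → Realizable n w) (symm β≡)
        (BS.Run.result a′ w near′ desc (trans eq′ (cong tri β≡))
          λ a″ w′ near″ desc′ eq″ →
            stage r (suc j) (16 * α) a″ w′ (trans (symm (+-suc j r)) jr) αr′ near″ eq″ (BS.low-after desc′) (BS.small-after desc′))
    where
    β′ : ℕ
    β′ = 2 * (u₂ * 16 ^ r)
    module W = Window (u₂ * 16 ^ suc r) (u≤ (suc r)) (5β≤T (suc r) α αr) a e near eq low≤
    regroup : ∀ u x → 2 * (u * (16 * x)) ≡ 16 * (2 * (u * x))
    regroup = solve-∀
    β≡ : 2 * (u₂ * 16 ^ suc r) ≡ 16 * β′
    β≡ = regroup u₂ (16 ^ r)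
    regroup′ : ∀ α x → 16 * α * x ≡ α * (16 * x)
    regroup′ = solve-∀
    αr′ : 16 * α * 16 ^ r ≡ h * h
    αr′ = trans (regroup′ α (16 ^ r)) αr
    double : ∀ α → 16 * α ≡ 2 * (8 * α)
    double = solve-∀
    αr″ : 2 * (8 * α) * 16 ^ r ≡ h * h
    αr″ = trans (cong (_* 16 ^ r) (symm (double α))) αr′
    α′≤h² : 2 * (8 * α) ≤ h * h
    α′≤h² = ≤-trans (m≤m*n _ (16 ^ r) {{>-nonZero (16^≢0 r)}}) (≤-reflexive αr″)
    module BS = BlockStage (8 * α) β′ (1≤α r (2 * (8 * α)) αr″) (≤-trans α′≤h² (≤-trans h²≤u (u≤ r))) (u≤ r) (scale r (2 * (8 * α)) αr″)
      α′≤h² j a W.w₀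
      (λ i i≢a → subst (λ n → W.w₀ i < 4 * n ⊎ G ≤ W.w₀ i) β≡ (W.separated i i≢a))
      (subst (λ n → ∑ W.w₀ ≤ 13 * (n * n)) β≡ W.∑w₀≤)
      (small₀ {j} {u₂ * 16 ^ suc r} {u≤ (suc r)} {5β≤T (suc r) α αr} {a} {e} {near} {eq} {low≤} small)

-- Upper bound: from n vertices down to the first stage

module Initial {k : ℕ} (Q T u₂ h J : ℕ) (1≤u₂ : 1 ≤ u₂) (1≤h : 1 ≤ h) (1≤k : 1 ≤ k)
  (k-small : 64 * (64 * k) ≤ 2 * u₂) (T-small : 64 * (2 * T) ≤ 2 * u₂ * (2 * u₂)) (Q-large : 64 * (13 * (16 * 16)) ≤ Q)
  (T-large : 128 * (2 * u₂ * (h * h)) ≤ T) (h²≤u : h * h ≤ 2 * u₂)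
  (class : Fin k → ℕ) (class<J : ∀ i → class i < J)
  (class-count : ∀ j → 8 * ∑ (λ i → 𝟙 (does (class i ≟ j))) ≤ h * h)
  (few : ∀ q → q * T ≤ tri (2 * u₂) → 4 ^ (4 + q) ≤ 2 * u₂) (3≤h : 3 ≤ h) (h≡ : h ≡ 16 ^ J)
  (kG≤ : k * (Q * (2 * T)) ≤ 32 * (2 * (u₂ * 16 ^ J) * (2 * (u₂ * 16 ^ J)))) where

  open Stages {k} Q T u₂ h J 1≤u₂ 1≤h k-small T-small Q-large T-large h²≤u class class<J class-count few
  open ≤-Reasoning

  β : ℕ
  β = 2 * (u₂ * 16 ^ J)

  β≡uh : β ≡ u * h
  β≡uh = trans (symm (*-assoc 2 u₂ (16 ^ J))) (cong (u *_) (symm h≡))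

  u≤β : u ≤ β
  u≤β = u≤ J

  1≤β : 1 ≤ β
  1≤β = ≤-trans 1≤u u≤β

  2≤β : 2 ≤ β
  2≤β = *-monoʳ-≤ 2 (*-mono-≤ 1≤u₂ (16^≢0 J))

  1≤β² : 1 ≤ β * β
  1≤β² = *-mono-≤ 1≤β 1≤β

  11β≤T : 11 * β ≤ T
  11β≤T = begin
    11 * β ≡⟨ cong (11 *_) β≡uh ⟩
    11 * (u * h) ≤⟨ *-mono-≤ (m≤m+n 11 117) (*-monoʳ-≤ u (m≤m*n h h {{>-nonZero 1≤h}})) ⟩
    128 * (u * (h * h)) ≤⟨ T-large ⟩
    T ∎

  64k2T≤β² : 64 * (k * (2 * T)) ≤ β * β
  64k2T≤β² = *-cancelˡ-≤ Q {{>-nonZero 1≤Q}} (begin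
    Q * (64 * (k * (2 * T))) ≡⟨ regroup Q k (2 * T) ⟩
    64 * (k * (Q * (2 * T))) ≤⟨ *-monoʳ-≤ 64 kG≤ ⟩
    64 * (32 * (β * β)) ≡⟨ *-assoc 64 32 (β * β) ⟨
    64 * 32 * (β * β) ≤⟨ *-monoˡ-≤ (β * β) (≤-trans (*-monoʳ-≤ 64 (m≤m+n 32 (13 * (16 * 16) ∸ 32))) Q-large) ⟩
    Q * (β * β) ∎)
    where
    regroup : ∀ Q k t → Q * (64 * (k * t)) ≡ 64 * (k * (Q * t))
    regroup = solve-∀

  -- 45 = 32 + 13: colours below `G` have at most k G ≤ 32β² edges in all, and 13β² bounds the edges
  -- among the last 5β vertices.
  45β²<tri : 45 * (β * β) < tri (10 * β)
  45β²<tri = *-cancelˡ-< 2 _ _ (≤-from 0 (+-mono-≤ (*-monoˡ-≤ (5 * β) 2≤β) 1≤β²′)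
      (trans (regroup β (tri (10 * β))) (trans (cong (_+ 1) (tri-double (10 * β))) (expand β))))
    where
    1≤β²′ : 1 ≤ 5 * (β * β)
    1≤β²′ = ≤-trans 1≤β² (m≤n*m (β * β) 5)
    regroup : ∀ β t → 2 * t + (2 * (5 * β) + 1) ≡ 2 * t + 10 * β + 1
    regroup = solve-∀
    expand : ∀ β → 10 * β * (10 * β) + 1 ≡ suc (2 * (45 * (β * β))) + (β * (5 * β) + 5 * (β * β)) + 0
    expand = solve-∀

  tri[11β]≤ : tri (11 * β) ≤ 61 * (β * β)
  tri[11β]≤ = *-cancelˡ-≤ 2 (≤-trans (2tri≤² (11 * β)) (≤-from (β * β) (z≤n {0}) (regroup β)))
    where
    regroup : ∀ β → 2 * (61 * (β * β)) + 0 ≡ 11 * β * (11 * β) + 0 + β * β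
    regroup = solve-∀

  cap : Demand k → Demand k
  cap e i = if does (e i <? G) then e i else 0

  cap-< : ∀ e i → e i < G → cap e i ≡ e i
  cap-< e i lt rewrite dec-true (e i <? G) lt = refl

  cap≤G : ∀ e i → cap e i ≤ G
  cap≤G e i with e i <? G
  ... | yes lt rewrite dec-true (e i <? G) lt = <⇒≤ lt
  ... | no ≮ rewrite dec-false (e i <? G) ≮ = z≤n

  cap-cong : ∀ e e′ i → e i ≡ e′ i → cap e i ≡ cap e′ i
  cap-cong e e′ i eq = cong (λ t → if does (t <? G) then t else 0) eq

  ∑-cap-sub : ∀ e p x → e p < G → x ≤ e p → ∑ (cap (sub e p x)) + x ≡ ∑ (cap e)
  ∑-cap-sub e p x lt x≤ = trans (cong (_+ x) (∑-cong pointwise)) (∑-sub (cap e) p x (≤-trans x≤ (≡⇒≥ (cap-< e p lt))))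
    where
    cases : ∀ i → Dec (p ≡ i) → cap (sub e p x) i ≡ sub (cap e) p x i
    cases i (no p≢i) = trans (cap-cong (sub e p x) e i (sub-≢ e x p≢i)) (symm (sub-≢ (cap e) x p≢i))
    cases i (yes refl) =
      trans (cap-< (sub e p x) p (≤-trans (s≤s (≤-trans (≤-reflexive (sub-≡ e p x)) (m∸n≤m (e p) x))) lt))
        (trans (sub-≡ e p x) (trans (cong (_∸ x) (symm (cap-< e p lt))) (symm (sub-≡ (cap e) p x))))
    pointwise : ∀ i → cap (sub e p x) i ≡ sub (cap e) p x i
    pointwise i = cases i (p Fin.≟ i)

  -- The block parameter α reaches h² at the last block stage, where covering requires demands of at
  -- least 4α.
  Tame : Demand k → Set
  Tame e = ∀ i → e i ≡ 0 ⊎ 4 * (h * h) ≤ e i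

  a₀ : Fin k
  a₀ = fromℕ< 1≤k

  settled : ∀ d (e : Demand k) → (∀ i → e i < 2 * T ⊎ G ≤ e i) → d + 5 * β ≤ 11 * β → ∑ e ≡ tri (d + 5 * β) → Tame e →
    Realizable (d + 5 * β) e
  settled d e sep top eq tame = realizable-cong (λ i → trans (cong (e i +_) (empty (d + 5 * β) i)) (+-identityʳ _))
      (descend (λ _ → nothing) (λ _ → 0) d a₀ e (λ i _ → sep i) desc-refl (≤-trans top 11β≤T)
        (trans (trans (cong (∑ e +_) (∑-zero (empty (d + 5 * β)))) (+-identityʳ _)) eq)
        (≤-reflexive (∑-zero (empty (d + 5 * β)))) next)
    where
    empty : ∀ m i → 0 + used {k} (λ _ → nothing) m i ≡ 0
    empty m i = used-nothing (λ _ → nothing) m i (λ _ _ → refl)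
    S-term : 64 * ∑ e ≤ Q * (β * β)
    S-term = begin
      64 * ∑ e ≤⟨ *-monoʳ-≤ 64 (≤-trans (≤-reflexive eq) (≤-trans (tri-mono top) tri[11β]≤)) ⟩
      64 * (61 * (β * β)) ≡⟨ *-assoc 64 61 (β * β) ⟨
      64 * 61 * (β * β) ≤⟨ *-monoˡ-≤ (β * β) (≤-trans (*-monoʳ-≤ 64 (m≤m+n 61 (13 * (16 * 16) ∸ 61))) Q-large) ⟩
      Q * (β * β) ∎
    T-term : 64 * (2 * T) ≤ β * β
    T-term = ≤-trans T-small (*-mono-≤ u≤β u≤β)
    β²≤ : β * β ≤ 2 * tri (suc (5 * β))
    β²≤ = ≤-trans (*-mono-≤ (m≤n*m β 5) (m≤n*m β 5)) (²≤2tri-suc (5 * β))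
    open Descent a₀ (2 * T) e (λ i _ → sep i) 0 (5 * β)
      (room (2 * T) (∑ e) 0 (5 * β) (β * β) 1≤β² 64k2T≤β² S-term T-term z≤n β²≤)
    next : ∀ a′ (w : Demand k) → Near a′ w → Desc e w →
      ∑ w + ∑ {k} (λ i → 0 + used (λ _ → nothing) (5 * β) i) ≡ tri (5 * β) →
      Realizable (5 * β) (λ i → w i + (0 + used (λ _ → nothing) (5 * β) i))
    next a′ w near desc eq′ = realizable-cong (λ i → symm (trans (cong (w i +_) (empty (5 * β) i)) (+-identityʳ _)))
      (stage J 0 h a′ w refl (cong (h *_) (symm h≡)) near
        (trans (symm (trans (cong (∑ w +_) (∑-zero (empty (5 * β)))) (+-identityʳ _))) eq′) low≤β² small)
      where
      low≤β² : 16 * ∑ (low w) ≤ β * β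
      low≤β² = begin
        16 * ∑ (low w) ≤⟨ *-mono-≤ (m≤m+n 16 48) (≤-trans (∑-mono (λ i → proj₂ (low≤ w i))) (≤-reflexive (∑-const k (2 * T)))) ⟩
        64 * (k * (2 * T)) ≤⟨ 64k2T≤β² ⟩
        β * β ∎
      small : Small 0 w
      small i lt with desc i
      ... | inj₂ (T≤ , _) = ⊥-elim (<⇒≱ lt (≤-trans 4u≤T T≤))
      ... | inj₁ same with tame i
      ...   | inj₁ z = inj₁ (trans same z)
      ...   | inj₂ ge = inj₂ (≤-trans ge (≡⇒≥ same) , z≤n)

  -- Colours with between 2T and G edges are peeled first; altogether they have too few edges to last.
  settle : ∀ d (e : Demand k) → d + 5 * β ≤ 11 * β → ∑ e ≡ tri (d + 5 * β) → Tame e →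
    ∑ (cap e) + tri (5 * β) < tri (d + 5 * β) → Realizable (d + 5 * β) e
  settle zero e top eq tame lt = ⊥-elim (<⇒≱ lt (m≤n+m _ (∑ (cap e))))
  settle (suc d) e top eq tame lt with Fin.any? (λ i → (2 * T ≤? e i) ×-dec (e i <? G))
  ... | no none = settled (suc d) e sep top eq tame
    where
    sep : ∀ i → e i < 2 * T ⊎ G ≤ e i
    sep i with 2 * T ≤? e i
    ... | no ≰ = inj₁ (≰⇒> ≰)
    ... | yes le = inj₂ (≮⇒≥ (λ e<G → none (i , le , e<G)))
  ... | yes (p , 2T≤ , <G) = peel p m≤ (settle d (sub e p m) (≤-trans (n≤1+n _) top) eq′ tame′ lt′)
    where
    m : ℕ
    m = d + 5 * β
    m≤T : m ≤ T
    m≤T = ≤-trans (≤-trans (n≤1+n _) top) 11β≤T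
    m≤ : m ≤ e p
    m≤ = ≤-trans m≤T (≤-trans (m≤n*m T 2) 2T≤)
    eq′ : ∑ (sub e p m) ≡ tri m
    eq′ = +-cancelʳ-≡ m _ _ (trans (∑-sub e p m m≤) (trans eq (+-comm m _)))
    lt′ : ∑ (cap (sub e p m)) + tri (5 * β) < tri m
    lt′ = +-cancelʳ-< m _ _ (begin-strict
      ∑ (cap (sub e p m)) + tri (5 * β) + m ≡⟨ +-swapʳ (∑ (cap (sub e p m))) (tri (5 * β)) m ⟩
      ∑ (cap (sub e p m)) + m + tri (5 * β) ≡⟨ cong (_+ tri (5 * β)) (∑-cap-sub e p m <G m≤) ⟩
      ∑ (cap e) + tri (5 * β) <⟨ lt ⟩
      m + tri m ≡⟨ +-comm m (tri m) ⟩
      tri m + m ∎)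
    4h²≤T : 4 * (h * h) ≤ T
    4h²≤T = ≤-trans (*-monoʳ-≤ 4 h²≤u) 4u≤T
    tame′ : Tame (sub e p m)
    tame′ i with desc-sub e p m 2T≤ m≤T i
    ... | inj₂ (T≤ , _) = inj₂ (≤-trans 4h²≤T T≤)
    ... | inj₁ same = subst (λ t → t ≡ 0 ⊎ 4 * (h * h) ≤ t) (symm same) (tame i)

  40hβk≤β² : k * (40 * h * β) ≤ β * β
  40hβk≤β² = begin
    k * (40 * h * β) ≡⟨ regroup k h β ⟩
    40 * k * h * β ≤⟨ *-monoˡ-≤ β (*-monoˡ-≤ h (≤-trans (≤-trans (*-monoˡ-≤ k (m≤m+n 40 24)) (m≤n*m (64 * k) 64)) k-small)) ⟩
    u * h * β ≡⟨ cong (_* β) β≡uh ⟨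
    β * β ∎
    where
    regroup : ∀ k h β → k * (40 * h * β) ≡ 40 * k * h * β
    regroup = solve-∀

  3hk≤β : k * (3 * h) ≤ β
  3hk≤β = begin
    k * (3 * h) ≡⟨ regroup k h ⟩
    3 * k * h ≤⟨ *-monoˡ-≤ h (≤-trans (≤-trans (*-monoˡ-≤ k (m≤m+n 3 61)) (m≤n*m (64 * k) 64)) k-small) ⟩
    u * h ≡⟨ β≡uh ⟨
    β ∎
    where
    regroup : ∀ k h → k * (3 * h) ≡ 3 * k * h
    regroup = solve-∀

  h≤β : h ≤ β
  h≤β = ≤-trans (m≤n*m h u {{>-nonZero 1≤u}}) (≡⇒≥ β≡uh)

  4h²≤tri : 4 * (h * h) ≤ tri (3 * h)
  4h²≤tri = *-cancelˡ-≤ 2 (≤-from 0 (*-monoˡ-≤ h 3≤h) (trans (tri-double (3 * h)) (regroup h)))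
    where
    regroup : ∀ h → 3 * h * (3 * h) ≡ 2 * (4 * (h * h)) + h * h + 0
    regroup = solve-∀

  -- `L` lists the colours not yet inspected. A colour below 4h² ≤ tri (3h) is eliminated in a block
  -- of 3h vertices; k such blocks fit between 10β and 11β. By averaging, some colour has more than
  -- 40hβ edges, and after paying for the block it still has 4h², so no new tiny colour arises.
  tiny : ∀ L m (e : Demand k) → 10 * β + length L * (3 * h) ≤ m → m ≤ 11 * β → ∑ e ≡ tri m →
    (∀ i → i ∉ L → e i ≡ 0 ⊎ 4 * (h * h) ≤ e i) → Realizable m e
  tiny [] m e lo hi eq tame = subst (λ n → Realizable n e) (proj₂ split)
      (settle (proj₁ split) e (≤-trans (≤-reflexive (proj₂ split)) hi) (trans eq (cong tri (symm (proj₂ split))))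
        (λ i → tame i λ ()) (subst (λ n → ∑ (cap e) + tri (5 * β) < tri n) (symm (proj₂ split)) lt))
    where
    10β≤m : 10 * β ≤ m
    10β≤m = ≤-trans (m≤m+n _ 0) lo
    split : ∃ λ d → d + 5 * β ≡ m
    split = m ∸ 5 * β , m∸n+n≡m (≤-trans (*-monoˡ-≤ β (m≤m+n 5 5)) 10β≤m)
    lt : ∑ (cap e) + tri (5 * β) < tri m
    lt = begin-strict
      ∑ (cap e) + tri (5 * β) ≤⟨ +-mono-≤ (≤-trans (∑-mono (cap≤G e)) (≤-reflexive (∑-const k G))) (tri[5β]≤ β) ⟩
      k * G + 13 * (β * β) ≤⟨ +-monoˡ-≤ (13 * (β * β)) kG≤ ⟩
      32 * (β * β) + 13 * (β * β) ≡⟨ *-distribʳ-+ (β * β) 32 13 ⟨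
      45 * (β * β) <⟨ 45β²<tri ⟩
      tri (10 * β) ≤⟨ tri-mono 10β≤m ⟩
      tri m ∎
  tiny (i ∷ L) m e lo hi eq tame with (e i ≟ 0) ⊎-dec (4 * (h * h) ≤? e i)
  ... | yes ok = tiny L m e (≤-trans (+-monoʳ-≤ (10 * β) (m≤n+m _ (3 * h))) lo) hi eq tame′
    where
    tame′ : ∀ j → j ∉ L → e j ≡ 0 ⊎ 4 * (h * h) ≤ e j
    tame′ j j∉ with j Fin.≟ i
    ... | yes refl = ok
    ... | no j≢i = tame j (λ { (here e) → j≢i e ; (there j∈) → j∉ j∈ })
  ... | no bad = remove (∑-large e (40 * h * β) c<)
    where
    b m″ : ℕ
    b = 3 * h
    m″ = m ∸ b
    10β≤m : 10 * β ≤ m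
    10β≤m = ≤-trans (m≤m+n _ _) lo
    c< : k * (40 * h * β) < ∑ e
    c< = begin-strict
      k * (40 * h * β) ≤⟨ 40hβk≤β² ⟩
      β * β ≤⟨ m≤n*m (β * β) 45 ⟩
      45 * (β * β) <⟨ 45β²<tri ⟩
      tri (10 * β) ≤⟨ tri-mono 10β≤m ⟩
      tri m ≡⟨ eq ⟨
      ∑ e ∎
    ei< : e i < 4 * (h * h)
    ei< = ≰⇒> (λ le → bad (inj₂ le))
    b≤m : b ≤ m
    b≤m = ≤-trans (≤-trans (m≤m+n b (length L * b)) (m≤n+m _ (10 * β))) lo
    b+m″ : b + m″ ≡ m
    b+m″ = m+[n∸m]≡n b≤m
    lo″ : 10 * β + length L * b ≤ m″
    lo″ = m+n≤o⇒m≤o∸n _ (≤-trans (≤-reflexive (regroup (10 * β) (length L * b) b)) lo)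
      where
      regroup : ∀ x y z → x + y + z ≡ x + (z + y)
      regroup = solve-∀
    spent : b * m″ + tri b + 4 * (h * h) ≤ 40 * h * β
    spent = begin
      b * m″ + tri b + 4 * (h * h) ≤⟨ +-monoˡ-≤ (4 * (h * h)) (+-monoʳ-≤ (b * m″) (≤-trans (m≤n*m (tri b) 2) (2tri≤² b))) ⟩
      b * m″ + b * b + 4 * (h * h) ≡⟨ cong (_+ 4 * (h * h)) (trans (symm (*-distribˡ-+ b m″ b)) (cong (b *_) (trans (+-comm m″ b) b+m″))) ⟩
      b * m + 4 * (h * h) ≤⟨ +-mono-≤ (*-monoʳ-≤ b hi) (*-monoʳ-≤ 4 (*-monoʳ-≤ h h≤β)) ⟩
      3 * h * (11 * β) + 4 * (h * β) ≤⟨ ≤-from (3 * (h * β)) (z≤n {0}) (collect h β) ⟩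
      40 * h * β ∎
      where
      collect : ∀ h β → 40 * h * β + 0 ≡ 3 * h * (11 * β) + 4 * (h * β) + 0 + 3 * (h * β)
      collect = solve-∀
    remove : (∃ λ p → 40 * h * β < e p) → Realizable m e
    remove (p , big) =
      let (e″ , other , zero-i , loss , _ , total , realize) =
            eliminate {m = m″} e i p b p≢i (≤-trans (<⇒≤ ei<) 4h²≤tri) (≤-trans (m≤m+n _ _) (≤-trans spent (<⇒≤ big)))
      in subst (λ n → Realizable n e) b+m″
           (realize (next e″ other zero-i loss (total (trans eq (cong tri (symm b+m″))))))
      where
      p≢i : p ≢ i
      p≢i refl = <⇒≱ ei< (≤-trans (≤-trans (m≤n+m (4 * (h * h)) (b * m″ + tri b)) spent) (<⇒≤ big))
      next : ∀ e″ → (∀ j → j ≢ i → j ≢ p → e″ j ≡ e j) → e″ i ≡ 0 → e p ≤ e″ p + (b * m″ + tri b) → ∑ e″ ≡ tri m″ →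
        Realizable m″ e″
      next e″ other zero-i loss eq″ = tiny L m″ e″ lo″ (≤-trans (m∸n≤m m b) hi) eq″ tame″
        where
        p-big : 4 * (h * h) ≤ e″ p
        p-big = +-cancelʳ-≤ (b * m″ + tri b) _ _
          (≤-trans (≤-reflexive (+-comm (4 * (h * h)) _)) (≤-trans spent (≤-trans (<⇒≤ big) loss)))
        tame″ : ∀ j → j ∉ L → e″ j ≡ 0 ⊎ 4 * (h * h) ≤ e″ j
        tame″ j j∉ with j Fin.≟ i
        ... | yes refl = inj₁ zero-i
        ... | no j≢i with j Fin.≟ p
        ...   | yes refl = inj₂ p-big
        ...   | no j≢p = subst (λ t → t ≡ 0 ⊎ 4 * (h * h) ≤ t) (symm (other j j≢i j≢p))
                  (tame j (λ { (here e) → j≢i e ; (there j∈) → j∉ j∈ }))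

  -- Above 11β vertices `k * m < tri (suc m)`, so some colour has more than `m` edges and one vertex
  -- can be peeled in it.
  realize : ∀ d (e : Demand k) → ∑ e ≡ tri (d + 11 * β) → Realizable (d + 11 * β) e
  realize zero e eq = tiny (allFin k) (11 * β) e enough ≤-refl eq (λ i i∉ → ⊥-elim (i∉ (∈-allFin i)))
    where
    length-all : length (allFin k) ≡ k
    length-all = length-tabulate {n = k} id
    enough : 10 * β + length (allFin k) * (3 * h) ≤ 11 * β
    enough = begin
      10 * β + length (allFin k) * (3 * h) ≡⟨ cong (λ t → 10 * β + t * (3 * h)) length-all ⟩
      10 * β + k * (3 * h) ≤⟨ +-monoʳ-≤ (10 * β) 3hk≤β ⟩
      10 * β + β ≡⟨ +-comm (10 * β) β ⟩
      11 * β ∎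
  realize (suc d) e eq with ∑-large e (d + 11 * β) k*m<
    where
    m : ℕ
    m = d + 11 * β
    2k<m : 2 * k < m
    2k<m = begin-strict
      2 * k <⟨ m<m+n (2 * k) (*-mono-≤ {1} {62} (s≤s z≤n) 1≤k) ⟩
      2 * k + 62 * k ≡⟨ *-distribʳ-+ k 2 62 ⟨
      64 * k ≤⟨ m≤n*m (64 * k) 64 ⟩
      64 * (64 * k) ≤⟨ k-small ⟩
      u ≤⟨ u≤β ⟩
      β ≤⟨ m≤n*m β 11 ⟩
      11 * β ≤⟨ m≤n+m (11 * β) d ⟩
      m ∎
    k*m< : k * m < ∑ e
    k*m< = *-cancelˡ-< 2 _ _ (begin-strict
      2 * (k * m) ≡⟨ *-assoc 2 k m ⟨
      2 * k * m <⟨ *-monoˡ-< m {{>-nonZero (≤-trans (s≤s z≤n) 2k<m)}} 2k<m ⟩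
      m * m ≤⟨ ²≤2tri-suc m ⟩
      2 * tri (suc m) ≡⟨ cong (2 *_) eq ⟨
      2 * ∑ e ∎)
  ... | p , lt = peel p (<⇒≤ lt) (realize d (sub e p (d + 11 * β))
          (+-cancelʳ-≡ (d + 11 * β) _ _ (trans (∑-sub e p (d + 11 * β) (<⇒≤ lt)) (trans eq (+-comm (d + 11 * β) _)))))

  gallaiProperty : GallaiProperty k (11 * β)
  gallaiProperty n le e eq = subst (λ m → Realizable m e) (m∸n+n≡m le)
    (realize (n ∸ 11 * β) e (trans (symm (∑-tabulate e)) (trans eq (trans (tri-C n) (cong tri (symm (m∸n+n≡m le)))))))

-- Upper bound: choice of the parameters

-- The indicator of the interval [lo, lo + K), recursive so that its sum over `Fin n` is bounded by
-- induction.
inInterval : ℕ → ℕ → ℕ → ℕ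
inInterval zero     zero    x       = 0
inInterval zero     (suc K) zero    = 1
inInterval zero     (suc K) (suc x) = inInterval zero K x
inInterval (suc lo) K       zero    = 0
inInterval (suc lo) K       (suc x) = inInterval lo K x

inInterval-hit : ∀ lo K x → lo ≤ x → x < lo + K → 1 ≤ inInterval lo K x
inInterval-hit zero     (suc K) zero    _         _         = ≤-refl
inInterval-hit zero     (suc K) (suc x) _         (s≤s hi)  = inInterval-hit zero K x z≤n hi
inInterval-hit (suc lo) K       (suc x) (s≤s le)  (s≤s hi)  = inInterval-hit lo K x le hi

∑-inInterval : ∀ n lo K → ∑ {n} (inInterval lo K ∘ toℕ) ≤ K
∑-inInterval zero    lo       K       = z≤n
∑-inInterval (suc n) zero     zero    = ≤-reflexive (∑-zero {suc n} (λ i → empty (toℕ i)))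
  where
  empty : ∀ x → inInterval zero zero x ≡ 0
  empty x = refl
∑-inInterval (suc n) zero     (suc K) = s≤s (∑-inInterval n zero K)
∑-inInterval (suc n) (suc lo) K       = ∑-inInterval n lo K

∑-quotient : ∀ n K .{{_ : NonZero K}} j → ∑ {n} (λ i → 𝟙 (does (toℕ i / K ≟ j))) ≤ K
∑-quotient n K j = ≤-trans (∑-mono (pointwise j)) (∑-inInterval n (j * K) K)
  where
  open ≤-Reasoning
  pointwise : ∀ j (i : Fin n) → 𝟙 (does (toℕ i / K ≟ j)) ≤ inInterval (j * K) K (toℕ i)
  pointwise j i with toℕ i / K ≟ j
  ... | no ≢ rewrite dec-false (toℕ i / K ≟ j) ≢ = z≤n
  ... | yes refl = ≤-trans (𝟙≤1 _) (inInterval-hit (toℕ i / K * K) K (toℕ i)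
          (≤-trans (m≤n+m _ (toℕ i % K)) (≡⇒≥ (m≡m%n+[m/n]*n (toℕ i) K)))
          (begin-strict
            toℕ i ≡⟨ m≡m%n+[m/n]*n (toℕ i) K ⟩
            toℕ i % K + toℕ i / K * K <⟨ +-monoˡ-< (toℕ i / K * K) (m%n<n (toℕ i) K) ⟩
            K + toℕ i / K * K ≡⟨ +-comm K _ ⟩
            toℕ i / K * K + K ∎))

n²≤2^n : ∀ n → 4 ≤ n → n * n ≤ 2 ^ n
n²≤2^n n 4≤n with m≤n⇒∃[o]m+o≡n 4≤n
... | d , refl = go d
  where
  open ≤-Reasoning
  go : ∀ d → (4 + d) * (4 + d) ≤ 2 ^ (4 + d)
  go zero = ≤-refl
  go (suc d) = begin
    (5 + d) * (5 + d) ≤⟨ ≤-from (7 + 6 * d + d * d) (z≤n {0}) (expand d) ⟩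
    2 * ((4 + d) * (4 + d)) ≤⟨ *-monoʳ-≤ 2 (go d) ⟩
    2 * 2 ^ (4 + d) ∎
    where
    expand : ∀ d → 2 * ((4 + d) * (4 + d)) + 0 ≡ (5 + d) * (5 + d) + 0 + (7 + 6 * d + d * d)
    expand = solve-∀

256^≡ : ∀ J → 256 ^ J ≡ 16 ^ J * 16 ^ J
256^≡ zero    = refl
256^≡ (suc J) = trans (cong (256 *_) (256^≡ J)) (regroup (16 ^ J))
  where
  regroup : ∀ x → 256 * (x * x) ≡ 16 * x * (16 * x)
  regroup = solve-∀

256^≡2^ : ∀ J → 256 ^ J ≡ 2 ^ (8 * J)
256^≡2^ J = ^-*-assoc 2 8 J

module UpperBound (Q k L : ℕ) (Q-large : 64 * (13 * (16 * 16)) ≤ Q) (L-large : 2048 * 256 ≤ L)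
  (2^L≤k : 2 ^ L ≤ k) where

  open ≤-Reasoning

  512≤Q : 512 ≤ Q
  512≤Q = ≤-trans (m≤m+n 512 (64 * (13 * (16 * 16)) ∸ 512)) Q-large

  1≤Q : 1 ≤ Q
  1≤Q = ≤-trans (m≤m+n 1 511) 512≤Q

  1≤k : 1 ≤ k
  1≤k = ≤-trans (m^n>0 2 L) 2^L≤k

  9≤L : 9 ≤ L
  9≤L = ≤-trans (m≤m+n 9 (2048 * 256 ∸ 9)) L-large

  L<Qk : L < Q * k
  L<Qk = ≤-trans (n<2^n L) (≤-trans 2^L≤k (m≤n*m k Q {{>-nonZero 1≤Q}}))

  -- Powers of 256 because h = 16 ^ J must have a square of order Q k / L; one step of the exponent
  -- costs a factor 256.
  choice : ∃ λ J → 256 ^ J * L < Q * k × ¬ (256 ^ suc J * L < Q * k)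
  choice = last-true (λ J → 256 ^ J * L <? Q * k) (≤-trans (s≤s (≤-reflexive (*-identityˡ L))) L<Qk) (Q * k)
    λ lt → <⇒≱ lt (begin
      Q * k ≤⟨ <⇒≤ (n<2^n (Q * k)) ⟩
      2 ^ (Q * k) ≤⟨ ^-monoˡ-≤ (Q * k) (m≤m+n 2 254) ⟩
      256 ^ (Q * k) ≤⟨ m≤m*n (256 ^ (Q * k)) L {{>-nonZero (≤-trans (s≤s z≤n) 9≤L)}} ⟩
      256 ^ (Q * k) * L ∎)

  module Chosen (J₀ : ℕ) (J₀-small : 256 ^ J₀ * L < Q * k) (J-large : Q * k ≤ 256 ^ suc J₀ * L) where

    -- `T` takes the least value permitted by `T-large`. `K` is h² / 8, the size of a class, and β =
    -- u h is the scale of the first stage.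
    J h K u₂ u T β : ℕ
    J = suc J₀
    h = 16 ^ J
    K = 32 * 256 ^ J₀
    u₂ = 4 * (Q * k)
    u = 2 * u₂
    T = 128 * (u * (h * h))
    β = 2 * (u₂ * 16 ^ J)

    h² : h * h ≡ 256 ^ J
    h² = symm (256^≡ J)

    u≡ : u ≡ 8 * (Q * k)
    u≡ = symm (*-assoc 2 4 (Q * k))

    h²L≥ : Q * k ≤ h * h * L
    h²L≥ = ≤-trans J-large (≤-reflexive (cong (_* L) (symm h²)))

    h²L≤ : h * h * L ≤ 256 * (Q * k)
    h²L≤ = begin
      h * h * L ≡⟨ cong (_* L) h² ⟩
      256 * 256 ^ J₀ * L ≡⟨ *-assoc 256 (256 ^ J₀) L ⟩
      256 * (256 ^ J₀ * L) ≤⟨ *-monoʳ-≤ 256 (<⇒≤ J₀-small) ⟩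
      256 * (Q * k) ∎

    -- For `u` = 8Qk this amounts to `T-small`, as 64 · 2 · 128 = 8 · 2048. The threshold 2048 * 256
    -- for `L` comes from here.
    2048h²≤Qk : 2048 * (h * h) ≤ Q * k
    2048h²≤Qk = *-cancelʳ-≤ _ _ L {{>-nonZero (≤-trans (s≤s z≤n) 9≤L)}} (begin
      2048 * (h * h) * L ≡⟨ *-assoc 2048 (h * h) L ⟩
      2048 * (h * h * L) ≤⟨ *-monoʳ-≤ 2048 h²L≤ ⟩
      2048 * (256 * (Q * k)) ≡⟨ *-assoc 2048 256 (Q * k) ⟨
      2048 * 256 * (Q * k) ≤⟨ *-monoˡ-≤ (Q * k) L-large ⟩
      L * (Q * k) ≡⟨ *-comm L (Q * k) ⟩
      Q * k * L ∎)

    1≤h : 1 ≤ h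
    1≤h = m^n>0 16 J

    16≤h : 16 ≤ h
    16≤h = *-monoʳ-≤ 16 (m^n>0 16 J₀)

    1≤Qk : 1 ≤ Q * k
    1≤Qk = *-mono-≤ 1≤Q 1≤k

    1≤u₂ : 1 ≤ u₂
    1≤u₂ = ≤-trans 1≤Qk (m≤n*m (Q * k) 4)

    k-small : 64 * (64 * k) ≤ u
    k-small = begin
      64 * (64 * k) ≡⟨ regroup k ⟩
      8 * (512 * k) ≤⟨ *-monoʳ-≤ 8 (*-monoˡ-≤ k 512≤Q) ⟩
      8 * (Q * k) ≡⟨ u≡ ⟨
      u ∎
      where
      regroup : ∀ k → 64 * (64 * k) ≡ 8 * (512 * k)
      regroup = solve-∀

    h²≤u : h * h ≤ u
    h²≤u = begin
      h * h ≤⟨ m≤n*m (h * h) 2048 ⟩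
      2048 * (h * h) ≤⟨ 2048h²≤Qk ⟩
      Q * k ≤⟨ m≤n*m (Q * k) 8 ⟩
      8 * (Q * k) ≡⟨ u≡ ⟨
      u ∎

    T-small : 64 * (2 * T) ≤ u * u
    T-small = begin
      64 * (2 * (128 * (u * (h * h)))) ≡⟨ regroup u (h * h) 2048 8 64 128 refl ⟩
      u * (8 * (2048 * (h * h))) ≤⟨ *-monoʳ-≤ u (≤-trans (*-monoʳ-≤ 8 2048h²≤Qk) (≡⇒≥ u≡)) ⟩
      u * u ∎
      where
      regroup : ∀ u x a b c d → c * (2 * d) ≡ b * a → c * (2 * (d * (u * x))) ≡ u * (b * (a * x))
      regroup u x a b c d eq = trans (step u x c d) (trans (cong (λ t → t * (u * x)) eq) (step′ u x a b))
        where
        step : ∀ u x c d → c * (2 * (d * (u * x))) ≡ c * (2 * d) * (u * x)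
        step = solve-∀
        step′ : ∀ u x a b → b * a * (u * x) ≡ u * (b * (a * x))
        step′ = solve-∀

    -- From 2 ^ L ≤ k ≤ 256 ^ J · L by squaring, since L² ≤ 2 ^ L absorbs the factor L². The number
    -- of stages is thus at least of order log k.
    L≤16J : L ≤ 16 * J
    L≤16J = ≮⇒≥ λ lt → <⇒≱ (^-monoʳ-< 2 (m≤m+n 2 0) lt) (*-cancelˡ-≤ (2 ^ L) {{>-nonZero (m^n>0 2 L)}} (begin
      2 ^ L * 2 ^ L ≤⟨ *-mono-≤ 2^L≤ 2^L≤ ⟩
      h * h * L * (h * h * L) ≡⟨ regroup (h * h) L ⟩
      h * h * (h * h) * (L * L) ≤⟨ *-monoʳ-≤ (h * h * (h * h)) (n²≤2^n L (≤-trans (m≤m+n 4 5) 9≤L)) ⟩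
      h * h * (h * h) * 2 ^ L ≡⟨ cong (_* 2 ^ L) h⁴ ⟩
      2 ^ (16 * J) * 2 ^ L ≡⟨ *-comm (2 ^ (16 * J)) (2 ^ L) ⟩
      2 ^ L * 2 ^ (16 * J) ∎))
      where
      2^L≤ : 2 ^ L ≤ h * h * L
      2^L≤ = ≤-trans 2^L≤k (≤-trans (m≤n*m k Q {{>-nonZero 1≤Q}}) h²L≥)
      regroup : ∀ x L → x * L * (x * L) ≡ x * x * (L * L)
      regroup = solve-∀
      h⁴ : h * h * (h * h) ≡ 2 ^ (16 * J)
      h⁴ = trans (cong (λ t → t * t) (trans h² (256^≡2^ J)))
        (trans (symm (^-distribˡ-+-* 2 (8 * J) (8 * J))) (cong (2 ^_) (symm (*-distribʳ-+ J 8 8))))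

    instance
      K≢0 : NonZero K
      K≢0 = m*n≢0 32 (256 ^ J₀) {{_}} {{m^n≢0 256 J₀}}

    8K≡h² : 8 * K ≡ h * h
    8K≡h² = trans (symm (*-assoc 8 32 (256 ^ J₀))) (symm h²)

    -- Here the logarithmic number of stages pays off: Q k ≤ h² L ≤ 8K · 16J, so J classes of size K
    -- hold all colours.
    k≤JK : k ≤ J * K
    k≤JK = *-cancelˡ-≤ 512 (begin
      512 * k ≤⟨ *-monoˡ-≤ k 512≤Q ⟩
      Q * k ≤⟨ h²L≥ ⟩
      h * h * L ≤⟨ *-mono-≤ (≡⇒≥ 8K≡h²) L≤16J ⟩
      8 * K * (16 * J) ≡⟨ regroup 8 16 J K ⟩
      8 * 16 * (J * K) ≤⟨ *-monoˡ-≤ (J * K) (m≤m+n (8 * 16) 384) ⟩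
      512 * (J * K) ∎)
      where
      regroup : ∀ a b J K → a * K * (b * J) ≡ a * b * (J * K)
      regroup = solve-∀

    class : Fin k → ℕ
    class i = toℕ i / K

    class<J : ∀ i → class i < J
    class<J i = *-cancelʳ-< K (class i) J (begin-strict
      class i * K ≤⟨ m≤n+m _ (toℕ i % K) ⟩
      toℕ i % K + class i * K ≡⟨ m≡m%n+[m/n]*n (toℕ i) K ⟨
      toℕ i <⟨ Fin.toℕ<n i ⟩
      k ≤⟨ k≤JK ⟩
      J * K ∎)

    class-count : ∀ j → 8 * ∑ (λ i → 𝟙 (does (class i ≟ j))) ≤ h * h
    class-count j = ≤-trans (*-monoʳ-≤ 8 (∑-quotient k K j)) (≤-reflexive 8K≡h²)

    -- Since tri u ≤ u², q colours of `T` edges need 128 q h² ≤ u ≤ 8 h² L, that is 16 q ≤ L. Then 4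
    -- ^ (4 + q) ≤ 2 ^ L ≤ k.
    few : ∀ q → q * T ≤ tri u → 4 ^ (4 + q) ≤ u
    few q qT≤ = begin
      4 ^ (4 + q) ≡⟨ ^-*-assoc 2 2 (4 + q) ⟩
      2 ^ (2 * (4 + q)) ≤⟨ ^-monoʳ-≤ 2 exponent ⟩
      2 ^ L ≤⟨ 2^L≤k ⟩
      k ≤⟨ m≤n*m k Q {{>-nonZero 1≤Q}} ⟩
      Q * k ≤⟨ m≤n*m (Q * k) 8 ⟩
      8 * (Q * k) ≡⟨ u≡ ⟨
      u ∎
      where
      1≤u : 1 ≤ u
      1≤u = ≤-trans 1≤u₂ (m≤n*m u₂ 2)
      qh² : q * (128 * (h * h)) ≤ 8 * (h * h * L)
      qh² = *-cancelˡ-≤ u {{>-nonZero 1≤u}} (begin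
        u * (q * (128 * (h * h))) ≡⟨ regroup u q 128 (h * h) ⟩
        q * (128 * (u * (h * h))) ≤⟨ qT≤ ⟩
        tri u ≤⟨ m≤n*m (tri u) 2 ⟩
        2 * tri u ≤⟨ 2tri≤² u ⟩
        u * u ≤⟨ *-monoʳ-≤ u (≤-trans (≤-reflexive u≡) (*-monoʳ-≤ 8 h²L≥)) ⟩
        u * (8 * (h * h * L)) ∎)
        where
        regroup : ∀ u q c x → u * (q * (c * x)) ≡ q * (c * (u * x))
        regroup = solve-∀
      16q≤L : 16 * q ≤ L
      16q≤L = *-cancelˡ-≤ 8 (*-cancelˡ-≤ (h * h) {{>-nonZero (*-mono-≤ 1≤h 1≤h)}} (begin
        h * h * (8 * (16 * q)) ≡⟨ regroup (h * h) q 8 16 ⟩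
        q * (8 * 16 * (h * h)) ≤⟨ qh² ⟩
        8 * (h * h * L) ≡⟨ regroup′ 8 (h * h) L ⟩
        h * h * (8 * L) ∎))
        where
        regroup : ∀ x q a b → x * (a * (b * q)) ≡ q * (a * b * x)
        regroup = solve-∀
        regroup′ : ∀ a x L → a * (x * L) ≡ x * (a * L)
        regroup′ = solve-∀
      16≤L : 16 ≤ L
      16≤L = ≤-trans (m≤m+n 16 (2048 * 256 ∸ 16)) L-large
      exponent : 2 * (4 + q) ≤ L
      exponent = *-cancelˡ-≤ 8 (begin
        8 * (2 * (4 + q)) ≡⟨ regroup q ⟩
        4 * 16 + 16 * q ≤⟨ +-mono-≤ (*-monoʳ-≤ 4 16≤L) 16q≤L ⟩
        4 * L + L ≤⟨ ≤-from (3 * L) (z≤n {0}) (collect L) ⟩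
        8 * L ∎)
        where
        regroup : ∀ q → 8 * (2 * (4 + q)) ≡ 4 * 16 + 16 * q
        regroup = solve-∀
        collect : ∀ L → 8 * L + 0 ≡ 4 * L + L + 0 + 3 * L
        collect = solve-∀

    β≡uh : β ≡ u * h
    β≡uh = symm (*-assoc 2 u₂ (16 ^ J))

    kG≤ : k * (Q * (2 * T)) ≤ 32 * (β * β)
    kG≤ = ≤-reflexive (begin-equality
      k * (Q * (2 * (128 * (u * (h * h))))) ≡⟨ regroup k Q 128 u (h * h) ⟩
      2 * 128 * (Q * k) * (u * (h * h)) ≡⟨ cong (_* (u * (h * h))) (*-assoc 32 8 (Q * k)) ⟩
      32 * (8 * (Q * k)) * (u * (h * h)) ≡⟨ cong (λ t → 32 * t * (u * (h * h))) u≡ ⟨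
      32 * u * (u * (h * h)) ≡⟨ regroup′ 32 u h ⟩
      32 * (u * h * (u * h)) ≡⟨ cong (λ t → 32 * (t * t)) β≡uh ⟨
      32 * (β * β) ∎)
      where
      regroup : ∀ k Q c u x → k * (Q * (2 * (c * (u * x)))) ≡ 2 * c * (Q * k) * (u * x)
      regroup = solve-∀
      regroup′ : ∀ c u h → c * u * (u * (h * h)) ≡ c * (u * h * (u * h))
      regroup′ = solve-∀

    property : GallaiProperty k (11 * β)
    property = Initial.gallaiProperty Q T u₂ h J 1≤u₂ 1≤h 1≤k k-small T-small Q-large ≤-refl h²≤u
      class class<J class-count few (≤-trans (m≤m+n 3 13) 16≤h) refl kG≤

    -- β² L = u² · h² L, where `u` and h² L are both of order Q k.
    size : 11 * β * (11 * β) * L ≤ 11 * 8 * (11 * 8) * 256 * (Q * Q * Q) * (k * k * k)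
    size = begin
      11 * β * (11 * β) * L ≡⟨ cong (λ t → 11 * t * (11 * t) * L) (trans β≡uh (cong (_* h) u≡)) ⟩
      11 * (8 * (Q * k) * h) * (11 * (8 * (Q * k) * h)) * L ≡⟨ regroup 11 8 (Q * k) h L ⟩
      11 * 8 * (11 * 8) * (Q * k * (Q * k)) * (h * h * L) ≤⟨ *-monoʳ-≤ (11 * 8 * (11 * 8) * (Q * k * (Q * k))) h²L≤ ⟩
      11 * 8 * (11 * 8) * (Q * k * (Q * k)) * (256 * (Q * k)) ≡⟨ regroup′ (11 * 8 * (11 * 8)) 256 Q k ⟩
      11 * 8 * (11 * 8) * 256 * (Q * Q * Q) * (k * k * k) ∎
      where
      regroup : ∀ a b x h L → a * (b * x * h) * (a * (b * x * h)) * L ≡ a * b * (a * b) * (x * x) * (h * h * L)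
      regroup = solve-∀
      regroup′ : ∀ a c Q k → a * (Q * k * (Q * k)) * (c * (Q * k)) ≡ a * c * (Q * Q * Q) * (k * k * k)
      regroup′ = solve-∀

  result : ∃ λ N → GallaiProperty k N × N * N * L ≤ 11 * 8 * (11 * 8) * 256 * (Q * Q * Q) * (k * k * k)
  result = build choice
    where
    build : (∃ λ J → 256 ^ J * L < Q * k × ¬ (256 ^ suc J * L < Q * k)) →
      ∃ λ N → GallaiProperty k N × N * N * L ≤ 11 * 8 * (11 * 8) * 256 * (Q * Q * Q) * (k * k * k)
    build (J₀ , small , large) = 11 * β , property , size
      where open Chosen J₀ small (≮⇒≥ large)

-- Combining the two bounds

order-of-g : ∀ Q a → 64 * (13 * (16 * 16)) ≤ Q → 2048 * 256 ≤ a → 20 ≤ a →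
  ∃[ C ] ∃[ k₀ ] ((k : ℕ) → k₀ ≤ k →
    ∃[ g ] (IsG k g × (k ^ 3 ≤ C * (g ^ 2 * ⌊log₂ k ⌋))
                    × (g ^ 2 * ⌊log₂ k ⌋ ≤ C * k ^ 3)))
order-of-g Q a Q-large a-large 20≤a = C₁ + C₂ , 2 ^ a , bounds
  where
  C₁ C₂ : ℕ
  C₁ = 32 * 32 * 32 * 3
  C₂ = 11 * 8 * (11 * 8) * 256 * (Q * Q * Q)
  open ≤-Reasoning
  combine : ∀ k g N L → g ≤ N → N * N * L ≤ C₂ * (k * k * k) → g ^ 2 * L ≤ (C₁ + C₂) * k ^ 3
  combine k g N L g≤N size = begin
    g * (g * 1) * L ≡⟨ cong (λ t → g * t * L) (*-identityʳ g) ⟩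
    g * g * L ≤⟨ *-monoˡ-≤ L (*-mono-≤ g≤N g≤N) ⟩
    N * N * L ≤⟨ size ⟩
    C₂ * (k * k * k) ≡⟨ cong (C₂ *_) (cube k) ⟩
    C₂ * k ^ 3 ≤⟨ *-monoˡ-≤ (k ^ 3) (m≤n+m C₂ C₁) ⟩
    (C₁ + C₂) * k ^ 3 ∎
  assemble : ∀ k → 1 ≤ k → a ≤ ⌊log₂ k ⌋ → ∀ N → N * N * ⌊log₂ k ⌋ ≤ C₂ * (k * k * k) →
    (∃ λ g → IsG k g × g ≤ N) →
    ∃[ g ] (IsG k g × (k ^ 3 ≤ (C₁ + C₂) * (g ^ 2 * ⌊log₂ k ⌋)) × (g ^ 2 * ⌊log₂ k ⌋ ≤ (C₁ + C₂) * k ^ 3))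
  assemble k 1≤k a≤L N size (g , isG , g≤N) = g , isG ,
    ≤-trans (lower-bound k 1≤k (≤-trans 20≤a a≤L) g (proj₁ isG)) (*-monoˡ-≤ (g ^ 2 * ⌊log₂ k ⌋) (m≤m+n C₁ C₂)) ,
    combine k g N ⌊log₂ k ⌋ g≤N size
  construct : ∀ k → 1 ≤ k → a ≤ ⌊log₂ k ⌋ →
    (∃ λ N → GallaiProperty k N × N * N * ⌊log₂ k ⌋ ≤ C₂ * (k * k * k)) →
    ∃[ g ] (IsG k g × (k ^ 3 ≤ (C₁ + C₂) * (g ^ 2 * ⌊log₂ k ⌋)) × (g ^ 2 * ⌊log₂ k ⌋ ≤ (C₁ + C₂) * k ^ 3))
  construct k 1≤k a≤L (N , property , size) = assemble k 1≤k a≤L N size (isG-exists k N property)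
  bounds : ∀ k → 2 ^ a ≤ k →
    ∃[ g ] (IsG k g × (k ^ 3 ≤ (C₁ + C₂) * (g ^ 2 * ⌊log₂ k ⌋)) × (g ^ 2 * ⌊log₂ k ⌋ ≤ (C₁ + C₂) * k ^ 3))
  bounds k k₀≤k = construct k 1≤k a≤L
    (UpperBound.result Q k ⌊log₂ k ⌋ Q-large (≤-trans a-large a≤L) (2^⌊log₂n⌋≤n k 1≤k))
    where
    1≤k : 1 ≤ k
    1≤k = ≤-trans (m^n>0 2 a) k₀≤k
    a≤L : a ≤ ⌊log₂ k ⌋
    a≤L = ≤⌊log₂⌋ a k k₀≤k

theorem1p2 : ∃[ C ] ∃[ k₀ ] ((k : ℕ) → k₀ ≤ k →
    ∃[ g ] (IsG k g × (k ^ 3 ≤ C * (g ^ 2 * ⌊log₂ k ⌋))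
    × (g ^ 2 * ⌊log₂ k ⌋ ≤ C * k ^ 3)))
theorem1p2 = order-of-g (64 * (13 * (16 * 16))) (2048 * 256) ≤-refl ≤-refl (m≤m+n 20 (2048 * 256 ∸ 20))
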